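{- There is an absolute constant $c>0$ such that for every $\mu_1,\mu_2\ge1$ and $\varepsilon\in(0,1]$, every (possibly randomized) online algorithm for minimizing total flow time on a single machine in the $(\varepsilon,\mu_1,\mu_2)$-online estimate model has competitive ratio at least $c\cdot\frac{\mu_1\mu_2}{\varepsilon}$, even if $\mu_1$, $\mu_2$ and $\varepsilon$ are given to the algorithm up-front.
   Context: Scheduling problem: a finite set of jobs is given; job $j$ has a release time $r_j\in\mathbb Z_{\ge 0}$ and a processing time $p_j\in\mathbb Z_{\ge 1}$. A feasible schedule on a single machine processes, during each unit interval $[t,t+1]$, $t\in\mathbb Z_{\ge0}$, at most one job $j$, which must satisfy $r_j\le t$ and be unfinished; preemption is allowed. The elapsed time $e_j(t)$ is the number of unit intervals before time $t$ in which $j$ was processed; $p_j(t)=p_j-e_j(t)$; the completion time is $C_j=\min\{t: p_j(t)=0\}$, the flow time is $F_j=C_j-r_j$, and the total flow time is $\sum_j F_j$. $(\varepsilon,\mu_1,\mu_2)$-online estimate model: for each job $j$ the adversary chooses, besides $r_j$ and $p_j$, (i) an estimate $\hat p_j\in\mathbb Z_{\ge1}$ with $p_j/\mu_2\le\hat p_j\le\mu_1p_j$, and (ii) an online estimate threshold $q_j\in\mathbb Z_{\ge0}$ with $q_j\le(1-\varepsilon)p_j$. The online algorithm learns of the existence of job $j$ at time $r_j$ (and of no other parameter of $j$); at the first time when it has processed $j$ for $q_j$ units, it is told $\hat p_j$; and it is informed when $j$ completes. No other information is revealed, and decisions at time $t$ may depend only on information revealed up to time $t$ (and on internal randomness). A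 (randomized) algorithm is $\rho$-competitive if on every instance its (expected) total flow time is at most $\rho$ times the minimum total flow time of a feasible offline schedule; the instance is fixed by an oblivious adversary independently of the algorithm's random choices. The competitive ratio is the infimum of such $\rho$ (or $\infty$). -}

module Defs where

open import Data.Bool.Base using (Bool; true; false; not; _∨_; _∧_; if_then_else_)
open import Data.Fin.Base as Fin using (Fin; toℕ)
open import Data.Integer.Base as ℤ using (+_)
open import Data.List.Base as List using (List; []; _∷_; length; filter; allFin)
open import Data.Maybe.Base using (Maybe; just; nothing)
open import Data.Maybe.Properties using (≡-dec)
open import Data.Nat.Base as ℕ using (ℕ; zero; suc)
import Data.Nat.ListAction as ListAction
import Data.Nat.Properties as ℕ
open import Data.Product.Base using (Σ-syntax; ∃; ∃-syntax; _×_; _,_)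
open import Data.Rational.Base as ℚ using (ℚ; 0ℚ; 1ℚ; ½)
import Data.Rational.Properties as ℚ
open import Data.Rational.Solver using (module +-*-Solver)
open import Function.Bundles using (_⇔_)
open import Relation.Binary.PropositionalEquality
  using (_≡_; _≢_; refl; sym; trans; cong; cong₂; subst; _≗_)
open import Relation.Nullary.Decidable using (⌊_⌋)

abs-scale : ∀ {p q b d} → ℚ.∣ p ∣ ℚ.≤ b → ℚ.∣ q ∣ ℚ.≤ d → ℚ.∣ p ℚ.* q ∣ ℚ.≤ b ℚ.* d
abs-scale {p} {q} {b} {d} p≤b q≤d = begin
  ℚ.∣ p ℚ.* q ∣        ≡⟨ ℚ.∣p*q∣≡∣p∣*∣q∣ p q ⟩
  ℚ.∣ p ∣ ℚ.* ℚ.∣ q ∣  ≤⟨ ℚ.*-monoʳ-≤-nonNeg ℚ.∣ q ∣ ⦃ ℚ.nonNegative (ℚ.0≤∣p∣ q) ⦄ p≤b ⟩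
  b ℚ.* ℚ.∣ q ∣        ≤⟨ ℚ.*-monoˡ-≤-nonNeg b ⦃ ℚ.nonNegative (ℚ.≤-trans (ℚ.0≤∣p∣ p) p≤b) ⦄ q≤d ⟩
  b ℚ.* d              ∎
  where open ℚ.≤-Reasoning

abs-add : ∀ {p q b d} → ℚ.∣ p ∣ ℚ.≤ b → ℚ.∣ q ∣ ℚ.≤ d → ℚ.∣ p ℚ.+ q ∣ ℚ.≤ b ℚ.+ d
abs-add {p} {q} p≤b q≤d = ℚ.≤-trans (ℚ.∣p+q∣≤∣p∣+∣q∣ p q) (ℚ.+-mono-≤ p≤b q≤d)

half-pos : ∀ {δ} → 0ℚ ℚ.< δ → 0ℚ ℚ.< ½ ℚ.* δ
half-pos {δ} 0<δ = ℚ.positive⁻¹ (½ ℚ.* δ) ⦃ ℚ.pos*pos⇒pos ½ δ ⦃ ℚ.positive 0<δ ⦄ ⦄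

halves : ∀ δ → ½ ℚ.* δ ℚ.+ ½ ℚ.* δ ≡ δ
halves δ = trans (sym (ℚ.*-distribʳ-+ δ ½ ½)) (ℚ.*-identityˡ δ)

quotient : ∀ {b δ} → 0ℚ ℚ.< b → 0ℚ ℚ.< δ → ∃[ η ] 0ℚ ℚ.< η × b ℚ.* η ≡ δ
quotient {b} {δ} 0<b 0<δ = i ℚ.* δ , ℚ.positive⁻¹ _ ⦃ ℚ.pos*pos⇒pos i δ ⦄ ,
  trans (sym (ℚ.*-assoc b i δ)) (trans (cong (ℚ._* δ) (ℚ.*-inverseʳ b)) (ℚ.*-identityˡ δ))
  where
  instance
    b-pos : ℚ.Positive b
    b-pos = ℚ.positive 0<b
    b-nz : ℚ.NonZero b
    b-nz = ℚ.pos⇒nonZero b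
    δ-pos : ℚ.Positive δ
    δ-pos = ℚ.positive 0<δ
  i : ℚ
  i = ℚ.1/ b
  instance
    i-pos : ℚ.Positive i
    i-pos = ℚ.1/pos⇒pos b

Cauchy : (ℕ → ℚ) → Set
Cauchy x = ∀ δ → 0ℚ ℚ.< δ →
  ∃[ N ] ∀ m n → N ℕ.≤ m → N ℕ.≤ n → ℚ.∣ x m ℚ.- x n ∣ ℚ.≤ δ

-- Representatives of the real numbers; equality of reals is _≃_, not _≡_.
record ℝ : Set where
  constructor mkℝ
  field
    seq    : ℕ → ℚ
    cauchy : Cauchy seq

open ℝ public

infix  4 _≤_ _<_ _≃_ _⟶_
infixl 6 _+_ _-_
infixl 7 _*_
infix  8 -_ 1/_by_

_≤_ : ℝ → ℝ → Set
x ≤ y = ∀ δ → 0ℚ ℚ.< δ → ∃[ N ] ∀ n → N ℕ.≤ n → seq x n ℚ.≤ seq y n ℚ.+ δ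

_<_ : ℝ → ℝ → Set
x < y = ∃[ δ ] 0ℚ ℚ.< δ × ∃[ N ] ∀ n → N ℕ.≤ n → seq x n ℚ.+ δ ℚ.≤ seq y n

_≃_ : ℝ → ℝ → Set
x ≃ y = x ≤ y × y ≤ x

fromℚ : ℚ → ℝ
fromℚ q = mkℝ (λ _ → q) λ δ 0<δ → 0 , λ _ _ _ _ →
  subst (λ z → ℚ.∣ z ∣ ℚ.≤ δ) (sym (ℚ.+-inverseʳ q)) (ℚ.<⇒≤ 0<δ)

fromℕ : ℕ → ℝ
fromℕ n = fromℚ (+ n ℚ./ 1)

0ℝ 1ℝ : ℝ
0ℝ = fromℕ 0
1ℝ = fromℕ 1

_+_ : ℝ → ℝ → ℝ
x + y = mkℝ (λ n → seq x n ℚ.+ seq y n) λ δ 0<δ →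
  let (N₁ , h₁) = cauchy x (½ ℚ.* δ) (half-pos 0<δ)
      (N₂ , h₂) = cauchy y (½ ℚ.* δ) (half-pos 0<δ)
  in N₁ ℕ.⊔ N₂ , λ m n N≤m N≤n →
    subst (ℚ.∣ (seq x m ℚ.+ seq y m) ℚ.- (seq x n ℚ.+ seq y n) ∣ ℚ.≤_) (halves δ)
      (subst (λ z → ℚ.∣ z ∣ ℚ.≤ ½ ℚ.* δ ℚ.+ ½ ℚ.* δ)
        (regroup (seq x m) (seq x n) (seq y m) (seq y n))
        (abs-add (h₁ m n (ℕ.m⊔n≤o⇒m≤o N₁ N₂ N≤m) (ℕ.m⊔n≤o⇒m≤o N₁ N₂ N≤n))
                 (h₂ m n (ℕ.m⊔n≤o⇒n≤o N₁ N₂ N≤m) (ℕ.m⊔n≤o⇒n≤o N₁ N₂ N≤n))))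
  where
  open +-*-Solver
  regroup : ∀ a a′ b b′ → (a ℚ.- a′) ℚ.+ (b ℚ.- b′) ≡ (a ℚ.+ b) ℚ.- (a′ ℚ.+ b′)
  regroup = solve 4 (λ a a′ b b′ → (a :- a′) :+ (b :- b′) := (a :+ b) :- (a′ :+ b′)) refl

-_ : ℝ → ℝ
- x = mkℝ (λ n → ℚ.- seq x n) λ δ 0<δ →
  let (N , h) = cauchy x δ 0<δ
  in N , λ m n N≤m N≤n → subst (ℚ._≤ δ)
    (trans (sym (ℚ.∣-p∣≡∣p∣ _)) (cong ℚ.∣_∣ (ℚ.neg-distrib-+ (seq x m) (ℚ.- seq x n))))
    (h m n N≤m N≤n)

_-_ : ℝ → ℝ → ℝ
x - y = x + (- y)

eventually-bounded : ∀ x → ∃[ b ] 0ℚ ℚ.< b × ∃[ N ] ∀ n → N ℕ.≤ n → ℚ.∣ seq x n ∣ ℚ.≤ b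
eventually-bounded x =
  let (N , h) = cauchy x 1ℚ (ℚ.positive⁻¹ 1ℚ)
      b       = 1ℚ ℚ.+ ℚ.∣ seq x N ∣
  in b , ℚ.+-mono-<-≤ (ℚ.positive⁻¹ 1ℚ) (ℚ.0≤∣p∣ (seq x N)) , N , λ n N≤n →
    subst (λ z → ℚ.∣ z ∣ ℚ.≤ b) (cancel (seq x n) (seq x N))
      (abs-add (h n N N≤n ℕ.≤-refl) ℚ.≤-refl)
  where
  open +-*-Solver
  cancel : ∀ a a′ → (a ℚ.- a′) ℚ.+ a′ ≡ a
  cancel = solve 2 (λ a a′ → (a :- a′) :+ a′ := a) refl

_*_ : ℝ → ℝ → ℝ
x * y = mkℝ (λ n → seq x n ℚ.* seq y n) λ δ 0<δ →
  let (b₁ , 0<b₁ , M₁ , B₁) = eventually-bounded x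
      (b₂ , 0<b₂ , M₂ , B₂) = eventually-bounded y
      (η₁ , 0<η₁ , b₁η₁)    = quotient 0<b₁ (half-pos 0<δ)
      (η₂ , 0<η₂ , b₂η₂)    = quotient 0<b₂ (half-pos 0<δ)
      (N₁ , h₁)             = cauchy x η₂ 0<η₂
      (N₂ , h₂)             = cauchy y η₁ 0<η₁
      M = M₁ ℕ.⊔ M₂
      N = N₁ ℕ.⊔ N₂
  in M ℕ.⊔ N , λ m n ≤m ≤n →
    let M≤m = ℕ.m⊔n≤o⇒m≤o M N ≤m
        M≤n = ℕ.m⊔n≤o⇒m≤o M N ≤n
        N≤m = ℕ.m⊔n≤o⇒n≤o M N ≤m
        N≤n = ℕ.m⊔n≤o⇒n≤o M N ≤n
        xm  = seq x m
        xn  = seq x n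
        ym  = seq y m
        yn  = seq y n
    in subst (ℚ.∣ xm ℚ.* ym ℚ.- xn ℚ.* yn ∣ ℚ.≤_)
         (trans (cong₂ ℚ._+_ b₁η₁ b₂η₂) (halves δ))
         (subst (λ z → ℚ.∣ z ∣ ℚ.≤ b₁ ℚ.* η₁ ℚ.+ b₂ ℚ.* η₂) (regroup xm xn ym yn)
           (abs-add
             (abs-scale (B₁ m (ℕ.m⊔n≤o⇒m≤o M₁ M₂ M≤m))
                        (h₂ m n (ℕ.m⊔n≤o⇒n≤o N₁ N₂ N≤m) (ℕ.m⊔n≤o⇒n≤o N₁ N₂ N≤n)))
             (abs-scale (B₂ n (ℕ.m⊔n≤o⇒n≤o M₁ M₂ M≤n))
                        (h₁ m n (ℕ.m⊔n≤o⇒m≤o N₁ N₂ N≤m) (ℕ.m⊔n≤o⇒m≤o N₁ N₂ N≤n)))))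
  where
  open +-*-Solver
  regroup : ∀ a a′ b b′ → a ℚ.* (b ℚ.- b′) ℚ.+ b′ ℚ.* (a ℚ.- a′) ≡ a ℚ.* b ℚ.- a′ ℚ.* b′
  regroup = solve 4 (λ a a′ b b′ → a :* (b :- b′) :+ b′ :* (a :- a′) := a :* b :- a′ :* b′) refl

module Reciprocal {y d N} (0<d : 0ℚ ℚ.< d) (d≤y : ∀ n → N ℕ.≤ n → 0ℚ ℚ.+ d ℚ.≤ seq y n) where

  instance
    d-pos : ℚ.Positive d
    d-pos = ℚ.positive 0<d

  y⁺ : ℕ → ℚ
  y⁺ n = d ℚ.⊔ seq y n

  y⁺-pos : ∀ n → ℚ.Positive (y⁺ n)
  y⁺-pos n = ℚ.positive (ℚ.<-≤-trans 0<d (ℚ.p≤p⊔q d (seq y n)))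

  y⁺-nz : ∀ n → ℚ.NonZero (y⁺ n)
  y⁺-nz n = ℚ.pos⇒nonZero (y⁺ n) ⦃ y⁺-pos n ⦄

  r : ℕ → ℚ
  r n = (ℚ.1/ y⁺ n) ⦃ y⁺-nz n ⦄

  y⁺≡y : ∀ n → N ℕ.≤ n → y⁺ n ≡ seq y n
  y⁺≡y n N≤n = ℚ.p≤q⇒p⊔q≡q (subst (ℚ._≤ seq y n) (ℚ.+-identityˡ d) (d≤y n N≤n))

  inverse : ∀ n → r n ℚ.* y⁺ n ≡ 1ℚ
  inverse n = ℚ.*-inverseˡ (y⁺ n) ⦃ y⁺-nz n ⦄

  instance
    d-nz : ℚ.NonZero d
    d-nz = ℚ.pos⇒nonZero d

  r-pos : ∀ n → ℚ.Positive (r n)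
  r-pos n = ℚ.1/pos⇒pos (y⁺ n) ⦃ y⁺-pos n ⦄

  1/d-pos : ℚ.Positive (ℚ.1/ d)
  1/d-pos = ℚ.1/pos⇒pos d

  r≤1/d : ∀ n → r n ℚ.≤ ℚ.1/ d
  r≤1/d n = begin
    r n                          ≡⟨ sym (ℚ.*-identityʳ (r n)) ⟩
    r n ℚ.* 1ℚ                   ≡⟨ cong (r n ℚ.*_) (sym (ℚ.*-inverseʳ d)) ⟩
    r n ℚ.* (d ℚ.* ℚ.1/ d)       ≤⟨ ℚ.*-monoˡ-≤-nonNeg (r n) ⦃ ℚ.pos⇒nonNeg (r n) ⦃ r-pos n ⦄ ⦄
                                     (ℚ.*-monoʳ-≤-nonNeg (ℚ.1/ d) ⦃ ℚ.pos⇒nonNeg (ℚ.1/ d) ⦃ 1/d-pos ⦄ ⦄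
                                       (ℚ.p≤p⊔q d (seq y n))) ⟩
    r n ℚ.* (y⁺ n ℚ.* ℚ.1/ d)    ≡⟨ sym (ℚ.*-assoc (r n) (y⁺ n) (ℚ.1/ d)) ⟩
    (r n ℚ.* y⁺ n) ℚ.* ℚ.1/ d    ≡⟨ cong (ℚ._* ℚ.1/ d) (inverse n) ⟩
    1ℚ ℚ.* ℚ.1/ d                ≡⟨ ℚ.*-identityˡ _ ⟩
    ℚ.1/ d                       ∎
    where open ℚ.≤-Reasoning

  ∣r∣≤1/d : ∀ n → ℚ.∣ r n ∣ ℚ.≤ ℚ.1/ d
  ∣r∣≤1/d n = subst (ℚ._≤ ℚ.1/ d)
    (sym (ℚ.0≤p⇒∣p∣≡p (ℚ.<⇒≤ (ℚ.positive⁻¹ (r n) ⦃ r-pos n ⦄)))) (r≤1/d n)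

  difference : ∀ m n → (r m ℚ.* r n) ℚ.* (y⁺ n ℚ.- y⁺ m) ≡ r m ℚ.- r n
  difference m n = trans (regroup (r m) (r n) (y⁺ m) (y⁺ n))
    (cong₂ ℚ._-_ (trans (cong (r m ℚ.*_) (inverse n)) (ℚ.*-identityʳ (r m)))
                 (trans (cong (r n ℚ.*_) (inverse m)) (ℚ.*-identityʳ (r n))))
    where
    open +-*-Solver
    regroup : ∀ a b u v → (a ℚ.* b) ℚ.* (v ℚ.- u) ≡ a ℚ.* (b ℚ.* v) ℚ.- b ℚ.* (a ℚ.* u)
    regroup = solve 4 (λ a b u v → (a :* b) :* (v :- u) := a :* (b :* v) :- b :* (a :* u)) refl

  r-cauchy : Cauchy r
  r-cauchy δ 0<δ =
    let (η , 0<η , eq) = quotient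
          (ℚ.positive⁻¹ (ℚ.1/ d ℚ.* ℚ.1/ d) ⦃ ℚ.pos*pos⇒pos (ℚ.1/ d) ⦃ 1/d-pos ⦄ (ℚ.1/ d) ⦃ 1/d-pos ⦄ ⦄) 0<δ
        (M , h)        = cauchy y η 0<η
    in N ℕ.⊔ M , λ m n ≤m ≤n →
      subst (ℚ.∣ r m ℚ.- r n ∣ ℚ.≤_) eq
        (subst (λ z → ℚ.∣ z ∣ ℚ.≤ (ℚ.1/ d ℚ.* ℚ.1/ d) ℚ.* η) (difference m n)
          (abs-scale (abs-scale (∣r∣≤1/d m) (∣r∣≤1/d n))
            (subst (λ z → ℚ.∣ z ∣ ℚ.≤ η)
              (sym (cong₂ ℚ._-_ (y⁺≡y n (ℕ.m⊔n≤o⇒m≤o N M ≤n)) (y⁺≡y m (ℕ.m⊔n≤o⇒m≤o N M ≤m))))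
              (h n m (ℕ.m⊔n≤o⇒n≤o N M ≤n) (ℕ.m⊔n≤o⇒n≤o N M ≤m)))))

-- The positivity proof supplies a rational d > 0 below almost all terms of y;
-- the reciprocal is taken of max(d, yₙ), which is yₙ for almost all n.
1/_by_ : ∀ y → 0ℝ < y → ℝ
1/ y by (d , 0<d , N , d≤y) = mkℝ (λ n → R.r n) R.r-cauchy
  where module R = Reciprocal {y} {d} {N} 0<d d≤y

Σℝ : ℕ → (ℕ → ℝ) → ℝ
Σℝ zero    f = 0ℝ
Σℝ (suc n) f = Σℝ n f + f n

_⟶_ : (ℕ → ℝ) → ℝ → Set
s ⟶ l = ∀ δ → 0ℝ < δ → ∃[ N ] ∀ n → N ℕ.≤ n → s n ≤ l + δ × l ≤ s n + δ

-- A probability on a Boolean algebra of subsets of Ω, countably additive on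
-- every countable disjoint union that belongs to the algebra.  By
-- Carathéodory's theorem these are exactly the restrictions of probability
-- measures to generating algebras; in particular every probability space is
-- one.  Closure under arbitrary countable unions is not demanded because,
-- constructively, such a union of Bool-valued predicates need not be Bool-valued.
record ProbabilitySpace : Set₁ where
  field
    Ω       : Set
    IsEvent : (Ω → Bool) → Set

    event-cong : ∀ {A B} → A ≗ B → IsEvent A → IsEvent B
    event-full : IsEvent (λ _ → true)
    event-not  : ∀ {A} → IsEvent A → IsEvent (λ ω → not (A ω))
    event-or   : ∀ {A B} → IsEvent A → IsEvent B → IsEvent (λ ω → A ω ∨ B ω)

    ℙ          : ∀ A → IsEvent A → ℝ
    ℙ-cong     : ∀ {A B} (a : IsEvent A) (b : IsEvent B) → A ≗ B → ℙ A a ≃ ℙ B b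
    ℙ-nonneg   : ∀ {A} (a : IsEvent A) → 0ℝ ≤ ℙ A a
    ℙ-full     : ℙ (λ _ → true) event-full ≃ 1ℝ
    ℙ-additive : ∀ {A B} (a : IsEvent A) (b : IsEvent B) →
                 (∀ ω → A ω ∧ B ω ≡ false) →
                 ℙ (λ ω → A ω ∨ B ω) (event-or a b) ≃ ℙ A a + ℙ B b
    ℙ-σ-additive : (A : ℕ → Ω → Bool) (a : ∀ i → IsEvent (A i)) →
                   (∀ i j → i ≢ j → ∀ ω → A i ω ∧ A j ω ≡ false) →
                   ∀ {U} (u : IsEvent U) →
                   (∀ ω → U ω ≡ true ⇔ (∃[ i ] A i ω ≡ true)) →
                   (λ n → Σℝ n (λ i → ℙ (A i) (a i))) ⟶ ℙ U u

module _ (S : ProbabilitySpace) where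
  open ProbabilitySpace S

  record SimpleVariable : Set where
    field
      value      : Ω → ℕ
      bound      : ℕ
      bounded    : ∀ ω → value ω ℕ.≤ bound
      measurable : ∀ v → IsEvent (λ ω → value ω ℕ.≡ᵇ v)

    mean : ℝ
    mean = Σℝ (suc bound) (λ v → fromℕ v * ℙ (λ ω → value ω ℕ.≡ᵇ v) (measurable v))

  -- X ω F says that an (ℕ ∪ {∞})-valued random variable X takes the value F
  -- at ω, with value ∞ when there is no such F.  Its expectation, the supremum
  -- of the means of the simple variables below it, is at most b.
  Expectation≤ : (Ω → ℕ → Set) → ℝ → Set
  Expectation≤ X b =
    (s : SimpleVariable) → (∀ ω F → X ω F → SimpleVariable.value s ω ℕ.≤ F) →
    SimpleVariable.mean s ≤ b

-- Jobs are numbered in order of release (ties broken by the adversary), so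
-- that the number under which an algorithm sees a job reveals nothing about
-- the jobs still to come.
record Instance : Set where
  field
    #jobs      : ℕ
    release    : Fin #jobs → ℕ
    processing : Fin #jobs → ℕ
    estimate   : Fin #jobs → ℕ
    threshold  : Fin #jobs → ℕ

    processing≥1 : ∀ j → 1 ℕ.≤ processing j
    estimate≥1   : ∀ j → 1 ℕ.≤ estimate j
    sorted       : ∀ {i j} → i Fin.≤ j → release i ℕ.≤ release j

open Instance public

-- estimate-lower is pⱼ / μ₂ ≤ p̂ⱼ with the denominator μ₂ > 0 cleared.
record InModel (ε μ₁ μ₂ : ℝ) (I : Instance) : Set where
  field
    estimate-upper  : ∀ j → fromℕ (estimate I j) ≤ μ₁ * fromℕ (processing I j)
    estimate-lower  : ∀ j → fromℕ (processing I j) ≤ μ₂ * fromℕ (estimate I j)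
    threshold-upper : ∀ j → fromℕ (threshold I j) ≤ (1ℝ - ε) * fromℕ (processing I j)

-- What the machine does in one unit interval: process the job with the given
-- number, or idle.
Decision : Set
Decision = Maybe ℕ

Schedule : Set
Schedule = ℕ → Decision

-- The decisions before time t, latest first.
before : Schedule → ℕ → List Decision
before σ zero    = []
before σ (suc t) = σ t ∷ before σ t

module _ (I : Instance) where

  elapsed : List Decision → Fin (#jobs I) → ℕ
  elapsed ds j = length (filter (λ d → ≡-dec ℕ._≟_ d (just (toℕ j))) ds)

  remaining : List Decision → Fin (#jobs I) → ℕ
  remaining ds j = processing I j ℕ.∸ elapsed ds j

  Feasible : Schedule → Set
  Feasible σ = ∀ t i → σ t ≡ just i →
    ∃[ j ] toℕ j ≡ i × release I j ℕ.≤ t × remaining (before σ t) j ≢ 0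

  IsCompletionTime : Schedule → Fin (#jobs I) → ℕ → Set
  IsCompletionTime σ j C =
    remaining (before σ C) j ≡ 0 × (∀ t → t ℕ.< C → remaining (before σ t) j ≢ 0)

  -- Holds for no F if some job is never completed.
  TotalFlow : Schedule → ℕ → Set
  TotalFlow σ F = Σ[ C ∈ (Fin (#jobs I) → ℕ) ]
    (∀ j → IsCompletionTime σ j (C j)) ×
    F ≡ ListAction.sum (List.map (λ j → C j ℕ.∸ release I j) (allFin (#jobs I)))

  IsOptimalFlow : ℕ → Set
  IsOptimalFlow F = (∃[ σ ] Feasible σ × TotalFlow σ F) ×
    (∀ σ F′ → Feasible σ → TotalFlow σ F′ → F ℕ.≤ F′)

record JobStatus : Set where
  constructor status
  field
    revealedEstimate : Maybe ℕ
    completed        : Bool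

-- The statuses of the jobs released so far, in the order of their numbers.
Observation : Set
Observation = List JobStatus

-- Everything revealed up to the current time: the current observation, and the
-- observation and decision of every earlier time, latest first.
record History : Set where
  constructor history
  field
    now  : Observation
    past : List (Observation × Decision)

Policy : Set
Policy = History → Decision

module _ (I : Instance) where

  -- The current time is the number of decisions already made.
  observe : List Decision → Observation
  observe ds = List.map jobStatus
    (filter (λ j → release I j ℕ.≤? length ds) (allFin (#jobs I)))
    where
    jobStatus : Fin (#jobs I) → JobStatus
    jobStatus j = status
      (if threshold I j ℕ.≤ᵇ elapsed I ds j then just (estimate I j) else nothing)
      (remaining I ds j ℕ.≡ᵇ 0)

  pastOf : List Decision → List (Observation × Decision)
  pastOf []       = []
  pastOf (d ∷ ds) = (observe ds , d) ∷ pastOf ds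

  historyOf : List Decision → History
  historyOf ds = history (observe ds) (pastOf ds)

  decisions : Policy → ℕ → List Decision
  decisions π zero    = []
  decisions π (suc t) = π (historyOf (decisions π t)) ∷ decisions π t

  run : Policy → Schedule
  run π t = π (historyOf (decisions π t))

-- A random choice of policy, made independently of the instance.  A
-- deterministic algorithm is the case of a one-point space.
record OnlineAlgorithm (ε μ₁ μ₂ : ℝ) : Set₁ where
  field
    space : ProbabilitySpace

  open ProbabilitySpace space public

  field
    policy     : Ω → Policy
    measurable : ∀ h d → IsEvent (λ ω → ⌊ ≡-dec ℕ._≟_ (policy ω h) d ⌋)
    feasible   : ∀ I → InModel ε μ₁ μ₂ I → ∀ ω → Feasible I (run I (policy ω))

module _ {ε μ₁ μ₂ : ℝ} (A : OnlineAlgorithm ε μ₁ μ₂) where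
  open OnlineAlgorithm A

  Competitive : ℝ → Set
  Competitive ρ = ∀ I → InModel ε μ₁ μ₂ I → ∀ F → IsOptimalFlow I F →
    Expectation≤ space (λ ω → TotalFlow I (run I (policy ω))) (ρ * fromℕ F)

  -- b is a lower bound of the set whose infimum is the competitive ratio.
  CompetitiveRatio≥ : ℝ → Set
  CompetitiveRatio≥ b = ∀ ρ → Competitive ρ → b ≤ ρ

{-# OPTIONS --safe #-}
-- Choose integers a ≤ μ₁, b ≤ μ₂, s ≤ 1/ε within a factor 3 and put K = a b s.
-- Job sizes are independent, geometric with parameter 1/2 and truncated at K, so
-- they are memoryless: as long as a job is not about to be finished, nothing
-- revealed to the algorithm says how much of it remains.  Hence at a fixed time T
-- the expected number of its unfinished jobs is at least a third of the expected
-- volume left, whereas the optimum keeps the left-over volume in jobs of size K.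
-- A long stream of unit jobs starting at T turns the numbers of unfinished jobs
-- into total flow times, which then differ by a factor of order K.  Averaging over
-- the sizes gives, for any randomized algorithm, the same bound on some instance.
module Submission where

open import Data.Bool.Base as Bool using (Bool; true; false; not; _∨_; _∧_; if_then_else_)
open import Data.Bool.Properties using (∧-comm; ∨-identityʳ)
open import Data.Empty using (⊥-elim)
open import Data.Fin.Base as Fin using (Fin; zero; suc; toℕ; fromℕ<)
open import Data.Fin.Properties using (any?; toℕ<n; toℕ-fromℕ<)
open import Data.List.Base using (List; []; _∷_; _++_; length; filter; map; allFin; tabulate)
open import Data.List.Properties using (map-cong; map-tabulate)
open import Data.Maybe.Base using (Maybe; just; nothing)
open import Data.Maybe.Properties using (≡-dec; just-injective)
open import Data.Nat.Base as ℕ using (ℕ; zero; suc; z≤n; s≤s)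
import Data.Nat.ListAction as ListAction
import Data.Nat.Properties as ℕ
open import Data.Nat.Tactic.RingSolver using (solve-∀)
open import Data.Product.Base using (Σ-syntax; ∃-syntax; _×_; _,_; proj₁; proj₂)
open import Data.Sum.Base using (_⊎_; inj₁; inj₂; [_,_]′)
open import Data.Vec.Base using (Vec; []; _∷_; lookup; replicate; _[_]≔_)
open import Function.Base using (_∘_; id)
open import Relation.Binary.PropositionalEquality
open import Relation.Nullary using (¬_; Dec; yes; no; does)
open import Relation.Nullary.Decidable using (⌊_⌋; isYes≗does; dec-true; dec-false; _×-dec_)

-- Averages over truncated geometric sizes

-- Three obstacles shape the argument. Hiding must be legal: a single estimate `a * s` has to serve
-- all sizes from `s` to `K`. It may exceed the size by the factor `a` and fall short of it by the
-- factor `b`, which gives `K = a b s`; that `s - 1` units of work pass before it appears is legal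
-- because `s ε ≤ 1`. The optimum needs almost all volume of the smaller jobs to fit before `T`,
-- while `T` must leave a constant fraction of the volume of the size-`K` jobs. Expectations alone
-- do not give this, so a second-moment bound controls the expected overflow. Finally, the total
-- flow time may be infinite and depends on the whole run. It is replaced by a multiple of the
-- number of jobs unfinished at `T`, a function of finitely many decisions and thus a simple random
-- variable, so that exchanging the averages over sizes and over random choices needs finite sums
-- only. Averages over sizes are kept as natural numbers, scaled by the total weight `(2 ^ k) ^ n`.

module Averages where
  open import Data.Nat.Base
  open import Data.Nat.Properties
  open import Algebra.Properties.CommutativeMonoid.Sum +-0-commutativeMonoid public using (sum; sum-cong-≗; ∑-distrib-+)

  sum-mono : ∀ {n} {f g : Fin n → ℕ} → (∀ i → f i ≤ g i) → sum f ≤ sum g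
  sum-mono {zero}  f≤g = z≤n
  sum-mono {suc n} f≤g = +-mono-≤ (f≤g zero) (sum-mono (f≤g ∘ suc))

  sum-+-≤ : ∀ {n} (f g : Fin n → ℕ) {h : Fin n → ℕ} → (∀ i → h i ≤ f i + g i) → sum h ≤ sum f + sum g
  sum-+-≤ f g h≤ = ≤-trans (sum-mono h≤) (≤-reflexive (∑-distrib-+ f g))

  sum-const : ∀ n c → sum {n} (λ _ → c) ≡ n * c
  sum-const zero    c = refl
  sum-const (suc n) c = cong (c +_) (sum-const n c)

  sum-* : ∀ {n} c (f : Fin n → ℕ) → sum (λ i → c * f i) ≡ c * sum f
  sum-* {zero}  c f = sym (*-zeroʳ c)
  sum-* {suc n} c f = trans (cong (c * f zero +_) (sum-* c (f ∘ suc))) (sym (*-distribˡ-+ c (f zero) _))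

  sum-split : ∀ n m (f : ℕ → ℕ) →
              sum {n + m} (f ∘ toℕ) ≡ sum {n} (f ∘ toℕ) + sum {m} (λ i → f (n + toℕ i))
  sum-split zero    m f = refl
  sum-split (suc n) m f = trans (cong (f 0 +_) (sum-split n m (f ∘ suc))) (sym (+-assoc (f 0) _ _))

  -- The indicator of a nonzero amount: summed over remaining processing times it counts unfinished
  -- jobs.
  pos : ℕ → ℕ
  pos x = 1 ⊓ x

  pos≤ : ∀ x → pos x ≤ x
  pos≤ x = m⊓n≤n 1 x

  pos-mono : ∀ {x y} → x ≤ y → pos x ≤ pos y
  pos-mono = ⊓-monoʳ-≤ 1

  pos-≥1 : ∀ {x} → 1 ≤ x → pos x ≡ 1
  pos-≥1 (s≤s _) = refl

  weightedSum : ∀ {A : Set} → List (ℕ × A) → (A → ℕ) → ℕ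
  weightedSum []            f = 0
  weightedSum ((w , a) ∷ l) f = w * f a + weightedSum l f

  weightedSum-++ : ∀ {A} (l l′ : List (ℕ × A)) f → weightedSum (l ++ l′) f ≡ weightedSum l f + weightedSum l′ f
  weightedSum-++ []            l′ f = refl
  weightedSum-++ ((w , a) ∷ l) l′ f = trans (cong (w * f a +_) (weightedSum-++ l l′ f)) (sym (+-assoc (w * f a) _ _))

  -- 2ᵏ times the expectation of f (i) for a truncated geometric variable i:
  -- i has probability 2⁻ⁱ⁻¹ for i < k, and k has probability 2⁻ᵏ.
  G : ∀ k → (Fin (suc k) → ℕ) → ℕ
  G zero    f = f zero
  G (suc k) f = 2 ^ k * f zero + G k (f ∘ suc)

  G-mono : ∀ k {f g} → (∀ i → f i ≤ g i) → G k f ≤ G k g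
  G-mono zero    f≤g = f≤g zero
  G-mono (suc k) f≤g = +-mono-≤ (*-monoʳ-≤ (2 ^ k) (f≤g zero)) (G-mono k (f≤g ∘ suc))

  G-cong : ∀ k {f g} → (∀ i → f i ≡ g i) → G k f ≡ G k g
  G-cong k f≡g = ≤-antisym (G-mono k (≤-reflexive ∘ f≡g)) (G-mono k (≤-reflexive ∘ sym ∘ f≡g))

  G-+ : ∀ k f g → G k (λ i → f i + g i) ≡ G k f + G k g
  G-+ zero    f g = refl
  G-+ (suc k) f g = trans (cong (2 ^ k * (f zero + g zero) +_) (G-+ k (f ∘ suc) (g ∘ suc)))
                          (regroup (2 ^ k) (f zero) (g zero) _ _)
    where
    regroup : ∀ w a b c d → w * (a + b) + (c + d) ≡ w * a + c + (w * b + d)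
    regroup = solve-∀

  G-* : ∀ k c f → G k (λ i → c * f i) ≡ c * G k f
  G-* zero    c f = refl
  G-* (suc k) c f = trans (cong (2 ^ k * (c * f zero) +_) (G-* k c (f ∘ suc))) (regroup (2 ^ k) c (f zero) _)
    where
    regroup : ∀ w c x y → w * (c * x) + c * y ≡ c * (w * x + y)
    regroup = solve-∀

  G-const : ∀ k c → G k (λ _ → c) ≡ 2 ^ k * c
  G-const zero    c = sym (*-identityˡ c)
  G-const (suc k) c = trans (cong (2 ^ k * c +_) (G-const k c)) (regroup (2 ^ k) c)
    where
    regroup : ∀ w c → w * c + w * c ≡ 2 * w * c
    regroup = solve-∀

  -- The size `suc i` exceeds `j` with probability 2⁻ʲ for every `j ≤ k`, so its mean is `2 - 2⁻ᵏ`.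
  G-size : ∀ k → G k (λ i → suc (toℕ i)) ≤ 2 * 2 ^ k
  G-size zero    = s≤s z≤n
  G-size (suc k) = begin
    2 ^ k * 1 + G k (λ i → 1 + suc (toℕ i))     ≡⟨ cong (2 ^ k * 1 +_) (G-+ k (λ _ → 1) (suc ∘ toℕ)) ⟩
    2 ^ k * 1 + (G k (λ _ → 1) + G k (suc ∘ toℕ)) ≤⟨ +-monoʳ-≤ (2 ^ k * 1) (+-mono-≤ (≤-reflexive (G-const k 1)) (G-size k)) ⟩
    2 ^ k * 1 + (2 ^ k * 1 + 2 * 2 ^ k)         ≡⟨ regroup (2 ^ k) ⟩
    2 * (2 * 2 ^ k)                             ∎
    where
    open ≤-Reasoning
    regroup : ∀ w → w * 1 + (w * 1 + 2 * w) ≡ 2 * (2 * w)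
    regroup = solve-∀

  -- Given that the size exceeds `c`, the excess is again a truncated geometric size, of mean at
  -- most 2. Each step of the induction removes one coin toss from both `k` and `c`.
  G-excess : ∀ k c → G k (λ i → suc (toℕ i) ∸ c) ≤ 2 * G k (λ i → pos (suc (toℕ i) ∸ c))
  G-excess k       zero    = ≤-trans (G-size k) (≤-reflexive (cong (2 *_) (sym (trans (G-const k 1) (*-identityʳ (2 ^ k))))))
  G-excess zero    (suc c) = ≤-trans (≤-reflexive (0∸n≡0 c)) z≤n
  G-excess (suc k) (suc c) = begin
    2 ^ k * (0 ∸ c) + G k (λ i → suc (toℕ i) ∸ c)      ≡⟨ cong (_+ G k (λ i → suc (toℕ i) ∸ c)) (trans (cong (2 ^ k *_) (0∸n≡0 c)) (*-zeroʳ (2 ^ k))) ⟩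
    G k (λ i → suc (toℕ i) ∸ c)                        ≤⟨ G-excess k c ⟩
    2 * G k (λ i → pos (suc (toℕ i) ∸ c))              ≤⟨ *-monoʳ-≤ 2 (m≤n+m (G k (λ i → pos (suc (toℕ i) ∸ c))) (2 ^ k * pos (0 ∸ c))) ⟩
    2 * (2 ^ k * pos (0 ∸ c) + G k (λ i → pos (suc (toℕ i) ∸ c)))  ∎
    where open ≤-Reasoning

  -- e i is the work done on a job of size suc i, which cannot be told apart from
  -- any other size of at least e i + 2.
  G-memoryless : ∀ k (e : Fin (suc k) → ℕ) →
    (∀ i j → 2 + e i ≤ suc (toℕ i) → 2 + e i ≤ suc (toℕ j) → e j ≡ e i) →
    G k (λ i → suc (toℕ i) ∸ e i) ≤ 3 * G k (λ i → pos (suc (toℕ i) ∸ e i))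
  G-memoryless k e const = cases (any? (λ i → 2 + e i ≤? suc (toℕ i)))
    where
    open ≤-Reasoning
    alive = λ i → pos (suc (toℕ i) ∸ e i)
    x≤1⇒x≤pos : ∀ {x} → x ≤ 1 → x ≤ pos x
    x≤1⇒x≤pos z≤n       = z≤n
    x≤1⇒x≤pos (s≤s z≤n) = s≤s z≤n
    short : ∀ i → ¬ 2 + e i ≤ suc (toℕ i) → suc (toℕ i) ∸ e i ≤ alive i
    short i ≰ = x≤1⇒x≤pos (m≤n+o⇒m∸n≤o (suc (toℕ i)) (e i) (subst (suc (toℕ i) ≤_) (+-comm 1 (e i)) (≤-pred (≰⇒> ≰))))
    cases : Dec (∃[ i ] 2 + e i ≤ suc (toℕ i)) → _
    cases (no none) = ≤-trans (G-mono k (λ i → short i (λ h → none (i , h)))) (m≤n*m (G k alive) 3)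
    -- All jobs with two or more units left have received the same work `e₀`. Their remainder is one
    -- unit, paid by `alive`, plus the excess over `suc e₀`, whose mean is at most twice the chance
    -- that it is positive: together the factor 3.
    cases (yes (i₀ , h₀)) = begin
      G k (λ i → suc (toℕ i) ∸ e i)                        ≤⟨ G-mono k bound ⟩
      G k (λ i → alive i + (suc (toℕ i) ∸ suc e₀))         ≡⟨ G-+ k alive (λ i → suc (toℕ i) ∸ suc e₀) ⟩
      G k alive + G k (λ i → suc (toℕ i) ∸ suc e₀)         ≤⟨ +-monoʳ-≤ (G k alive) (G-excess k (suc e₀)) ⟩
      G k alive + 2 * G k (λ i → pos (suc (toℕ i) ∸ suc e₀))  ≤⟨ +-monoʳ-≤ (G k alive) (*-monoʳ-≤ 2 (G-mono k excess)) ⟩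
      G k alive + 2 * G k alive                            ≡⟨⟩
      3 * G k alive                                        ∎
      where
      e₀ = e i₀
      -- `const` measures both sizes against the work of its first argument, which therefore has to
      -- be the job with less work.
      long : ∀ i → 2 + e i ≤ suc (toℕ i) → e i ≡ e₀
      long i h with ≤-total (e i) e₀
      ... | inj₁ ei≤ = sym (const i i₀ h (≤-trans (s≤s (s≤s ei≤)) h₀))
      ... | inj₂ e₀≤ = const i₀ i h₀ (≤-trans (s≤s (s≤s e₀≤)) h)
      bound : ∀ i → suc (toℕ i) ∸ e i ≤ alive i + (suc (toℕ i) ∸ suc e₀)
      bound i with 2 + e i ≤? suc (toℕ i)
      ... | no  ≰ = ≤-trans (short i ≰) (m≤m+n (alive i) _)
      ... | yes h = begin
        suc (toℕ i) ∸ e i                     ≤⟨ step (suc (toℕ i)) (e i) ⟩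
        1 + (suc (toℕ i) ∸ suc (e i))         ≡⟨ cong₂ (λ x y → x + (suc (toℕ i) ∸ suc y)) (sym (pos-≥1 (m<n⇒0<n∸m (≤-trans (n≤1+n _) h)))) (long i h) ⟩
        alive i + (suc (toℕ i) ∸ suc e₀)      ∎
        where
        step : ∀ x y → x ∸ y ≤ 1 + (x ∸ suc y)
        step x y = subst (λ z → x ∸ y ≤ 1 + z) (trans (∸-+-assoc x y 1) (cong (x ∸_) (+-comm y 1))) (m≤n+m∸n (x ∸ y) 1)
      excess : ∀ i → pos (suc (toℕ i) ∸ suc e₀) ≤ alive i
      excess i with 2 + e₀ ≤? suc (toℕ i)
      ... | yes h = pos-mono (∸-monoʳ-≤ {e i} {suc e₀} (suc (toℕ i)) (≤-trans (≤-reflexive (const i₀ i h₀ h)) (n≤1+n e₀)))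
      ... | no  ≰ = ≤-trans (≤-reflexive (cong pos (m≤n⇒m∸n≡0 (≤-pred (≰⇒> ≰))))) z≤n

  module _ (k : ℕ) where

    -- `(2 ^ k) ^ n` times the expectation over `n` independent sizes.
    E : ∀ n → (Vec (Fin (suc k)) n → ℕ) → ℕ
    E zero    f = f []
    E (suc n) f = G k (λ p → E n (λ v → f (p ∷ v)))

    E-mono : ∀ n {f g} → (∀ v → f v ≤ g v) → E n f ≤ E n g
    E-mono zero    f≤g = f≤g []
    E-mono (suc n) f≤g = G-mono k (λ p → E-mono n (λ v → f≤g (p ∷ v)))

    E-cong : ∀ n {f g} → (∀ v → f v ≡ g v) → E n f ≡ E n g
    E-cong n f≡g = ≤-antisym (E-mono n (≤-reflexive ∘ f≡g)) (E-mono n (≤-reflexive ∘ sym ∘ f≡g))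

    E-+ : ∀ n f g → E n (λ v → f v + g v) ≡ E n f + E n g
    E-+ zero    f g = refl
    E-+ (suc n) f g = trans (G-cong k (λ p → E-+ n (λ v → f (p ∷ v)) (λ v → g (p ∷ v)))) (G-+ k _ _)

    E-* : ∀ n c f → E n (λ v → c * f v) ≡ c * E n f
    E-* zero    c f = refl
    E-* (suc n) c f = trans (G-cong k (λ p → E-* n c (λ v → f (p ∷ v)))) (G-* k c _)

    E-const : ∀ n c → E n (λ _ → c) ≡ (2 ^ k) ^ n * c
    E-const zero    c = sym (*-identityˡ c)
    E-const (suc n) c = trans (G-cong k (λ _ → E-const n c))
      (trans (G-const k _) (sym (*-assoc (2 ^ k) ((2 ^ k) ^ n) c)))

    E-zero : ∀ n → E n (λ _ → 0) ≡ 0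
    E-zero n = trans (E-const n 0) (*-zeroʳ ((2 ^ k) ^ n))

    E-sum : ∀ n {m} (f : Fin m → Vec (Fin (suc k)) n → ℕ) → E n (λ v → sum (λ j → f j v)) ≡ sum (λ j → E n (f j))
    E-sum n {zero}  f = E-zero n
    E-sum n {suc m} f = trans (E-+ n (f zero) _) (cong (E n (f zero) +_) (E-sum n (f ∘ suc)))

    -- By linearity the scaled mean is `n * G k g * (2 ^ k) ^ (n - 1)`; the extra factor `2 ^ k` on
    -- both sides avoids the predecessor.
    E-statistic : ∀ n (g : Fin (suc k) → ℕ) →
      E n (λ v → sum (λ j → g (lookup v j))) * 2 ^ k ≡ n * G k g * (2 ^ k) ^ n
    E-statistic zero    g = refl
    E-statistic (suc n) g = begin
      G k (λ p → E n (λ v → g p + stat v)) * W          ≡⟨ cong (_* W) (G-cong k (λ p → trans (E-+ n (λ _ → g p) stat) (cong (_+ E n stat) (E-const n (g p))))) ⟩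
      G k (λ p → W ^ n * g p + E n stat) * W            ≡⟨ cong (_* W) (trans (G-+ k _ _) (cong₂ _+_ (G-* k (W ^ n) g) (G-const k (E n stat)))) ⟩
      (W ^ n * G k g + W * E n stat) * W                ≡⟨ regroup (W ^ n) (G k g) W (E n stat) ⟩
      W ^ n * G k g * W + W * (E n stat * W)            ≡⟨ cong (λ z → W ^ n * G k g * W + W * z) (E-statistic n g) ⟩
      W ^ n * G k g * W + W * (n * G k g * W ^ n)       ≡⟨ regroup′ (W ^ n) (G k g) W n ⟩
      suc n * G k g * (W * W ^ n)                       ∎
      where
      open ≡-Reasoning
      W = 2 ^ k
      stat : Vec (Fin (suc k)) n → ℕ
      stat v = sum (λ j → g (lookup v j))
      regroup : ∀ a b w c → (a * b + w * c) * w ≡ a * b * w + w * (c * w)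
      regroup = solve-∀
      regroup′ : ∀ a b w n → a * b * w + w * (n * b * a) ≡ suc n * b * (w * a)
      regroup′ = solve-∀

    G-E-swap : ∀ n m (f : Fin (suc m) → Vec (Fin (suc k)) n → ℕ) → G m (λ p → E n (f p)) ≡ E n (λ v → G m (λ p → f p v))
    G-E-swap n zero    f = refl
    G-E-swap n (suc m) f = begin
      2 ^ m * E n (f zero) + G m (λ p → E n (f (suc p)))               ≡⟨ cong₂ _+_ (sym (E-* n (2 ^ m) (f zero))) (G-E-swap n m (f ∘ suc)) ⟩
      E n (λ v → 2 ^ m * f zero v) + E n (λ v → G m (λ p → f (suc p) v)) ≡⟨ sym (E-+ n _ _) ⟩
      E n (λ v → G (suc m) (λ p → f p v))                              ∎
      where open ≡-Reasoning

    -- Conditioning on all sizes but the `j`-th, with `G-E-swap` as Fubini. The entry of `v` at `j`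
    -- is overwritten, hence the dummy `zero` in the proof.
    E-conditional : ∀ n (j : Fin n) f g → (∀ v → G k (λ p → f (v [ j ]≔ p)) ≤ G k (λ p → g (v [ j ]≔ p))) →
                    E n f ≤ E n g
    E-conditional (suc n) zero f g h = begin
      G k (λ p → E n (λ v → f (p ∷ v)))    ≡⟨ G-E-swap n k (λ p v → f (p ∷ v)) ⟩
      E n (λ v → G k (λ p → f (p ∷ v)))    ≤⟨ E-mono n (λ v → h (zero ∷ v)) ⟩
      E n (λ v → G k (λ p → g (p ∷ v)))    ≡⟨ G-E-swap n k (λ p v → g (p ∷ v)) ⟨
      G k (λ p → E n (λ v → g (p ∷ v)))    ∎
      where open ≤-Reasoning
    E-conditional (suc n) (suc j) f g h =
      G-mono k (λ p → E-conditional n j (λ v → f (p ∷ v)) (λ v → g (p ∷ v)) (λ v → h (p ∷ v)))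

    private
      prepend : ∀ {A B : Set} → ℕ → (A → B) → List (ℕ × A) → List (ℕ × B)
      prepend c f []            = []
      prepend c f ((w , a) ∷ l) = (c * w , f a) ∷ prepend c f l

      prepend-sum : ∀ {A B : Set} c (f : A → B) l g → weightedSum (prepend c f l) g ≡ c * weightedSum l (g ∘ f)
      prepend-sum c f []            g = sym (*-zeroʳ c)
      prepend-sum c f ((w , a) ∷ l) g = trans (cong (c * w * g (f a) +_) (prepend-sum c f l g)) (regroup c w (g (f a)) _)
        where
        regroup : ∀ c w x y → c * w * x + c * y ≡ c * (w * x + y)
        regroup = solve-∀

    G-list : ∀ m {A : Set} (l : List (ℕ × A)) {B : Set} (h : Fin (suc m) → A → B) →
             ∃[ l′ ] ∀ (f : B → ℕ) → weightedSum l′ f ≡ G m (λ p → weightedSum l (f ∘ h p))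
    G-list zero    l h = prepend 1 (h zero) l , λ f → trans (prepend-sum 1 (h zero) l f) (*-identityˡ _)
    G-list (suc m) l h = let (l′ , eq) = G-list m l (h ∘ suc) in
      prepend (2 ^ m) (h zero) l ++ l′ ,
      λ f → trans (weightedSum-++ (prepend (2 ^ m) (h zero) l) l′ f) (cong₂ _+_ (prepend-sum (2 ^ m) (h zero) l f) (eq f))

    -- As an explicit list of weighted outcomes, the average over sizes can be exchanged with an
    -- expectation over `Ω` by induction on the list.
    E-list : ∀ n → ∃[ l ] ∀ f → weightedSum l f ≡ E n f
    E-list zero    = (1 , []) ∷ [] , λ f → trans (+-identityʳ _) (*-identityˡ (f []))
    E-list (suc n) =
      let (l , eq)   = E-list n
          (l′ , eq′) = G-list k l _∷_
      in l′ , λ f → trans (eq′ f) (G-cong k (λ p → eq (f ∘ (p ∷_))))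

-- Concentration of sums of independent sizes

module Variance where
  open import Data.Integer.Base as ℤ using (ℤ; +_)
  import Data.Integer.Properties as ℤ
  import Data.Integer.Tactic.RingSolver as ℤ-RingSolver
  open import Data.Nat.Base
  open import Data.Nat.Properties
  open Averages

  sq : ℤ → ℕ
  sq z = ℤ.∣ z ∣ * ℤ.∣ z ∣

  +sq : ∀ z → + sq z ≡ z ℤ.* z
  +sq (+ n)      = ℤ.pos-* n n
  +sq ℤ.-[1+ n ] = refl

  -- The signed counterpart of `G`, since deviations from the mean take both signs.
  Gℤ : ∀ k → (Fin (suc k) → ℤ) → ℤ
  Gℤ zero    f = f zero
  Gℤ (suc k) f = + (2 ^ k) ℤ.* f zero ℤ.+ Gℤ k (f ∘ suc)

  Gℤ-cong : ∀ k {f g} → (∀ i → f i ≡ g i) → Gℤ k f ≡ Gℤ k g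
  Gℤ-cong zero    f≡g = f≡g zero
  Gℤ-cong (suc k) f≡g = cong₂ (λ x y → + (2 ^ k) ℤ.* x ℤ.+ y) (f≡g zero) (Gℤ-cong k (f≡g ∘ suc))

  +G : ∀ k f → + G k f ≡ Gℤ k (λ i → + f i)
  +G zero    f = refl
  +G (suc k) f = cong₂ ℤ._+_ (ℤ.pos-* (2 ^ k) (f zero)) (+G k (f ∘ suc))

  Gℤ-linear : ∀ k a b f g → Gℤ k (λ i → a ℤ.* f i ℤ.+ b ℤ.* g i) ≡ a ℤ.* Gℤ k f ℤ.+ b ℤ.* Gℤ k g
  Gℤ-linear zero    a b f g = refl
  Gℤ-linear (suc k) a b f g = trans (cong (ℤ._+_ (+ (2 ^ k) ℤ.* (a ℤ.* f zero ℤ.+ b ℤ.* g zero))) (Gℤ-linear k a b (f ∘ suc) (g ∘ suc)))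
    (regroup (+ (2 ^ k)) a b (f zero) (g zero) _ _)
    where
    regroup : ∀ w a b x y X Y → w ℤ.* (a ℤ.* x ℤ.+ b ℤ.* y) ℤ.+ (a ℤ.* X ℤ.+ b ℤ.* Y) ≡ a ℤ.* (w ℤ.* x ℤ.+ X) ℤ.+ b ℤ.* (w ℤ.* y ℤ.+ Y)
    regroup = ℤ-RingSolver.solve-∀

  module _ (k : ℕ) where

    private
      W : ℕ
      W = 2 ^ k

    -- Expanding the square, the cross term is `2 a` times the mean of `y`, which is zero.
    G-sq : ∀ (y : Fin (suc k) → ℤ) b → Gℤ k y ≡ + 0 → (∀ p → sq (y p) ≤ b) →
           ∀ a → G k (λ p → sq (a ℤ.+ y p)) ≤ W * (sq a + b)
    G-sq y b Gy≡0 y²≤b a = ℤ.drop‿+≤+ (begin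
      + G k (λ p → sq (a ℤ.+ y p))                        ≡⟨ trans (+G k _) (Gℤ-cong k expand) ⟩
      Gℤ k (λ p → + 1 ℤ.* + (sq a + sq (y p)) ℤ.+ (a ℤ.+ a) ℤ.* y p)   ≡⟨ Gℤ-linear k (+ 1) (a ℤ.+ a) (λ p → + (sq a + sq (y p))) y ⟩
      + 1 ℤ.* Gℤ k (λ p → + (sq a + sq (y p))) ℤ.+ (a ℤ.+ a) ℤ.* Gℤ k y  ≡⟨ cong₂ (λ u v → + 1 ℤ.* u ℤ.+ (a ℤ.+ a) ℤ.* v) (sym (+G k _)) Gy≡0 ⟩
      + 1 ℤ.* + G k (λ p → sq a + sq (y p)) ℤ.+ (a ℤ.+ a) ℤ.* + 0  ≡⟨ simplify (+ G k (λ p → sq a + sq (y p))) a ⟩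
      + G k (λ p → sq a + sq (y p))                       ≤⟨ ℤ.+≤+ (≤-trans (G-mono k (λ p → +-monoʳ-≤ (sq a) (y²≤b p))) (≤-reflexive (G-const k (sq a + b)))) ⟩
      + (W * (sq a + b))                                  ∎)
      where
      open ℤ.≤-Reasoning
      square : ∀ a y → (a ℤ.+ y) ℤ.* (a ℤ.+ y) ≡ + 1 ℤ.* (a ℤ.* a ℤ.+ y ℤ.* y) ℤ.+ (a ℤ.+ a) ℤ.* y
      square = ℤ-RingSolver.solve-∀
      simplify : ∀ u a → + 1 ℤ.* u ℤ.+ (a ℤ.+ a) ℤ.* + 0 ≡ u
      simplify = ℤ-RingSolver.solve-∀
      expand : ∀ p → + sq (a ℤ.+ y p) ≡ + 1 ℤ.* + (sq a + sq (y p)) ℤ.+ (a ℤ.+ a) ℤ.* y p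
      expand p = trans (+sq (a ℤ.+ y p)) (trans (square a (y p))
        (cong (λ z → + 1 ℤ.* z ℤ.+ (a ℤ.+ a) ℤ.* y p) (sym (cong₂ ℤ._+_ (+sq a) (+sq (y p))))))

    sumℤ : ∀ {n} → (Fin (suc k) → ℤ) → Vec (Fin (suc k)) n → ℤ
    sumℤ y []      = + 0
    sumℤ y (p ∷ v) = y p ℤ.+ sumℤ y v

    -- Independence: the cross terms vanish, so the variance grows linearly in n.
    E-sq : ∀ (y : Fin (suc k) → ℤ) b → Gℤ k y ≡ + 0 → (∀ p → sq (y p) ≤ b) →
           ∀ n a → E k n (λ v → sq (a ℤ.+ sumℤ y v)) ≤ W ^ n * (sq a + n * b)
    E-sq y b Gy≡0 y²≤b zero    a = ≤-reflexive (trans (cong sq (ℤ.+-identityʳ a))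
      (sym (trans (*-identityˡ (sq a + 0)) (+-identityʳ (sq a)))))
    E-sq y b Gy≡0 y²≤b (suc n) a = begin
      G k (λ p → E k n (λ v → sq (a ℤ.+ (y p ℤ.+ sumℤ y v))))    ≡⟨ G-cong k (λ p → E-cong k n (λ v → cong sq (sym (ℤ.+-assoc a (y p) (sumℤ y v))))) ⟩
      G k (λ p → E k n (λ v → sq (a ℤ.+ y p ℤ.+ sumℤ y v)))      ≤⟨ G-mono k (λ p → E-sq y b Gy≡0 y²≤b n (a ℤ.+ y p)) ⟩
      G k (λ p → W ^ n * (sq (a ℤ.+ y p) + n * b))               ≡⟨ trans (G-* k (W ^ n) _) (cong (W ^ n *_) (trans (G-+ k _ _) (cong (λ z → G k (λ p → sq (a ℤ.+ y p)) + z) (G-const k (n * b))))) ⟩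
      W ^ n * (G k (λ p → sq (a ℤ.+ y p)) + W * (n * b))         ≤⟨ *-monoʳ-≤ (W ^ n) (+-monoˡ-≤ (W * (n * b)) (G-sq y b Gy≡0 y²≤b a)) ⟩
      W ^ n * (W * (sq a + b) + W * (n * b))                     ≡⟨ regroup (W ^ n) W (sq a) b n ⟩
      W * W ^ n * (sq a + suc n * b)                             ∎
      where
      open ≤-Reasoning
      regroup : ∀ u w s b n → u * (w * (s + b) + w * (n * b)) ≡ w * u * (s + suc n * b)
      regroup = solve-∀

    4su≤[s+u]² : ∀ s u → 4 * s * u ≤ (s + u) * (s + u)
    4su≤[s+u]² s u with ≤-total s u
    ... | inj₁ s≤u with u ∸ s | m+[n∸m]≡n s≤u
    ...   | w | refl = subst (4 * s * (s + w) ≤_) (identity s w) (m≤m+n _ (w * w))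
      where
      identity : ∀ s w → 4 * s * (s + w) + w * w ≡ (s + (s + w)) * (s + (s + w))
      identity = solve-∀
    4su≤[s+u]² s u | inj₂ u≤s with s ∸ u | m+[n∸m]≡n u≤s
    ...   | w | refl = subst (4 * (u + w) * u ≤_) (identity u w) (m≤m+n _ (w * w))
      where
      identity : ∀ u w → 4 * (u + w) * u + w * w ≡ (u + w + u) * (u + w + u)
      identity = solve-∀

    -- Chebyshev, pointwise: an excess `u` over `c + S` is a deviation `S + u` from `c`, and
    -- `(S + u)² ≥ 4 S u`. The factor `W` clears the denominator of the mean of one size.
    excess≤sq : ∀ x c S → W * W * (4 * S * (x ∸ (c + S))) ≤ sq (+ (W * x) ℤ.- + (W * c))
    excess≤sq x c S with ≤-total x (c + S)
    ... | inj₁ x≤ = ≤-trans (≤-reflexive (trans (cong (λ z → W * W * (4 * S * z)) (m≤n⇒m∸n≡0 x≤)) (vanish (W * W) S))) z≤n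
      where
      vanish : ∀ w s → w * (4 * s * 0) ≡ 0
      vanish = solve-∀
    ... | inj₂ ≤x with x ∸ (c + S) | m+[n∸m]≡n ≤x
    ...   | u | refl = begin
      W * W * (4 * S * u)                      ≤⟨ *-monoʳ-≤ (W * W) (4su≤[s+u]² S u) ⟩
      W * W * ((S + u) * (S + u))              ≡⟨ regroup W S u ⟩
      sq (+ (W * (S + u)))                     ≡⟨ cong sq difference ⟨
      sq (+ (W * (c + S + u)) ℤ.- + (W * c))   ∎
      where
      open ≤-Reasoning
      regroup : ∀ w s u → w * w * ((s + u) * (s + u)) ≡ w * (s + u) * (w * (s + u))
      regroup = solve-∀
      cancel : ∀ a b → a ℤ.+ b ℤ.- a ≡ b
      cancel = ℤ-RingSolver.solve-∀
      difference : + (W * (c + S + u)) ℤ.- + (W * c) ≡ + (W * (S + u))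
      difference = trans (cong (λ z → + z ℤ.- + (W * c)) (trans (cong (W *_) (+-assoc c S u)) (*-distribˡ-+ W c (S + u))))
        (cancel (+ (W * c)) (+ (W * (S + u))))

    -- Averaging `excess≤sq` leaves the variance, at most `n K²` because a size in `[0, K]` is
    -- within `K` of its mean. The equation `n * G k s ≡ W * c` makes `c` the expectation of the
    -- sum.
    E-tail : ∀ (s : Fin (suc k) → ℕ) K → (∀ p → s p ≤ K) → ∀ n c S → n * G k s ≡ W * c →
             4 * S * E k n (λ v → sum (λ j → s (lookup v j)) ∸ (c + S)) ≤ W ^ n * (n * (K * K))
    E-tail s K s≤K n c S nμ≡Wc = *-cancelˡ-≤ (W * W) ⦃ m*n≢0 W W ⦃ m^n≢0 2 k ⦄ ⦃ m^n≢0 2 k ⦄ ⦄ (begin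
      W * W * (4 * S * E k n (λ v → stat v ∸ (c + S)))          ≡⟨ cong (W * W *_) (E-* k n (4 * S) _) ⟨
      W * W * E k n (λ v → 4 * S * (stat v ∸ (c + S)))          ≡⟨ E-* k n (W * W) _ ⟨
      E k n (λ v → W * W * (4 * S * (stat v ∸ (c + S))))        ≤⟨ E-mono k n (λ v → excess≤sq (stat v) c S) ⟩
      E k n (λ v → sq (+ (W * stat v) ℤ.- + (W * c)))           ≡⟨ E-cong k n (λ v → cong sq (sym (centre v))) ⟩
      E k n (λ v → sq (+ 0 ℤ.+ sumℤ y v))                       ≤⟨ E-sq y (W * K * (W * K)) Gy≡0 y²≤ n (+ 0) ⟩
      W ^ n * (n * (W * K * (W * K)))                           ≡⟨ regroup (W ^ n) n W K ⟩
      W * W * (W ^ n * (n * (K * K)))                           ∎)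
      where
      open ≤-Reasoning
      μ = G k s
      stat : ∀ {n} → Vec (Fin (suc k)) n → ℕ
      stat v = sum (λ j → s (lookup v j))
      -- `W` times the deviation of a size from its mean `μ / W`, written as the linear combination
      -- that `Gℤ-linear` expects.
      y : Fin (suc k) → ℤ
      y p = + W ℤ.* + s p ℤ.+ (ℤ.- + μ) ℤ.* + 1
      regroup : ∀ u n w K → u * (n * (w * K * (w * K))) ≡ w * w * (u * (n * (K * K)))
      regroup = solve-∀
      y-difference : ∀ p → y p ≡ + (W * s p) ℤ.- + μ
      y-difference p = cong₂ ℤ._+_ (sym (ℤ.pos-* W (s p))) (ℤ.*-identityʳ (ℤ.- + μ))
      Gy≡0 : Gℤ k y ≡ + 0
      Gy≡0 = trans (Gℤ-linear k (+ W) (ℤ.- + μ) (λ p → + s p) (λ _ → + 1))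
        (trans (cong₂ (λ u v → + W ℤ.* u ℤ.+ (ℤ.- + μ) ℤ.* v) (sym (+G k s)) (trans (sym (+G k (λ _ → 1))) (cong +_ (trans (G-const k 1) (*-identityʳ W)))))
          (cancel (+ W) (+ μ)))
        where
        cancel : ∀ w m → w ℤ.* m ℤ.+ (ℤ.- m) ℤ.* w ≡ + 0
        cancel = ℤ-RingSolver.solve-∀
      μ≤ : μ ≤ W * K
      μ≤ = ≤-trans (G-mono k s≤K) (≤-reflexive (G-const k K))
      ∣y∣≤ : ∀ p → ℤ.∣ y p ∣ ≤ W * K
      ∣y∣≤ p = subst (λ z → ℤ.∣ z ∣ ≤ W * K) (sym (trans (y-difference p) (ℤ.m-n≡m⊖n (W * s p) μ)))
        (≤-trans (ℤ.∣m⊝n∣≤m⊔n (W * s p) μ) (⊔-lub (*-monoʳ-≤ W (s≤K p)) μ≤))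
      y²≤ : ∀ p → sq (y p) ≤ W * K * (W * K)
      y²≤ p = *-mono-≤ (∣y∣≤ p) (∣y∣≤ p)
      sumℤ-y : ∀ {m} (v : Vec (Fin (suc k)) m) → sumℤ y v ≡ + (W * stat v) ℤ.- + (m * μ)
      sumℤ-y []      = cong (λ z → + z ℤ.- + 0) (sym (*-zeroʳ W))
      sumℤ-y {suc m} (p ∷ v) = trans (cong₂ ℤ._+_ (y-difference p) (sumℤ-y v))
        (trans (interchange (+ (W * s p)) (+ μ) (+ (W * stat v)) (+ (m * μ)))
          (cong (λ z → + z ℤ.- + (suc m * μ)) (sym (*-distribˡ-+ W (s p) (stat v)))))
        where
        interchange : ∀ a b c d → (a ℤ.- b) ℤ.+ (c ℤ.- d) ≡ (a ℤ.+ c) ℤ.- (b ℤ.+ d)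
        interchange = ℤ-RingSolver.solve-∀
      centre : ∀ (v : Vec (Fin (suc k)) n) → + 0 ℤ.+ sumℤ y v ≡ + (W * stat v) ℤ.- + (W * c)
      centre v = trans (ℤ.+-identityˡ _) (trans (sumℤ-y v) (cong (λ z → + (W * stat v) ℤ.- + z) nμ≡Wc))

-- The adversary's instances

module Scheduling where
  open import Data.Nat.Base
  open import Data.Nat.Properties
  open import Defs hiding (_≤_; _<_; _+_; _*_; -_; _-_)
  open Averages
  open Variance

  sum-allFin : ∀ {n} (f : Fin n → ℕ) → ListAction.sum (map f (allFin n)) ≡ sum f
  sum-allFin f = trans (cong ListAction.sum (map-tabulate id f)) (go f)
    where
    go : ∀ {n} (f : Fin n → ℕ) → ListAction.sum (tabulate f) ≡ sum f
    go {zero}  f = refl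
    go {suc n} f = cong (f zero +_) (go (f ∘ suc))

  δ : Decision → ℕ → ℕ
  δ d m = if does (≡-dec _≟_ d (just m)) then 1 else 0

  δ-≢ : ∀ {d m} → d ≢ just m → δ d m ≡ 0
  δ-≢ {d} {m} d≢ = cong (if_then 1 else 0) (dec-false (≡-dec _≟_ d (just m)) d≢)

  δ-≡ : ∀ m → δ (just m) m ≡ 1
  δ-≡ m = cong (if_then 1 else 0) (dec-true (≡-dec _≟_ (just m) (just m)) refl)

  sum-δ≤1 : ∀ n d → sum {n} (λ j → δ d (toℕ j)) ≤ 1
  sum-δ≤1 zero    d              = z≤n
  sum-δ≤1 (suc n) nothing        = sum-δ≤1 n nothing
  sum-δ≤1 (suc n) (just zero)    = s≤s (≤-reflexive (trans (sum-const n 0) (*-zeroʳ n)))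
  sum-δ≤1 (suc n) (just (suc i)) = sum-δ≤1 n (just i)

  1≤sum-δ : ∀ {n i} → i < n → 1 ≤ sum {n} (λ j → δ (just i) (toℕ j))
  1≤sum-δ {suc n} {zero}  i<n       = s≤s z≤n
  1≤sum-δ {suc n} {suc i} (s≤s i<n) = 1≤sum-δ i<n

  count : List Decision → ℕ → ℕ
  count ds m = length (filter (λ d → ≡-dec _≟_ d (just m)) ds)

  count-∷ : ∀ d ds m → count (d ∷ ds) m ≡ δ d m + count ds m
  count-∷ d ds m with does (≡-dec _≟_ d (just m))
  ... | true  = refl
  ... | false = refl

  count-mono : ∀ d ds m → count ds m ≤ count (d ∷ ds) m
  count-mono d ds m = subst (count ds m ≤_) (sym (count-∷ d ds m)) (m≤n+m _ _)

  sum-count : ∀ n ds → sum {n} (λ j → count ds (toℕ j)) ≤ length ds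
  sum-count n []       = ≤-reflexive (trans (sum-const n 0) (*-zeroʳ n))
  sum-count n (d ∷ ds) = ≤-trans (sum-+-≤ {n} (λ j → δ d (toℕ j)) (λ j → count ds (toℕ j)) (λ j → ≤-reflexive (count-∷ d ds (toℕ j))))
    (+-mono-≤ (sum-δ≤1 n d) (sum-count n ds))

  pos-∸-δ : ∀ x c d m → pos (x ∸ c) ≤ pos (x ∸ (δ d m + c)) + δ d m
  pos-∸-δ x c d m with does (≡-dec _≟_ d (just m))
  ... | true  = ≤-trans (m⊓n≤m 1 (x ∸ c)) (m≤n+m 1 _)
  ... | false = ≤-reflexive (sym (+-identityʳ _))

  module _ {k : ℕ} where

    -- Defined on all job numbers: beyond the `n` main jobs lie the unit jobs of the stream.
    size : ∀ {n} → Vec (Fin (suc k)) n → ℕ → ℕ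
    size []      m       = 1
    size (p ∷ v) zero    = suc (toℕ p)
    size (p ∷ v) (suc m) = size v m

    size≥1 : ∀ {n} (v : Vec (Fin (suc k)) n) m → 1 ≤ size v m
    size≥1 []      m       = ≤-refl
    size≥1 (p ∷ v) zero    = s≤s z≤n
    size≥1 (p ∷ v) (suc m) = size≥1 v m

    size≤ : ∀ {n} (v : Vec (Fin (suc k)) n) m → size v m ≤ suc k
    size≤ []      m       = s≤s z≤n
    size≤ (p ∷ v) zero    = toℕ<n p
    size≤ (p ∷ v) (suc m) = size≤ v m

    size-lookup : ∀ {n} (v : Vec (Fin (suc k)) n) j → size v (toℕ j) ≡ suc (toℕ (lookup v j))
    size-lookup (p ∷ v) zero    = refl
    size-lookup (p ∷ v) (suc j) = size-lookup v j

    size-unit : ∀ {n} (v : Vec (Fin (suc k)) n) m → size v (n + m) ≡ 1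
    size-unit []      m = refl
    size-unit (p ∷ v) m = size-unit v m

    size-update : ∀ {n} (v : Vec (Fin (suc k)) n) j p → size (v [ j ]≔ p) (toℕ j) ≡ suc (toℕ p)
    size-update (_ ∷ v) zero    p = refl
    size-update (_ ∷ v) (suc j) p = size-update v j p

    size-update-≢ : ∀ {n} (v : Vec (Fin (suc k)) n) j p m → m ≢ toℕ j → size (v [ j ]≔ p) m ≡ size v m
    size-update-≢ (_ ∷ v) zero    p zero    m≢ = ⊥-elim (m≢ refl)
    size-update-≢ (_ ∷ v) zero    p (suc m) m≢ = refl
    size-update-≢ (_ ∷ v) (suc j) p zero    m≢ = refl
    size-update-≢ (_ ∷ v) (suc j) p (suc m) m≢ = size-update-≢ v j p m (m≢ ∘ cong suc)

  -- n main jobs are released at time 0; from time T on, M jobs of size 1 follow,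
  -- one per time unit.  Estimates and thresholds depend on the size only: sizes
  -- below s are disclosed one unit before completion, larger ones look all alike.
  module Adversary (k n M T s a : ℕ) where

    releaseTime : ℕ → ℕ
    releaseTime m = if m <ᵇ n then 0 else T + (m ∸ n)

    -- For sizes `p` with `s ≤ p ≤ b * (a * s)` one estimate fits all: `a * s ≤ a * p` and
    -- `p ≤ b * (a * s)`.
    estimateOf : ℕ → ℕ
    estimateOf p = if p <ᵇ s then p else a * s

    -- At most `(1 - ε) p` as soon as `s ε ≤ 1`, since `p - ε p` drops at most one unit for the
    -- first `min (p , s)` units and nothing below zero for the others.
    thresholdOf : ℕ → ℕ
    thresholdOf p = pred (p ⊓ s)

    release-main : ∀ {m} → m < n → releaseTime m ≡ 0
    release-main {m} m<n = cong (if_then 0 else T + (m ∸ n)) (dec-true (m <? n) m<n)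

    release-late : ∀ {m} → n ≤ m → releaseTime m ≡ T + (m ∸ n)
    release-late {m} n≤m = cong (if_then 0 else T + (m ∸ n)) (dec-false (m <? n) (≤⇒≯ n≤m))

    release-unit : ∀ m → releaseTime (n + m) ≡ T + m
    release-unit m = trans (release-late (m≤m+n n m)) (cong (T +_) (m+n∸m≡n n m))

    releaseTime-mono : ∀ {m m′} → m ≤ m′ → releaseTime m ≤ releaseTime m′
    releaseTime-mono {m} {m′} m≤m′ with m <? n
    ... | yes m<n = subst (_≤ releaseTime m′) (sym (release-main m<n)) z≤n
    ... | no  m≮n = subst₂ _≤_ (sym (release-late (≮⇒≥ m≮n))) (sym (release-late (≤-trans (≮⇒≥ m≮n) m≤m′)))
                      (+-monoʳ-≤ T (∸-monoˡ-≤ n m≤m′))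

    estimateOf≥1 : 1 ≤ a → 1 ≤ s → ∀ p → 1 ≤ p → 1 ≤ estimateOf p
    estimateOf≥1 1≤a 1≤s p 1≤p with p <ᵇ s
    ... | true  = 1≤p
    ... | false = *-mono-≤ 1≤a 1≤s

    module Play (1≤a : 1 ≤ a) (1≤s : 1 ≤ s) where

      inst : Vec (Fin (suc k)) n → Instance
      inst v = record
        { #jobs        = n + M
        ; release      = λ j → releaseTime (toℕ j)
        ; processing   = λ j → size v (toℕ j)
        ; estimate     = λ j → estimateOf (size v (toℕ j))
        ; threshold    = λ j → thresholdOf (size v (toℕ j))
        ; processing≥1 = λ j → size≥1 v (toℕ j)
        ; estimate≥1   = λ j → estimateOf≥1 1≤a 1≤s (size v (toℕ j)) (size≥1 v (toℕ j))
        ; sorted       = releaseTime-mono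
        }

      revealed : ℕ → ℕ → Maybe ℕ
      revealed c p = if thresholdOf p ≤ᵇ c then just (estimateOf p) else nothing

      -- If `s ≤ p`, threshold and estimate are those of every large size. If `p < s`, then `c` lies
      -- below both `p - 1` and `s - 1`, so a job of either kind still shows nothing.
      revealed-generic : ∀ c p → 2 + c ≤ p → revealed c p ≡ (if pred s ≤ᵇ c then just (a * s) else nothing)
      revealed-generic c p c+2≤p with s ≤? p
      ... | yes s≤p = cong₂ (λ (x y : ℕ) → if pred x ≤ᵇ c then just y else nothing) (m≥n⇒m⊓n≡n s≤p)
                       (cong (if_then p else a * s) (dec-false (p <? s) (≤⇒≯ s≤p)))
      ... | no  s≰p = trans (hidden (estimateOf p) (subst (λ x → c < pred x) (sym (m≤n⇒m⊓n≡m (<⇒≤ p<s))) (pred-mono-≤ c+2≤p)))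
                            (sym (hidden (a * s) (pred-mono-≤ (≤-trans c+2≤p (<⇒≤ p<s)))))
        where
        p<s = ≰⇒> s≰p
        hidden : ∀ {t} (x : ℕ) → c < t → (if t ≤ᵇ c then just x else nothing) ≡ nothing
        hidden {t} x c<t = cong (if_then just x else nothing) (dec-false (t ≤? c) (<⇒≱ c<t))

      module Coupling {v v′ : Vec (Fin (suc k)) n} (i e : ℕ)
        (same : ∀ m → m ≢ i → size v m ≡ size v′ m) (e≤ : 2 + e ≤ size v i) (e≤′ : 2 + e ≤ size v′ i) where

        observe-≡ : ∀ ds → count ds i ≤ e → observe (inst v) ds ≡ observe (inst v′) ds
        observe-≡ ds c≤e = map-cong (λ j → job-≡ (toℕ j)) (filter (λ j → releaseTime (toℕ j) ≤? length ds) (allFin (n + M)))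
          where
          statusOf : ℕ → ℕ → JobStatus
          statusOf c p = status (revealed c p) (p ∸ c ≡ᵇ 0)
          generic : ∀ {c p} → 2 + c ≤ p → statusOf c p ≡ status (if pred s ≤ᵇ c then just (a * s) else nothing) false
          generic {c} {p} c+2≤p = cong₂ status (revealed-generic c p c+2≤p)
            (dec-false (p ∸ c ≟ 0) (λ eq → <⇒≢ (m<n⇒0<n∸m (≤-trans (n≤1+n (suc c)) c+2≤p)) (sym eq)))
          job-≡ : ∀ m → statusOf (count ds m) (size v m) ≡ statusOf (count ds m) (size v′ m)
          job-≡ m with m ≟ i
          ... | no  m≢i  = cong (statusOf (count ds m)) (same m m≢i)
          ... | yes refl = trans (generic (≤-trans (s≤s (s≤s c≤e)) e≤)) (sym (generic (≤-trans (s≤s (s≤s c≤e)) e≤′)))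

        pastOf-≡ : ∀ ds → count ds i ≤ e → pastOf (inst v) ds ≡ pastOf (inst v′) ds
        pastOf-≡ []       _   = refl
        pastOf-≡ (d ∷ ds) c≤e = let c≤e′ = ≤-trans (count-mono d ds i) c≤e in
          cong₂ (λ o p → (o , d) ∷ p) (observe-≡ ds c≤e′) (pastOf-≡ ds c≤e′)

        -- The bound on the work done on job `i` is assumed for the run on `v` only. Work never
        -- decreases, so the bound holds at all earlier times as well, where both instances show the
        -- same statuses and the policy decides alike.
        decisions-≡ : ∀ π t → count (decisions (inst v) π t) i ≤ e → decisions (inst v) π t ≡ decisions (inst v′) π t
        decisions-≡ π zero    _   = refl
        decisions-≡ π (suc t) c≤e = begin
          π (historyOf (inst v) ds) ∷ ds       ≡⟨ cong₂ (λ o p → π (history o p) ∷ ds) (observe-≡ ds c≤e′) (pastOf-≡ ds c≤e′) ⟩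
          π (historyOf (inst v′) ds) ∷ ds      ≡⟨ cong (λ ds′ → π (historyOf (inst v′) ds′) ∷ ds′) (decisions-≡ π t c≤e′) ⟩
          decisions (inst v′) π (suc t)        ∎
          where
          open ≡-Reasoning
          ds = decisions (inst v) π t
          c≤e′ : count ds i ≤ e
          c≤e′ = ≤-trans (count-mono (π (historyOf (inst v) ds)) ds i) c≤e

      alive : Vec (Fin (suc k)) n → List Decision → ℕ
      alive v ds = sum {n} (λ j → pos (size v (toℕ j) ∸ count ds (toℕ j)))

      alive≤n : ∀ v ds → alive v ds ≤ n
      alive≤n v ds = ≤-trans (sum-mono {n} (λ j → m⊓n≤m 1 _)) (≤-reflexive (trans (sum-const n 1) (*-identityʳ n)))

      length-decisions : ∀ I π t → length (decisions I π t) ≡ t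
      length-decisions I π zero    = refl
      length-decisions I π (suc t) = cong suc (length-decisions I π t)

      -- At most `T` units are processed by time `T`; the rest of the volume is left over.
      -- Resampling one size while the others are fixed, memorylessness bounds the mean remainder of
      -- each job by three times its chance of being unfinished.
      E-alive : ∀ π → E k n (λ v → sum {n} (λ j → size v (toℕ j))) ≤
                      (2 ^ k) ^ n * T + 3 * E k n (λ v → alive v (decisions (inst v) π T))
      E-alive π = begin
        E k n (λ v → sum {n} (λ j → size v (toℕ j)))       ≤⟨ E-mono k n work ⟩
        E k n (λ v → T + sum {n} (λ j → left j v))         ≡⟨ trans (E-+ k n (λ _ → T) _) (cong₂ _+_ (E-const k n T) (E-sum k n left)) ⟩
        (2 ^ k) ^ n * T + sum {n} (λ j → E k n (left j))   ≤⟨ +-monoʳ-≤ ((2 ^ k) ^ n * T) (sum-mono {n} memoryless) ⟩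
        (2 ^ k) ^ n * T + sum {n} (λ j → 3 * E k n (λ v → pos (left j v)))  ≡⟨ cong ((2 ^ k) ^ n * T +_) (trans (sum-* {n} 3 _) (cong (3 *_) (sym (E-sum k n (λ j v → pos (left j v)))))) ⟩
        (2 ^ k) ^ n * T + 3 * E k n (λ v → alive v (ds v)) ∎
        where
        open ≤-Reasoning
        ds : Vec (Fin (suc k)) n → List Decision
        ds v = decisions (inst v) π T
        left : Fin n → Vec (Fin (suc k)) n → ℕ
        left j v = size v (toℕ j) ∸ count (ds v) (toℕ j)
        work : ∀ v → sum {n} (λ j → size v (toℕ j)) ≤ T + sum {n} (λ j → left j v)
        work v = ≤-trans (sum-+-≤ {n} (λ j → count (ds v) (toℕ j)) (λ j → left j v) (λ j → m≤n+m∸n (size v (toℕ j)) (count (ds v) (toℕ j))))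
          (+-monoˡ-≤ _ (subst (sum {n} (λ j → count (ds v) (toℕ j)) ≤_) (length-decisions (inst v) π T) (sum-count n (ds v))))
        memoryless : ∀ j → E k n (left j) ≤ 3 * E k n (λ v → pos (left j v))
        memoryless j = ≤-trans (E-conditional k n j (left j) (λ v → 3 * pos (left j v)) (λ v → conditional v))
                               (≤-reflexive (E-* k n 3 (λ v → pos (left j v))))
          where
          conditional : ∀ v → G k (λ p → left j (v [ j ]≔ p)) ≤ G k (λ p → 3 * pos (left j (v [ j ]≔ p)))
          conditional v = begin
            G k (λ p → left j (v [ j ]≔ p))              ≡⟨ G-cong k (λ p → cong (_∸ e p) (size-update v j p)) ⟩
            G k (λ p → suc (toℕ p) ∸ e p)                ≤⟨ G-memoryless k e agree ⟩
            3 * G k (λ p → pos (suc (toℕ p) ∸ e p))      ≡⟨ G-* k 3 _ ⟨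
            G k (λ p → 3 * pos (suc (toℕ p) ∸ e p))      ≡⟨ G-cong k (λ p → cong (λ x → 3 * pos (x ∸ e p)) (size-update v j p)) ⟨
            G k (λ p → 3 * pos (left j (v [ j ]≔ p)))    ∎
            where
            e : Fin (suc k) → ℕ
            e p = count (ds (v [ j ]≔ p)) (toℕ j)
            agree : ∀ p q → 2 + e p ≤ suc (toℕ p) → 2 + e p ≤ suc (toℕ q) → e q ≡ e p
            agree p q hp hq = cong (λ x → count x (toℕ j)) (sym (Coupling.decisions-≡ {v [ j ]≔ p} {v [ j ]≔ q} (toℕ j) (e p)
              (λ m m≢ → trans (size-update-≢ v j p m m≢) (sym (size-update-≢ v j q m m≢)))
              (subst (2 + e p ≤_) (sym (size-update v j p)) hp) (subst (2 + e p ≤_) (sym (size-update v j q)) hq) π T ≤-refl))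

      module _ (v : Vec (Fin (suc k)) n) {σ : Schedule} (feasible : Feasible (inst v) σ) where

        private
          left : ℕ → ℕ → ℕ
          left t m = size v m ∸ count (before σ t) m

          left-anti : ∀ {t t′} m → t ≤′ t′ → left t′ m ≤ left t m
          left-anti m (≤′-reflexive refl) = ≤-refl
          left-anti m (≤′-step {t′} t≤t′) = ≤-trans (∸-monoʳ-≤ (size v m) (count-mono (σ t′) (before σ t′) m)) (left-anti m t≤t′)

        unprocessed : ∀ t m → t ≤ releaseTime m → count (before σ t) m ≡ 0
        unprocessed zero    m _ = refl
        unprocessed (suc t) m t<r = trans (count-∷ (σ t) (before σ t) m)
          (cong₂ _+_ (δ-≢ not-chosen) (unprocessed t m (<⇒≤ t<r)))
          where
          not-chosen : σ t ≢ just m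
          not-chosen eq with feasible t m eq
          ... | j , refl , r≤t , _ = <⇒≱ t<r r≤t

        private
          -- The flow time of a job is the number of times `t` at which this indicator is 1.
          active : ℕ → ℕ → ℕ
          active t m = if releaseTime m ≤ᵇ t then pos (left t m) else 0

          active-released : ∀ {t m} → releaseTime m ≤ t → active t m ≡ pos (left t m)
          active-released {t} {m} r≤t = cong (if_then pos (left t m) else 0) (dec-true (releaseTime m ≤? t) r≤t)

          active-unreleased : ∀ {t m} → ¬ releaseTime m ≤ t → active t m ≡ 0
          active-unreleased {t} {m} r≰t = cong (if_then pos (left t m) else 0) (dec-false (releaseTime m ≤? t) r≰t)

          active-fresh : ∀ {t m} → releaseTime m ≡ t → active t m ≡ 1
          active-fresh {t} {m} refl = trans (active-released {t} {m} ≤-refl)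
            (trans (cong (λ c → pos (size v m ∸ c)) (unprocessed t m ≤-refl)) (pos-≥1 (size≥1 v m)))

          activeSum : ℕ → ℕ
          activeSum t = sum {n + M} (λ j → active t (toℕ j))

          active-start : ∀ M′ → sum {suc M′} (λ j → active T (n + toℕ j)) ≥ 1
          active-start M′ = ≤-trans (≤-reflexive (sym (active-fresh (trans (release-unit 0) (+-identityʳ T))))) (m≤m+n _ _)

          main≤active : ∀ t → alive v (before σ t) ≤ sum {n} (λ j → active t (toℕ j))
          main≤active t = sum-mono {n} (λ j → ≤-reflexive (sym (active-released {t} {toℕ j} (subst (_≤ t) (sym (release-main (toℕ<n j))) z≤n))))

          activeSum-start : 1 ≤ M → suc (alive v (before σ T)) ≤ activeSum T
          activeSum-start (s≤s {n = M′} _) = begin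
            1 + alive v (before σ T)                           ≡⟨ +-comm 1 _ ⟩
            alive v (before σ T) + 1                           ≤⟨ +-mono-≤ (main≤active T) (active-start M′) ⟩
            sum {n} (λ j → active T (toℕ j)) + sum {suc M′} (λ j → active T (n + toℕ j))  ≡⟨ sum-split n (suc M′) (active T) ⟨
            sum {n + suc M′} (λ j → active T (toℕ j))          ∎
            where open ≤-Reasoning

          -- Kept per job so that it can be summed: the left `δ` marks the unit job that arrives at
          -- `T + i + 1`, the right one the only job that can be completed in between. Over all jobs
          -- the left marks add up to one and the right ones to at most one.
          active-step : ∀ i m → active (T + i) m + δ (just (n + suc i)) m ≤ active (suc (T + i)) m + δ (σ (T + i)) m
          active-step i m with n + suc i ≟ m
          ... | yes refl = begin
            active (T + i) m + δ (just m) m              ≡⟨ cong₂ _+_ (active-unreleased {T + i} {m} (λ r≤t → <⇒≱ ≤-refl (subst (_≤ T + i) release≡ r≤t))) (δ-≡ m) ⟩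
            1                                            ≡⟨ active-fresh release≡ ⟨
            active (suc (T + i)) m                       ≤⟨ m≤m+n _ _ ⟩
            active (suc (T + i)) m + δ (σ (T + i)) m     ∎
            where
            open ≤-Reasoning
            release≡ : releaseTime m ≡ suc (T + i)
            release≡ = trans (release-unit (suc i)) (+-suc T i)
          ... | no i≢m = ≤-trans (≤-reflexive (trans (cong (active (T + i) m +_) (δ-≢ {just (n + suc i)} {m} (λ { refl → i≢m refl }))) (+-identityʳ _))) (cases (releaseTime m ≤? T + i))
            where
            open ≤-Reasoning
            t = T + i
            cases : Dec (releaseTime m ≤ t) → active t m ≤ active (suc t) m + δ (σ t) m
            cases (no  r≰t) = subst (_≤ active (suc t) m + δ (σ t) m) (sym (active-unreleased {t} {m} r≰t)) z≤n
            cases (yes r≤t) = begin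
              active t m                                          ≡⟨ active-released {t} {m} r≤t ⟩
              pos (left t m)                                      ≤⟨ pos-∸-δ (size v m) (count (before σ t) m) (σ t) m ⟩
              pos (size v m ∸ (δ (σ t) m + count (before σ t) m)) + δ (σ t) m  ≡⟨ cong (λ c → pos (size v m ∸ c) + δ (σ t) m) (count-∷ (σ t) (before σ t) m) ⟨
              pos (left (suc t) m) + δ (σ t) m                    ≡⟨ cong (_+ δ (σ t) m) (active-released {suc t} {m} (≤-trans r≤t (n≤1+n t))) ⟨
              active (suc t) m + δ (σ t) m                        ∎

          -- Every unit interval after T releases a job and completes at most one.
          activeSum-mono : ∀ i → i < M → suc (alive v (before σ T)) ≤ activeSum (T + i)
          activeSum-mono zero    0<M = subst (λ t → suc (alive v (before σ T)) ≤ activeSum t) (sym (+-identityʳ T)) (activeSum-start 0<M)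
          activeSum-mono (suc i) i<M = ≤-trans (activeSum-mono i (<⇒≤ i<M)) (subst (λ t → activeSum (T + i) ≤ activeSum t) (sym (+-suc T i))
            (+-cancelʳ-≤ 1 _ _ (begin
              activeSum (T + i) + 1                                                        ≤⟨ +-monoʳ-≤ (activeSum (T + i)) (1≤sum-δ (+-monoʳ-< n i<M)) ⟩
              activeSum (T + i) + sum {n + M} (λ j → δ (just (n + suc i)) (toℕ j))         ≡⟨ ∑-distrib-+ {n + M} (λ j → active (T + i) (toℕ j)) (λ j → δ (just (n + suc i)) (toℕ j)) ⟨
              sum {n + M} (λ j → active (T + i) (toℕ j) + δ (just (n + suc i)) (toℕ j))    ≤⟨ sum-+-≤ {n + M} (λ j → active (suc (T + i)) (toℕ j)) (λ j → δ (σ (T + i)) (toℕ j)) (λ j → active-step i (toℕ j)) ⟩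
              activeSum (suc (T + i)) + sum {n + M} (λ j → δ (σ (T + i)) (toℕ j))          ≤⟨ +-monoʳ-≤ (activeSum (suc (T + i))) (sum-δ≤1 (n + M) (σ (T + i))) ⟩
              activeSum (suc (T + i)) + 1                                                  ∎)))
            where open ≤-Reasoning

        -- In each of the `M` unit intervals from `T` on every active job waits, and
        -- `activeSum-mono` bounds their number from below. The `suc` is the unit job released at
        -- `T`.
        flow-lower : ∀ F → TotalFlow (inst v) σ F → M * suc (alive v (before σ T)) ≤ F
        flow-lower F (C , completion , F≡) = begin
          M * A                                                   ≤⟨ accumulate M ≤-refl ⟩
          waited (T + M)                                          ≤⟨ sum-mono {n + M} (λ j → ∸-monoˡ-≤ (releaseTime (toℕ j)) (m⊓n≤m (C j) (T + M))) ⟩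
          sum {n + M} (λ j → C j ∸ releaseTime (toℕ j))           ≡⟨ trans F≡ (sum-allFin (λ j → C j ∸ releaseTime (toℕ j))) ⟨
          F                                                       ∎
          where
          open ≤-Reasoning
          A = suc (alive v (before σ T))
          -- The flow time accrued by time `t`, with completion times cut off at `t`; in one unit it
          -- grows by at least the number of active jobs.
          waited : ℕ → ℕ
          waited t = sum {n + M} (λ j → (C j ⊓ t) ∸ releaseTime (toℕ j))
          wait : ∀ t (j : Fin (n + M)) → ((C j ⊓ t) ∸ releaseTime (toℕ j)) + active t (toℕ j) ≤ (C j ⊓ suc t) ∸ releaseTime (toℕ j)
          wait t j = cases (releaseTime (toℕ j) ≤? t) (t <? C j)
            where
            r = releaseTime (toℕ j)
            inactive : active t (toℕ j) ≡ 0 → ((C j ⊓ t) ∸ r) + active t (toℕ j) ≤ (C j ⊓ suc t) ∸ r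
            inactive eq = ≤-trans (≤-reflexive (trans (cong ((C j ⊓ t) ∸ r +_) eq) (+-identityʳ _))) (∸-monoˡ-≤ r (⊓-monoʳ-≤ (C j) (n≤1+n t)))
            cases : Dec (r ≤ t) → Dec (t < C j) → ((C j ⊓ t) ∸ r) + active t (toℕ j) ≤ (C j ⊓ suc t) ∸ r
            cases (no  r≰t) _ = inactive (active-unreleased {t} {toℕ j} r≰t)
            cases (yes r≤t) (no t≮C) = inactive (trans (active-released {t} {toℕ j} r≤t)
              (cong pos (n≤0⇒n≡0 (≤-trans (left-anti (toℕ j) (≤⇒≤′ (≮⇒≥ t≮C))) (≤-reflexive (proj₁ (completion j)))))))
            cases (yes r≤t) (yes t<C) = begin
              (C j ⊓ t ∸ r) + active t (toℕ j)   ≤⟨ +-mono-≤ (≤-reflexive (cong (_∸ r) (m≥n⇒m⊓n≡n (<⇒≤ t<C)))) (≤-trans (≤-reflexive (active-released {t} {toℕ j} r≤t)) (m⊓n≤m 1 _)) ⟩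
              (t ∸ r) + 1                        ≡⟨ trans (+-comm (t ∸ r) 1) (sym (+-∸-assoc 1 r≤t)) ⟩
              suc t ∸ r                          ≡⟨ cong (_∸ r) (m≥n⇒m⊓n≡n t<C) ⟨
              C j ⊓ suc t ∸ r                    ∎
          accumulate : ∀ i → i ≤ M → i * A ≤ waited (T + i)
          accumulate zero    _   = z≤n
          accumulate (suc i) i<M = begin
            A + i * A                                  ≤⟨ +-mono-≤ (activeSum-mono i i<M) (accumulate i (<⇒≤ i<M)) ⟩
            activeSum (T + i) + waited (T + i)         ≡⟨ trans (+-comm (activeSum (T + i)) _) (sym (∑-distrib-+ {n + M} (λ j → (C j ⊓ (T + i)) ∸ releaseTime (toℕ j)) (λ j → active (T + i) (toℕ j)))) ⟩
            sum {n + M} (λ j → ((C j ⊓ (T + i)) ∸ releaseTime (toℕ j)) + active (T + i) (toℕ j)) ≤⟨ sum-mono {n + M} (wait (T + i)) ⟩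
            waited (suc (T + i))                       ≡⟨ cong waited (+-suc T i) ⟨
            waited (T + suc i)                         ∎

  -- An offline schedule with small flow time

  Minimal : ∀ {n} → (Fin n → Set) → (Fin n → ℕ) → Set
  Minimal P r = (∃[ j ] P j × (∀ i → P i → r j ≤ r i)) ⊎ (∀ j → ¬ P j)

  minimal : ∀ {n} {P : Fin n → Set} → (∀ j → Dec (P j)) → (r : Fin n → ℕ) → Minimal P r
  minimal {zero}      P? r = inj₂ λ ()
  minimal {suc n} {P} P? r = combine (P? zero) (minimal (P? ∘ suc) (r ∘ suc))
    where
    combine : Dec (P zero) → Minimal (P ∘ suc) (r ∘ suc) → Minimal P r
    combine (no ¬p) (inj₂ none)          = inj₂ λ { zero → ¬p ; (suc j) → none j }
    combine (no ¬p) (inj₁ (j , pj , j≤)) = inj₁ (suc j , pj , λ { zero p → ⊥-elim (¬p p) ; (suc i) → j≤ i })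
    combine (yes p) (inj₂ none)          = inj₁ (zero , p , λ { zero _ → ≤-refl ; (suc i) pi → ⊥-elim (none i pi) })
    combine (yes p) (inj₁ (j , pj , j≤)) with ≤-total (r zero) (r (suc j))
    ... | inj₁ 0≤j = inj₁ (zero , p , λ { zero _ → ≤-refl ; (suc i) pi → ≤-trans 0≤j (j≤ i pi) })
    ... | inj₂ j≤0 = inj₁ (suc j , pj , λ { zero _ → j≤0 ; (suc i) → j≤ i })

  module _ {k : ℕ} where

    small big : Fin (suc k) → ℕ
    small p = if toℕ p <ᵇ k then suc (toℕ p) else 0
    big   p = if toℕ p <ᵇ k then 0 else 1

  -- `n * T` pays for the main jobs up to `T`, `M` for the unit jobs. Every main job unfinished at
  -- `T` is charged `M + n * suc k` more; such jobs are either of the truncation size or hold a unit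
  -- of the small volume that does not fit before `T`.
  flowBound : ∀ {k} n M T → Vec (Fin (suc k)) n → ℕ
  flowBound {k} n M T v =
    n * T + M + (sum {n} (λ j → big (lookup v j)) + (sum {n} (λ j → small (lookup v j)) ∸ T)) * (M + n * suc k)

  module Greedy (k n M T s a : ℕ) (1≤a : 1 ≤ a) (1≤s : 1 ≤ s) (v : Vec (Fin (suc k)) n) where
    open Adversary k n M T s a
    open Play 1≤a 1≤s

    I : Instance
    I = inst v

    -- Smaller is more urgent. Unit jobs must never wait; jobs of size `suc k` wait longest, since
    -- they store the most volume per job.
    priority : ℕ → ℕ
    priority m = if m <ᵇ n then (if size v m ≤ᵇ k then 1 else 2) else 0

    priority-main : ∀ {m} → m < n → priority m ≡ (if size v m ≤ᵇ k then 1 else 2)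
    priority-main {m} m<n = cong (if_then (if size v m ≤ᵇ k then 1 else 2) else 0) (dec-true (m <? n) m<n)

    priority-late : ∀ {m} → n ≤ m → priority m ≡ 0
    priority-late {m} n≤m = cong (if_then (if size v m ≤ᵇ k then 1 else 2) else 0) (dec-false (m <? n) (≤⇒≯ n≤m))

    priority≤0⇒late : ∀ {m} → priority m ≤ 0 → n ≤ m
    priority≤0⇒late {m} p≤0 with n ≤? m
    ... | yes n≤m = n≤m
    ... | no  n≰m = ⊥-elim (≤⇒≯ p≤0 (subst (0 <_) (sym (priority-main (≰⇒> n≰m))) (positive (size v m ≤ᵇ k))))
      where
      positive : ∀ b → 0 < (if b then 1 else 2)
      positive true  = s≤s z≤n
      positive false = s≤s z≤n

    Available : List Decision → Fin (n + M) → Set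
    Available ds j = releaseTime (toℕ j) ≤ length ds × 1 ≤ size v (toℕ j) ∸ count ds (toℕ j)

    available? : ∀ ds j → Dec (Available ds j)
    available? ds j = (releaseTime (toℕ j) ≤? length ds) ×-dec (1 ≤? size v (toℕ j) ∸ count ds (toℕ j))

    best : ∀ ds → Minimal (Available ds) (priority ∘ toℕ)
    best ds = minimal (available? ds) (priority ∘ toℕ)

    decisionOf : ∀ ds → Minimal (Available ds) (priority ∘ toℕ) → Decision
    decisionOf ds (inj₁ (j , _)) = just (toℕ j)
    decisionOf ds (inj₂ _)       = nothing

    greedy : ℕ → List Decision
    greedy zero    = []
    greedy (suc t) = decisionOf (greedy t) (best (greedy t)) ∷ greedy t

    σ : Schedule
    σ t = decisionOf (greedy t) (best (greedy t))

    before-σ : ∀ t → before σ t ≡ greedy t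
    before-σ zero    = refl
    before-σ (suc t) = cong (σ t ∷_) (before-σ t)

    length-greedy : ∀ t → length (greedy t) ≡ t
    length-greedy zero    = refl
    length-greedy (suc t) = cong suc (length-greedy t)

    left : ℕ → ℕ → ℕ
    left t m = size v m ∸ count (greedy t) m

    left-suc : ∀ t m → left (suc t) m ≡ left t m ∸ δ (σ t) m
    left-suc t m = trans (cong (size v m ∸_) (trans (count-∷ (σ t) (greedy t) m) (+-comm (δ (σ t) m) _)))
                         (sym (∸-+-assoc (size v m) (count (greedy t) m) (δ (σ t) m)))

    left-anti : ∀ {t t′} m → t ≤′ t′ → left t′ m ≤ left t m
    left-anti         m (≤′-reflexive refl)  = ≤-refl
    left-anti {t} {_} m (≤′-step {t′} t≤t′) = ≤-trans (≤-trans (≤-reflexive (left-suc t′ m)) (m∸n≤m (left t′ m) (δ (σ t′) m))) (left-anti m t≤t′)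

    feasible : Feasible I σ
    feasible t i eq = cases (best (greedy t)) eq
      where
      cases : (b : Minimal (Available (greedy t)) (priority ∘ toℕ)) → decisionOf (greedy t) b ≡ just i →
              ∃[ j ] toℕ j ≡ i × releaseTime (toℕ j) ≤ t × remaining I (before σ t) j ≢ 0
      cases (inj₁ (j , (r≤ , 1≤left) , _)) refl = j , refl , subst (releaseTime (toℕ j) ≤_) (length-greedy t) r≤ ,
        λ left≡0 → <⇒≢ 1≤left (sym (trans (cong (λ ds → size v (toℕ j) ∸ count ds (toℕ j)) (sym (before-σ t))) left≡0))

    module Volume (P : ℕ → Bool) where

      vol : ℕ → ℕ
      vol t = sum {n + M} (λ j → if P (toℕ j) then left t (toℕ j) else 0)

      -- What makes the greedy machine work on `P` while `P` has volume left: no released job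
      -- outside `P` outranks or ties one in `P`, and nothing of `P` is still to come.
      Preferred : ℕ → Set
      Preferred t =
        (∀ (j : Fin (n + M)) → P (toℕ j) ≡ true → releaseTime (toℕ j) ≤ t) ×
        (∀ (i j : Fin (n + M)) → P (toℕ i) ≡ true → releaseTime (toℕ j) ≤ t → priority (toℕ j) ≤ priority (toℕ i) → P (toℕ j) ≡ true)

      vol-exhausted : ∀ t → (∀ (j : Fin (n + M)) → P (toℕ j) ≡ true → ¬ Available (greedy t) j) →
                      (∀ (j : Fin (n + M)) → P (toℕ j) ≡ true → releaseTime (toℕ j) ≤ t) → vol (suc t) ≤ vol t ∸ 1
      vol-exhausted t none released = ≤-trans (sum-mono {n + M} zeros) (≤-trans (≤-reflexive (trans (sum-const (n + M) 0) (*-zeroʳ (n + M)))) z≤n)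
        where
        zeros : ∀ (j : Fin (n + M)) → (if P (toℕ j) then left (suc t) (toℕ j) else 0) ≤ 0
        zeros j with P (toℕ j) in eq
        ... | false = z≤n
        ... | true  = ≤-trans (left-anti (toℕ j) (≤⇒≤′ (n≤1+n t))) (≤-pred (≰⇒> (λ 1≤left →
          none j eq (subst (releaseTime (toℕ j) ≤_) (sym (length-greedy t)) (released j eq) , 1≤left))))

      vol-step : ∀ t → Preferred t → vol (suc t) ≤ vol t ∸ 1
      vol-step t (released , preferred) = cases (best (greedy t)) refl
        where
        open ≤-Reasoning
        cases : (b : Minimal (Available (greedy t)) (priority ∘ toℕ)) → best (greedy t) ≡ b → vol (suc t) ≤ vol t ∸ 1
        cases (inj₂ none) _ = vol-exhausted t (λ j _ → none j) released
        cases (inj₁ (j₀ , (r≤ , 1≤left) , least)) eq with P (toℕ j₀) in P₀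
        -- The machine serves `j₀` outside `P`. An available job of `P` would be no more urgent than
        -- `j₀` and so force `j₀` into `P`; hence `P` is exhausted.
        ... | false = vol-exhausted t (λ j Pj av → subst Bool.T (trans (sym (preferred j j₀ Pj (subst (releaseTime (toℕ j₀) ≤_) (length-greedy t) r≤) (least j av))) P₀) _) released
        ... | true  = m+n≤o⇒m≤o∸n (vol (suc t)) (begin
          vol (suc t) + 1                                            ≤⟨ +-monoʳ-≤ (vol (suc t)) (1≤sum-δ (toℕ<n j₀)) ⟩
          vol (suc t) + sum {n + M} (λ j → δ (just (toℕ j₀)) (toℕ j))  ≡⟨ ∑-distrib-+ {n + M} (λ j → if P (toℕ j) then left (suc t) (toℕ j) else 0) (λ j → δ (just (toℕ j₀)) (toℕ j)) ⟨
          sum {n + M} (λ j → (if P (toℕ j) then left (suc t) (toℕ j) else 0) + δ (just (toℕ j₀)) (toℕ j))  ≤⟨ sum-mono {n + M} (λ j → decrease (toℕ j)) ⟩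
          vol t                                                      ∎)
          where
          σt≡ : σ t ≡ just (toℕ j₀)
          σt≡ = cong (decisionOf (greedy t)) eq
          decrease : ∀ m → (if P m then left (suc t) m else 0) + δ (just (toℕ j₀)) m ≤ (if P m then left t m else 0)
          decrease m with toℕ j₀ ≟ m
          ... | yes refl rewrite P₀ = ≤-reflexive (trans (cong₂ _+_ (trans (left-suc t m) (cong (left t m ∸_) (trans (cong (λ d → δ d m) σt≡) (δ-≡ m)))) (δ-≡ m)) (m∸n+n≡m 1≤left))
          ... | no  j₀≢m = ≤-trans (≤-reflexive (trans (cong ((if P m then left (suc t) m else 0) +_) (δ-≢ (j₀≢m ∘ just-injective))) (+-identityʳ _))) (monotone (P m))
            where
            monotone : ∀ b → (if b then left (suc t) m else 0) ≤ (if b then left t m else 0)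
            monotone true  = left-anti m (≤⇒≤′ (n≤1+n t))
            monotone false = z≤n

      vol-steps : ∀ t d → (∀ i → i < d → Preferred (t + i)) → vol (t + d) ≤ vol t ∸ d
      vol-steps t zero    _ = ≤-reflexive (cong vol (+-identityʳ t))
      vol-steps t (suc d) h = begin
        vol (t + suc d)        ≡⟨ cong vol (+-suc t d) ⟩
        vol (suc (t + d))      ≤⟨ vol-step (t + d) (h d ≤-refl) ⟩
        vol (t + d) ∸ 1        ≤⟨ ∸-monoˡ-≤ 1 (vol-steps t d (λ i i<d → h i (≤-trans i<d (n≤1+n d)))) ⟩
        vol t ∸ d ∸ 1          ≡⟨ trans (∸-+-assoc (vol t) d 1) (cong (vol t ∸_) (+-comm d 1)) ⟩
        vol t ∸ suc d          ∎
        where open ≤-Reasoning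

    -- At `T + i` exactly the unit jobs up to number `i` are released and the earlier ones are done,
    -- so this one is the only job of top urgency.
    unit-step : ∀ i → i < M → (∀ u → u < i → left (T + i) (n + u) ≡ 0) → left (suc (T + i)) (n + i) ≡ 0
    unit-step i i<M done = cases (best (greedy t)) refl (1 ≤? left t (n + i))
      where
      t = T + i
      u : Fin (n + M)
      u = fromℕ< (+-monoʳ-< n i<M)
      toℕ-u : toℕ u ≡ n + i
      toℕ-u = toℕ-fromℕ< (+-monoʳ-< n i<M)
      cases : (b : Minimal (Available (greedy t)) (priority ∘ toℕ)) → best (greedy t) ≡ b → Dec (1 ≤ left t (n + i)) → left (suc t) (n + i) ≡ 0
      cases _ _ (no left≱1) = n≤0⇒n≡0 (≤-trans (left-anti (n + i) (≤⇒≤′ (n≤1+n t))) (≤-pred (≰⇒> left≱1)))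
      cases b eq (yes 1≤left) = chosen b eq
        where
        available : Available (greedy t) u
        available = subst₂ _≤_ (sym (trans (cong releaseTime toℕ-u) (release-unit i))) (sym (length-greedy t)) ≤-refl
                  , subst (λ m → 1 ≤ left t m) (sym toℕ-u) 1≤left
        chosen : (b : Minimal (Available (greedy t)) (priority ∘ toℕ)) → best (greedy t) ≡ b → left (suc t) (n + i) ≡ 0
        chosen (inj₂ none) _ = ⊥-elim (none u available)
        chosen (inj₁ (j₀ , (r≤ , 1≤left₀) , least)) eq = begin
          left (suc t) (n + i)             ≡⟨ left-suc t (n + i) ⟩
          left t (n + i) ∸ δ (σ t) (n + i) ≡⟨ cong (left t (n + i) ∸_) (trans (cong (λ d → δ d (n + i)) (trans (cong (decisionOf (greedy t)) eq) (cong just j₀≡))) (δ-≡ (n + i))) ⟩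
          left t (n + i) ∸ 1               ≡⟨ m≤n⇒m∸n≡0 (≤-trans (m∸n≤m (size v (n + i)) (count (greedy t) (n + i))) (≤-reflexive (size-unit v i))) ⟩
          0                                ∎
          where
          open ≡-Reasoning
          late : n ≤ toℕ j₀
          late = priority≤0⇒late (≤-trans (least u available) (≤-reflexive (trans (cong priority toℕ-u) (priority-late (m≤m+n n i)))))
          w = toℕ j₀ ∸ n
          n+w≡ : n + w ≡ toℕ j₀
          n+w≡ = m+[n∸m]≡n late
          w≤i : w ≤ i
          w≤i = +-cancelˡ-≤ T w i (subst₂ _≤_ (trans (cong releaseTime (sym n+w≡)) (release-unit w)) (length-greedy t) r≤)
          w≮i : ¬ w < i
          w≮i w<i = <⇒≢ 1≤left₀ (sym (trans (cong (left t) (sym n+w≡)) (done w w<i)))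
          j₀≡ : toℕ j₀ ≡ n + i
          j₀≡ = trans (sym n+w≡) (cong (n +_) (≤-antisym w≤i (≮⇒≥ w≮i)))

    units-done : ∀ i → i ≤ M → ∀ u → u < i → left (T + i) (n + u) ≡ 0
    units-done (suc i) i<M u u<1+i = trans (cong (λ t → left t (n + u)) (+-suc T i)) (cases (u ≟ i))
      where
      cases : Dec (u ≡ i) → left (suc (T + i)) (n + u) ≡ 0
      cases (yes refl) = unit-step i i<M (units-done i (<⇒≤ i<M))
      cases (no  u≢i)  = n≤0⇒n≡0 (≤-trans (left-anti (n + u) (≤⇒≤′ (n≤1+n (T + i))))
        (≤-reflexive (units-done i (<⇒≤ i<M) u (≤∧≢⇒< (≤-pred u<1+i) u≢i))))

    isSmall : ℕ → Bool
    isSmall m = priority m ≡ᵇ 1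

    module Small = Volume isSmall
    module All   = Volume (λ _ → true)

    isSmall⇒priority : ∀ m → isSmall m ≡ true → priority m ≡ 1
    isSmall⇒priority m eq = ≡ᵇ⇒≡ (priority m) 1 (subst Bool.T (sym eq) _)

    priority≥1⇒main : ∀ m → 1 ≤ priority m → m < n
    priority≥1⇒main m 1≤p = ≰⇒> (λ n≤m → <⇒≢ 1≤p (sym (priority-late n≤m)))

    -- Before `T` no unit job is released, so the small jobs are the most urgent ones.
    small-preferred : ∀ t → t < T → Small.Preferred t
    small-preferred t t<T = (λ j → released (toℕ j)) , (λ i j → closed (toℕ i) (toℕ j))
      where
      released : ∀ m → isSmall m ≡ true → releaseTime m ≤ t
      released m eq = subst (_≤ t) (sym (release-main (priority≥1⇒main m (≤-reflexive (sym (isSmall⇒priority m eq)))))) z≤n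
      closed : ∀ m m′ → isSmall m ≡ true → releaseTime m′ ≤ t → priority m′ ≤ priority m → isSmall m′ ≡ true
      closed m m′ eq r≤t p≤ = dec-true (priority m′ ≟ 1) (≤-antisym (≤-trans p≤ (≤-reflexive (isSmall⇒priority m eq)))
        (≰⇒> (λ p≤0 → <⇒≱ t<T (≤-trans (m≤m+n T (m′ ∸ n)) (subst (_≤ t) (release-late (priority≤0⇒late p≤0)) r≤t)))))

    all-preferred : ∀ t → T + M ≤ t → All.Preferred t
    all-preferred t T+M≤t = (λ j _ → released (toℕ j) (toℕ<n j)) , λ _ _ _ _ _ → refl
      where
      released : ∀ m → m < n + M → releaseTime m ≤ t
      released m m<N with n ≤? m
      ... | no  n≰m = subst (_≤ t) (sym (release-main (≰⇒> n≰m))) z≤n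
      ... | yes n≤m = ≤-trans (≤-reflexive (release-late n≤m)) (≤-trans (+-monoʳ-≤ T (m≤n+o⇒m∸n≤o m n (<⇒≤ m<N))) T+M≤t)

    -- By `T + M` the unit jobs are done; the main volume left is at most `n * suc k` and is worked
    -- off without idling.
    horizon : ℕ
    horizon = T + M + n * suc k

    left-end : ∀ (j : Fin (n + M)) → left horizon (toℕ j) ≡ 0
    left-end j = n≤0⇒n≡0 (≤-trans (term (λ i → left horizon (toℕ i)) j) (begin
      All.vol horizon                            ≤⟨ All.vol-steps (T + M) (n * suc k) (λ i _ → all-preferred (T + M + i) (m≤m+n (T + M) i)) ⟩
      All.vol (T + M) ∸ n * suc k                ≤⟨ ∸-monoˡ-≤ (n * suc k) initial ⟩
      n * suc k ∸ n * suc k                      ≡⟨ n∸n≡0 (n * suc k) ⟩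
      0                                          ∎))
      where
      open ≤-Reasoning
      term : ∀ {m} (f : Fin m → ℕ) j → f j ≤ sum f
      term f zero    = m≤m+n (f zero) _
      term f (suc j) = ≤-trans (term (f ∘ suc) j) (m≤n+m _ (f zero))
      initial : All.vol (T + M) ≤ n * suc k
      initial = begin
        All.vol (T + M)                                     ≡⟨ sum-split n M (left (T + M)) ⟩
        sum {n} (λ j → left (T + M) (toℕ j)) + sum {M} (λ j → left (T + M) (n + toℕ j))  ≤⟨ +-mono-≤ (sum-mono {n} (λ j → ≤-trans (m∸n≤m (size v (toℕ j)) (count (greedy (T + M)) (toℕ j))) (size≤ v (toℕ j))))
                                                                (sum-mono {M} (λ j → ≤-reflexive (units-done M ≤-refl (toℕ j) (toℕ<n j)))) ⟩
        sum {n} (λ j → suc k) + sum {M} (λ _ → 0)           ≡⟨ cong₂ _+_ (sum-const n (suc k)) (trans (sum-const M 0) (*-zeroʳ M)) ⟩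
        n * suc k + 0                                       ≡⟨ +-identityʳ _ ⟩
        n * suc k                                           ∎

    Completion : ℕ → ℕ → Set
    Completion m C = left C m ≡ 0 × (∀ t → t < C → left t m ≢ 0)

    completion : ∀ m t → left t m ≡ 0 → ∃[ C ] Completion m C
    completion m zero    eq = 0 , eq , λ _ ()
    completion m (suc t) eq with left t m ≟ 0
    ... | yes left≡0 = completion m t left≡0
    ... | no  left≢0 = suc t , eq , λ t′ t′≤t left≡0 →
      left≢0 (n≤0⇒n≡0 (≤-trans (left-anti m (≤⇒≤′ (≤-pred t′≤t))) (≤-reflexive left≡0)))

    completion≤ : ∀ {m C t} → Completion m C → left t m ≡ 0 → C ≤ t
    completion≤ (_ , before≢0) eq = ≮⇒≥ (λ t<C → before≢0 _ t<C eq)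

    C : Fin (n + M) → ℕ
    C j = proj₁ (completion (toℕ j) horizon (left-end j))

    C-completion : ∀ j → Completion (toℕ j) (C j)
    C-completion j = proj₂ (completion (toℕ j) horizon (left-end j))

    flow : ℕ
    flow = sum {n + M} (λ j → C j ∸ releaseTime (toℕ j))

    totalFlow : TotalFlow I σ flow
    totalFlow = C , (λ j → transport (toℕ j) (C j) (C-completion j)) , sym (sum-allFin (λ j → C j ∸ releaseTime (toℕ j)))
      where
      transport : ∀ m c → Completion m c → (size v m ∸ count (before σ c) m ≡ 0) × (∀ t → t < c → size v m ∸ count (before σ t) m ≢ 0)
      transport m c (l , h) = trans (cong (λ ds → size v m ∸ count ds m) (before-σ c)) l
                            , λ t t<c eq → h t t<c (trans (cong (λ ds → size v m ∸ count ds m) (sym (before-σ t))) eq)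

    unfinished : ℕ
    unfinished = sum {n} (λ j → pos (left T (toℕ j)))

    -- A main job finished by `T` costs at most `T`, any other at most `horizon`. A unit job is
    -- served on release and costs at most 1.
    flow≤ : flow ≤ n * T + M + unfinished * (M + n * suc k)
    flow≤ = begin
      flow                                                 ≤⟨ sum-mono {n + M} (λ j → bound (toℕ j) (toℕ<n j) (C-completion j)) ⟩
      sum {n + M} (λ j → f (toℕ j))                        ≡⟨ sum-split n M f ⟩
      sum {n} (λ j → f (toℕ j)) + sum {M} (λ j → f (n + toℕ j))  ≤⟨ +-mono-≤ main units ⟩
      n * T + unfinished * Z + M                           ≡⟨ regroup (n * T) (unfinished * Z) M ⟩
      n * T + M + unfinished * Z                           ∎
      where
      open ≤-Reasoning
      Z = M + n * suc k
      regroup : ∀ a b c → a + b + c ≡ a + c + b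
      regroup = solve-∀
      f : ℕ → ℕ
      f m = if m <ᵇ n then T + pos (left T m) * Z else 1
      f-main : ∀ {m} → m < n → f m ≡ T + pos (left T m) * Z
      f-main {m} m<n = cong (if_then T + pos (left T m) * Z else 1) (dec-true (m <? n) m<n)
      f-late : ∀ {m} → n ≤ m → f m ≡ 1
      f-late {m} n≤m = cong (if_then T + pos (left T m) * Z else 1) (dec-false (m <? n) (≤⇒≯ n≤m))
      main : sum {n} (λ j → f (toℕ j)) ≤ n * T + unfinished * Z
      main = begin
        sum {n} (λ j → f (toℕ j))                          ≤⟨ sum-+-≤ {n} (λ _ → T) (λ j → Z * pos (left T (toℕ j))) (λ j → ≤-reflexive (trans (f-main (toℕ<n j)) (cong (T +_) (*-comm (pos (left T (toℕ j))) Z)))) ⟩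
        sum {n} (λ _ → T) + sum {n} (λ j → Z * pos (left T (toℕ j)))  ≡⟨ cong₂ _+_ (sum-const n T) (trans (sum-* {n} Z _) (*-comm Z unfinished)) ⟩
        n * T + unfinished * Z                             ∎
      units : sum {M} (λ j → f (n + toℕ j)) ≤ M
      units = ≤-trans (sum-mono {M} (λ j → ≤-reflexive (f-late (m≤m+n n (toℕ j))))) (≤-reflexive (trans (sum-const M 1) (*-identityʳ M)))
      bound : ∀ m → m < n + M → ∀ {c} → Completion m c → c ∸ releaseTime m ≤ f m
      bound m m<N {c} completes with n ≤? m
      ... | no n≰m = subst (c ∸ releaseTime m ≤_) (sym (f-main (≰⇒> n≰m))) (≤-trans (m∸n≤m c (releaseTime m)) (cases (1 ≤? left T m)))
        where
        cases : Dec (1 ≤ left T m) → c ≤ T + pos (left T m) * Z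
        cases (no  left≱1) = ≤-trans (completion≤ completes (n≤0⇒n≡0 (≤-pred (≰⇒> left≱1)))) (m≤m+n T _)
        cases (yes 1≤left) = subst (c ≤_) (trans (+-assoc T M _) (cong (T +_) (trans (sym (*-identityˡ Z)) (cong (_* Z) (sym (pos-≥1 1≤left))))))
          (completion≤ completes (trans (cong (left horizon) (sym (toℕ-fromℕ< m<N))) (left-end (fromℕ< m<N))))
      ... | yes n≤m = begin
        c ∸ releaseTime m       ≤⟨ ∸-monoˡ-≤ (releaseTime m) (completion≤ completes done) ⟩
        T + suc u ∸ releaseTime m   ≡⟨ cong₂ _∸_ (+-suc T u) (release-late n≤m) ⟩
        suc (T + u) ∸ (T + u)   ≡⟨ m+n∸n≡m 1 (T + u) ⟩
        1                       ≡⟨ f-late n≤m ⟨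
        f m                     ∎
        where
        u = m ∸ n
        n+u≡m : n + u ≡ m
        n+u≡m = m+[n∸m]≡n n≤m
        done : left (T + suc u) m ≡ 0
        done = trans (cong (left (T + suc u)) (sym n+u≡m))
          (units-done (suc u) (+-cancelˡ-< n u M (subst (_< n + M) (sym n+u≡m) m<N)) u ≤-refl)

    -- Each unfinished small job has at least one unit left, so their number is at most their
    -- left-over volume. That volume falls by one in every interval before `T` until it is used up.
    unfinished≤ : unfinished ≤ sum {n} (λ j → big (lookup v j)) + (sum {n} (λ j → small (lookup v j)) ∸ T)
    unfinished≤ = begin
      unfinished                                           ≤⟨ sum-+-≤ {n} (λ j → big (lookup v j)) (λ j → if isSmall (toℕ j) then left T (toℕ j) else 0) (λ j → bound j) ⟩
      B + sum {n} (λ j → if isSmall (toℕ j) then left T (toℕ j) else 0) ≤⟨ +-monoʳ-≤ B (≤-trans (m≤m+n _ _) (≤-reflexive (sym (sum-split n M (λ m → if isSmall m then left T m else 0))))) ⟩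
      B + Small.vol (0 + T)                                ≤⟨ +-monoʳ-≤ B (Small.vol-steps 0 T (λ i i<T → small-preferred i i<T)) ⟩
      B + (Small.vol 0 ∸ T)                                ≤⟨ +-monoʳ-≤ B (∸-monoˡ-≤ T initial) ⟩
      B + (sum {n} (λ j → small (lookup v j)) ∸ T)         ∎
      where
      open ≤-Reasoning
      B = sum {n} (λ j → big (lookup v j))
      priority-lookup : ∀ j → priority (toℕ j) ≡ (if toℕ (lookup v j) <ᵇ k then 1 else 2)
      priority-lookup j = trans (priority-main (toℕ<n j)) (cong (λ x → if x ≤ᵇ k then 1 else 2) (size-lookup v j))
      bound : ∀ j → pos (left T (toℕ j)) ≤ big (lookup v j) + (if isSmall (toℕ j) then left T (toℕ j) else 0)
      bound j = subst (λ p → pos (left T (toℕ j)) ≤ big (lookup v j) + (if p ≡ᵇ 1 then left T (toℕ j) else 0))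
        (sym (priority-lookup j)) (cases (toℕ (lookup v j) <ᵇ k))
        where
        cases : ∀ b → pos (left T (toℕ j)) ≤ (if b then 0 else 1) + (if (if b then 1 else 2) ≡ᵇ 1 then left T (toℕ j) else 0)
        cases true  = pos≤ (left T (toℕ j))
        cases false = m⊓n≤m 1 (left T (toℕ j))
      initial : Small.vol 0 ≤ sum {n} (λ j → small (lookup v j))
      initial = begin
        Small.vol 0                                        ≡⟨ sum-split n M (λ m → if isSmall m then left 0 m else 0) ⟩
        sum {n} (λ j → if isSmall (toℕ j) then left 0 (toℕ j) else 0) + sum {M} (λ j → if isSmall (n + toℕ j) then left 0 (n + toℕ j) else 0)
                                                           ≤⟨ +-mono-≤ (sum-mono {n} main) (sum-mono {M} (λ j → ≤-reflexive (cong (λ p → if p ≡ᵇ 1 then left 0 (n + toℕ j) else 0) (priority-late (m≤m+n n (toℕ j)))))) ⟩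
        sum {n} (λ j → small (lookup v j)) + sum {M} (λ _ → 0) ≡⟨ trans (cong (sum {n} (λ j → small (lookup v j)) +_) (trans (sum-const M 0) (*-zeroʳ M))) (+-identityʳ _) ⟩
        sum {n} (λ j → small (lookup v j))                 ∎
        where
        main : ∀ j → (if isSmall (toℕ j) then left 0 (toℕ j) else 0) ≤ small (lookup v j)
        main j = subst₂ (λ p x → (if p ≡ᵇ 1 then x else 0) ≤ small (lookup v j)) (sym (priority-lookup j)) (sym (size-lookup v j))
          (cases (toℕ (lookup v j) <ᵇ k))
          where
          cases : ∀ b → (if (if b then 1 else 2) ≡ᵇ 1 then suc (toℕ (lookup v j)) else 0) ≤ (if b then suc (toℕ (lookup v j)) else 0)
          cases true  = ≤-refl
          cases false = z≤n

    flow≤flowBound : flow ≤ flowBound n M T v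
    flow≤flowBound = ≤-trans flow≤ (+-monoʳ-≤ (n * T + M) (*-monoˡ-≤ (M + n * suc k) unfinished≤))

  -- Parameters and averaged flow times

  G-big : ∀ k → G k big ≡ 1
  G-big zero    = refl
  G-big (suc k) = trans (cong (_+ G k big) (*-zeroʳ (2 ^ k))) (G-big k)

  small+big : ∀ k (p : Fin (suc k)) → suc (toℕ p) ≡ small p + suc k * big p
  small+big k p with toℕ p <ᵇ k in eq
  ... | true  = sym (trans (cong (suc (toℕ p) +_) (*-zeroʳ (suc k))) (+-identityʳ _))
  ... | false = trans (cong suc (≤-antisym (≤-pred (toℕ<n p)) (≮⇒≥ (λ p<k → subst Bool.T eq (<⇒<ᵇ p<k))))) (sym (*-identityʳ (suc k)))

  small≤ : ∀ k (p : Fin (suc k)) → small p ≤ suc k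
  small≤ k p = ≤-trans (m≤m+n _ _) (≤-trans (≤-reflexive (sym (small+big k p))) (toℕ<n p))

  G-suc-toℕ : ∀ k → G k (λ p → suc (toℕ p)) ≡ G k small + suc k
  G-suc-toℕ k = begin
    G k (λ p → suc (toℕ p))                    ≡⟨ G-cong k (small+big k) ⟩
    G k (λ p → small p + suc k * big p)        ≡⟨ trans (G-+ k small _) (cong (G k small +_) (G-* k (suc k) big)) ⟩
    G k small + suc k * G k big                ≡⟨ cong (λ x → G k small + suc k * x) (G-big k) ⟩
    G k small + suc k * 1                      ≡⟨ cong (G k small +_) (*-identityʳ (suc k)) ⟩
    G k small + suc k                          ∎
    where open ≡-Reasoning

  -- 2 h jobs have size K in expectation.  T exceeds the expected volume of the
  -- smaller jobs, 2 h G k small, by half the expected volume of those jobs; with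
  -- h = W K this margin dominates the standard deviation.
  module Parameters (k : ℕ) where

    W K h c n T M₀ M unit : ℕ
    W  = 2 ^ k
    K  = suc k
    h  = W * K
    c  = 2 * h * G k small
    n  = 2 * h * W
    T  = c + K * h
    -- Exceeds `n * T` and `n * K`, so that the stream dominates all other costs. The 3 in `M`
    -- cancels the 3 of memorylessness, and `unit` is the common scale in which the averaged flow
    -- times are at least `K` online and at most 24 offline.
    M₀ = suc (n * T + n * K)
    M  = 3 * M₀
    unit = W ^ n * h * M₀

    instance
      W≢0 : NonZero W
      W≢0 = m^n≢0 2 k
      h≢0 : NonZero h
      h≢0 = m*n≢0 W K
      Wⁿ≢0 : NonZero (W ^ n)
      Wⁿ≢0 = m^n≢0 W n

    1≤unit : 1 ≤ unit
    1≤unit = >-nonZero⁻¹ unit ⦃ m*n≢0 (W ^ n * h) M₀ ⦃ m*n≢0 (W ^ n) h ⦄ ⦄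

    1≤M : 1 ≤ M
    1≤M = s≤s z≤n

    E-mean : ∀ g → E k n (λ v → sum (λ j → g (lookup v j))) ≡ 2 * h * G k g * W ^ n
    E-mean g = *-cancelʳ-≡ _ _ W (trans (E-statistic k n g) (regroup (2 * h) W (G k g) (W ^ n)))
      where
      regroup : ∀ a w g u → a * w * g * u ≡ a * g * u * w
      regroup = solve-∀

    -- The variance bound `n * K²` equals `2 * h² * K` because `h = W * K`; dividing by four times
    -- the margin `K * h` leaves `h / 2`.
    E-small-tail : E k n (λ v → sum {n} (λ j → small (lookup v j)) ∸ T) ≤ h * W ^ n
    E-small-tail = *-cancelˡ-≤ (4 * (K * h)) ⦃ m*n≢0 4 (K * h) ⦃ _ ⦄ ⦃ m*n≢0 K h ⦄ ⦄ (begin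
      4 * (K * h) * E k n (λ v → sum {n} (λ j → small (lookup v j)) ∸ T)   ≤⟨ E-tail k small K (small≤ k) n c (K * h) (regroup W h (G k small)) ⟩
      W ^ n * (n * (K * K))                       ≡⟨ regroup′ (W ^ n) h W K ⟩
      W ^ n * (2 * h * (h * K))                   ≤⟨ m≤n*m (W ^ n * (2 * h * (h * K))) 2 ⟩
      2 * (W ^ n * (2 * h * (h * K)))             ≡⟨ regroup″ (W ^ n) h K ⟩
      4 * (K * h) * (h * W ^ n)                   ∎)
      where
      open ≤-Reasoning
      regroup : ∀ w h g → 2 * h * w * g ≡ w * (2 * h * g)
      regroup = solve-∀
      regroup′ : ∀ u h w K → u * (2 * h * w * (K * K)) ≡ u * (2 * h * (w * K * K))
      regroup′ = solve-∀
      regroup″ : ∀ u h K → 2 * (u * (2 * h * (h * K))) ≡ 4 * (K * h) * (h * u)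
      regroup″ = solve-∀

    -- Since `M` dominates `n * T` and `n * K`, the bound is at most `2 M (1 + B + S)`. The means of
    -- `B` and `S` are `2 h` and at most `h`, and `1 ≤ h`, so the total is at most
    -- `8 M h = 24 M₀ h`.
    E-flowBound : E k n (flowBound n M T) ≤ 24 * unit
    E-flowBound = begin
      E k n (flowBound n M T)                     ≤⟨ E-mono k n crude ⟩
      E k n (λ v → 2 * M + 2 * M * (B v + S v))   ≡⟨ trans (E-+ k n _ _) (cong₂ _+_ (E-const k n (2 * M)) (trans (E-* k n (2 * M) _) (cong (2 * M *_) (E-+ k n B S)))) ⟩
      W ^ n * (2 * M) + 2 * M * (E k n B + E k n S)  ≤⟨ +-monoʳ-≤ (W ^ n * (2 * M)) (*-monoʳ-≤ (2 * M) (+-mono-≤ (≤-reflexive (trans (E-mean big) (cong (λ g → 2 * h * g * W ^ n) (G-big k)))) E-small-tail)) ⟩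
      W ^ n * (2 * M) + 2 * M * (2 * h * 1 * W ^ n + h * W ^ n)  ≤⟨ +-monoˡ-≤ _ (m≤n*m (W ^ n * (2 * M)) h) ⟩
      h * (W ^ n * (2 * M)) + 2 * M * (2 * h * 1 * W ^ n + h * W ^ n)  ≡⟨ regroup h (W ^ n) M₀ ⟩
      24 * unit                                   ∎
      where
      open ≤-Reasoning
      B S : Vec (Fin (suc k)) n → ℕ
      B v = sum {n} (λ j → big (lookup v j))
      S v = sum {n} (λ j → small (lookup v j)) ∸ T
      regroup : ∀ h u m → h * (u * (2 * (3 * m))) + 2 * (3 * m) * (2 * h * 1 * u + h * u) ≡ 24 * (u * h * m)
      regroup = solve-∀
      M₀≤M : M₀ ≤ M
      M₀≤M = m≤n*m M₀ 3
      nT≤M : n * T ≤ M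
      nT≤M = ≤-trans (≤-trans (m≤m+n (n * T) (n * K)) (n≤1+n _)) M₀≤M
      nK≤M : n * K ≤ M
      nK≤M = ≤-trans (≤-trans (m≤n+m (n * K) (n * T)) (n≤1+n _)) M₀≤M
      crude : ∀ v → flowBound n M T v ≤ 2 * M + 2 * M * (B v + S v)
      crude v = +-mono-≤ (≤-trans (+-monoˡ-≤ M nT≤M) (≤-reflexive (double M)))
        (≤-trans (*-monoʳ-≤ (B v + S v) (≤-trans (+-monoʳ-≤ M nK≤M) (≤-reflexive (double M)))) (≤-reflexive (*-comm (B v + S v) (2 * M))))
        where
        double : ∀ m → m + m ≡ 2 * m
        double = solve-∀

    module _ (s a : ℕ) (1≤a : 1 ≤ a) (1≤s : 1 ≤ s) where
      open Adversary k n M T s a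
      open Play 1≤a 1≤s

      -- The expected volume `2 h (G k small + K)` exceeds `T` by `K h`, so by `E-alive` the
      -- unfinished jobs number at least `K h / 3` on average.
      E-flow-lower : ∀ π → K * unit ≤ E k n (λ v → M * suc (alive v (decisions (inst v) π T)))
      E-flow-lower π = begin
        K * unit                                  ≡⟨ regroup K (W ^ n) h M₀ ⟩
        M₀ * (W ^ n * (K * h))                    ≤⟨ *-monoʳ-≤ M₀ main ⟩
        M₀ * (3 * E k n A)                        ≡⟨ trans (regroup″ M₀ (E k n A)) (sym (E-* k n M A)) ⟩
        E k n (λ v → M * A v)                     ≤⟨ E-mono k n (λ v → *-monoʳ-≤ M (n≤1+n (A v))) ⟩
        E k n (λ v → M * suc (A v))               ∎
        where
        open ≤-Reasoning
        A : Vec (Fin (suc k)) n → ℕ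
        A v = alive v (decisions (inst v) π T)
        regroup : ∀ K u h m → K * (u * h * m) ≡ m * (u * (K * h))
        regroup = solve-∀
        regroup″ : ∀ m e → m * (3 * e) ≡ 3 * m * e
        regroup″ = solve-∀
        regroup′ : ∀ u h g K → u * (2 * h * g + K * h) + u * (K * h) ≡ 2 * h * (g + K) * u
        regroup′ = solve-∀
        total : E k n (λ v → sum {n} (λ j → size v (toℕ j))) ≡ 2 * h * (G k small + K) * W ^ n
        total = trans (E-cong k n (λ v → sum-cong-≗ {n} (size-lookup v))) (trans (E-mean (λ p → suc (toℕ p))) (cong (λ g → 2 * h * g * W ^ n) (G-suc-toℕ k)))
        main : W ^ n * (K * h) ≤ 3 * E k n A
        main = +-cancelˡ-≤ (W ^ n * T) _ _ (begin
          W ^ n * T + W ^ n * (K * h)                      ≡⟨ regroup′ (W ^ n) h (G k small) K ⟩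
          2 * h * (G k small + K) * W ^ n                  ≡⟨ total ⟨
          E k n (λ v → sum {n} (λ j → size v (toℕ j)))     ≤⟨ E-alive π ⟩
          W ^ n * T + 3 * E k n A                          ∎)

-- Real numbers

import Data.Integer.Base as ℤ
import Data.Integer.Properties as ℤ
import Data.Nat.Coprimality as ℕ
open import Data.Rational.Base as ℚ using (ℚ; 0ℚ; 1ℚ; ½)
import Data.Rational.Properties as ℚ
open import Data.Rational.Solver using (module +-*-Solver)
open import Defs
open Averages using (weightedSum; E; E-list)
open Scheduling

ι : ℕ → ℚ
ι n = ℤ.+ n ℚ./ 1

-- `ι n` is a quotient still to be normalised, on which arithmetic is stuck for variable `n`; this
-- form has an explicit numerator and denominator.
ι-lowest-terms : ∀ n → ι n ≡ ℚ.mkℚ (ℤ.+ n) 0 (ℕ.sym (ℕ.1-coprimeTo n))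
ι-lowest-terms n = ℚ.↥p/↧p≡p (ℚ.mkℚ (ℤ.+ n) 0 (ℕ.sym (ℕ.1-coprimeTo n)))

ι-+ : ∀ m n → ι (m ℕ.+ n) ≡ ι m ℚ.+ ι n
ι-+ m n = sym (trans (cong₂ ℚ._+_ (ι-lowest-terms m) (ι-lowest-terms n))
  (ℚ./-cong (cong₂ ℤ._+_ (ℤ.*-identityʳ (ℤ.+ m)) (ℤ.*-identityʳ (ℤ.+ n))) refl))

ι-* : ∀ m n → ι (m ℕ.* n) ≡ ι m ℚ.* ι n
ι-* m n = sym (trans (cong₂ ℚ._*_ (ι-lowest-terms m) (ι-lowest-terms n))
  (ℚ./-cong (sym (ℤ.pos-* m n)) refl))

ι-mono : ∀ {m n} → m ℕ.≤ n → ι m ℚ.≤ ι n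
ι-mono {m} {n} m≤n = subst₂ ℚ._≤_ (sym (ι-lowest-terms m)) (sym (ι-lowest-terms n))
  (ℚ.*≤* (ℤ.*-monoʳ-≤-nonNeg (ℤ.+ 1) (ℤ.+≤+ m≤n)))

*-monoˡ : ∀ {p q r} → 0ℚ ℚ.≤ r → p ℚ.≤ q → p ℚ.* r ℚ.≤ q ℚ.* r
*-monoˡ {r = r} 0≤r = ℚ.*-monoʳ-≤-nonNeg r ⦃ ℚ.nonNegative 0≤r ⦄

*-monoʳ : ∀ {p q r} → 0ℚ ℚ.≤ r → p ℚ.≤ q → r ℚ.* p ℚ.≤ r ℚ.* q
*-monoʳ {r = r} 0≤r = ℚ.*-monoˡ-≤-nonNeg r ⦃ ℚ.nonNegative 0≤r ⦄

archimedean : ∀ p → ∃[ n ] p ℚ.≤ ι n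
archimedean (ℚ.mkℚ (ℤ.+ m) d c) = m , subst (ℚ.mkℚ (ℤ.+ m) d c ℚ.≤_) (sym (ι-lowest-terms m))
  (ℚ.*≤* (subst₂ ℤ._≤_ (ℤ.pos-* m 1) (ℤ.pos-* m (suc d)) (ℤ.+≤+ (ℕ.*-monoʳ-≤ m (ℕ.s≤s ℕ.z≤n)))))
archimedean (ℚ.mkℚ ℤ.-[1+ m ] d c) = 0 , ℚ.*≤* ℤ.-≤+

p≤p+δ : ∀ {p δ} → 0ℚ ℚ.< δ → p ℚ.≤ p ℚ.+ δ
p≤p+δ {p} {δ} 0<δ = subst (ℚ._≤ p ℚ.+ δ) (ℚ.+-identityʳ p) (ℚ.+-monoʳ-≤ p (ℚ.<⇒≤ 0<δ))

Eventually : (ℕ → Set) → Set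
Eventually P = ∃[ N ] ∀ n → N ℕ.≤ n → P n

eventually : ∀ {P} → (∀ n → P n) → Eventually P
eventually p = 0 , λ n _ → p n

map₂ : ∀ {P Q R : ℕ → Set} → (∀ n → P n → Q n → R n) → Eventually P → Eventually Q → Eventually R
map₂ f (N₁ , p) (N₂ , q) = N₁ ℕ.⊔ N₂ , λ n N≤n →
  f n (p n (ℕ.m⊔n≤o⇒m≤o N₁ N₂ N≤n)) (q n (ℕ.m⊔n≤o⇒n≤o N₁ N₂ N≤n))

map₁ : ∀ {P Q : ℕ → Set} → (∀ n → P n → Q n) → Eventually P → Eventually Q
map₁ f (N , p) = N , λ n N≤n → f n (p n N≤n)

eventually⇒≤ : ∀ {x y} → Eventually (λ n → seq x n ℚ.≤ seq y n) → x ≤ y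
eventually⇒≤ {x} {y} x≤y δ 0<δ = map₁ (λ n h → ℚ.≤-trans h (p≤p+δ 0<δ)) x≤y

pointwise⇒≃ : ∀ {x y} → (∀ n → seq x n ≡ seq y n) → x ≃ y
pointwise⇒≃ {x} {y} x≡y = eventually⇒≤ {x} {y} (eventually λ n → ℚ.≤-reflexive (x≡y n))
               , eventually⇒≤ {y} {x} (eventually λ n → ℚ.≤-reflexive (sym (x≡y n)))

≤-refl : ∀ {x} → x ≤ x
≤-refl {x} = eventually⇒≤ {x} {x} (eventually λ n → ℚ.≤-refl)

≤-trans : ∀ {x y z} → x ≤ y → y ≤ z → x ≤ z
≤-trans {x} {y} {z} x≤y y≤z δ 0<δ = map₂ step (x≤y η (half-pos 0<δ)) (y≤z η (half-pos 0<δ))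
  where
  η = ½ ℚ.* δ
  open ℚ.≤-Reasoning
  step : ∀ n → seq x n ℚ.≤ seq y n ℚ.+ η → seq y n ℚ.≤ seq z n ℚ.+ η → seq x n ℚ.≤ seq z n ℚ.+ δ
  step n h₁ h₂ = begin
    seq x n                   ≤⟨ h₁ ⟩
    seq y n ℚ.+ η             ≤⟨ ℚ.+-monoˡ-≤ η h₂ ⟩
    seq z n ℚ.+ η ℚ.+ η       ≡⟨ ℚ.+-assoc (seq z n) η η ⟩
    seq z n ℚ.+ (η ℚ.+ η)     ≡⟨ cong (seq z n ℚ.+_) (halves δ) ⟩
    seq z n ℚ.+ δ             ∎

+-mono-≤ : ∀ {x y u v} → x ≤ y → u ≤ v → x + u ≤ y + v
+-mono-≤ {x} {y} {u} {v} x≤y u≤v δ 0<δ = map₂ step (x≤y η (half-pos 0<δ)) (u≤v η (half-pos 0<δ))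
  where
  η = ½ ℚ.* δ
  open ℚ.≤-Reasoning
  open +-*-Solver
  step : ∀ n → seq x n ℚ.≤ seq y n ℚ.+ η → seq u n ℚ.≤ seq v n ℚ.+ η →
         seq x n ℚ.+ seq u n ℚ.≤ seq y n ℚ.+ seq v n ℚ.+ δ
  step n h₁ h₂ = begin
    seq x n ℚ.+ seq u n                       ≤⟨ ℚ.+-mono-≤ h₁ h₂ ⟩
    (seq y n ℚ.+ η) ℚ.+ (seq v n ℚ.+ η)       ≡⟨ solve 3 (λ a b e → (a :+ e) :+ (b :+ e) := a :+ b :+ (e :+ e)) refl (seq y n) (seq v n) η ⟩
    seq y n ℚ.+ seq v n ℚ.+ (η ℚ.+ η)         ≡⟨ cong (seq y n ℚ.+ seq v n ℚ.+_) (halves δ) ⟩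
    seq y n ℚ.+ seq v n ℚ.+ δ                 ∎

-- The tolerance `δ` is divided by an eventual bound `b` of `z`. Nonnegativity is asked of almost
-- all terms of `z`, so that inequalities can be multiplied term by term.
*-monoʳ-≤ : ∀ {x y z} → Eventually (λ n → 0ℚ ℚ.≤ seq z n) → x ≤ y → x * z ≤ y * z
*-monoʳ-≤ {x} {y} {z} 0≤z x≤y δ 0<δ =
  let (b , 0<b , z≤b)  = eventually-bounded z
      (η , 0<η , bη≡δ) = quotient 0<b 0<δ
      open ℚ.≤-Reasoning
  in map₂ (λ n h (0≤zn , zn≤b) → begin
       seq x n ℚ.* seq z n                       ≤⟨ *-monoˡ 0≤zn h ⟩
       (seq y n ℚ.+ η) ℚ.* seq z n               ≡⟨ ℚ.*-distribʳ-+ (seq z n) (seq y n) η ⟩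
       seq y n ℚ.* seq z n ℚ.+ η ℚ.* seq z n     ≤⟨ ℚ.+-monoʳ-≤ (seq y n ℚ.* seq z n)
                                                      (*-monoʳ (ℚ.<⇒≤ 0<η) (subst (ℚ._≤ b) (ℚ.0≤p⇒∣p∣≡p 0≤zn) zn≤b)) ⟩
       seq y n ℚ.* seq z n ℚ.+ η ℚ.* b           ≡⟨ cong (seq y n ℚ.* seq z n ℚ.+_) (trans (ℚ.*-comm η b) bη≡δ) ⟩
       seq y n ℚ.* seq z n ℚ.+ δ                 ∎)
     (x≤y η 0<η) (map₂ (λ n p q → p , q) 0≤z z≤b)

*-comm : ∀ x y → x * y ≃ y * x
*-comm x y = pointwise⇒≃ {x * y} {y * x} (λ n → ℚ.*-comm (seq x n) (seq y n))

*-monoˡ-≤ : ∀ {x y z} → Eventually (λ n → 0ℚ ℚ.≤ seq z n) → x ≤ y → z * x ≤ z * y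
*-monoˡ-≤ {x} {y} {z} 0≤z x≤y =
  ≤-trans {z * x} {x * z} {z * y} (proj₁ (*-comm z x))
    (≤-trans {x * z} {y * z} {z * y} (*-monoʳ-≤ {x} {y} {z} 0≤z x≤y) (proj₁ (*-comm y z)))

fromℕ-nonneg : ∀ m → Eventually (λ n → 0ℚ ℚ.≤ seq (fromℕ m) n)
fromℕ-nonneg m = eventually λ _ → ι-mono {0} {m} ℕ.z≤n

fromℕ-mono : ∀ {m n} → m ℕ.≤ n → fromℕ m ≤ fromℕ n
fromℕ-mono {m} {n} m≤n = eventually⇒≤ {fromℕ m} {fromℕ n} (eventually λ _ → ι-mono m≤n)

<⇒eventually-nonneg : ∀ {x} → 0ℝ < x → Eventually (λ n → 0ℚ ℚ.≤ seq x n)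
<⇒eventually-nonneg (δ , 0<δ , N , h) = N , λ n N≤n →
  ℚ.≤-trans (subst (0ℚ ℚ.≤_) (sym (ℚ.+-identityˡ δ)) (ℚ.<⇒≤ 0<δ)) (h n N≤n)

p≤∣p∣ : ∀ p → p ℚ.≤ ℚ.∣ p ∣
p≤∣p∣ p with ℚ.≤-total 0ℚ p
... | inj₁ 0≤p = ℚ.≤-reflexive (sym (ℚ.0≤p⇒∣p∣≡p 0≤p))
... | inj₂ p≤0 = ℚ.≤-trans p≤0 (ℚ.0≤∣p∣ p)

∣p-q∣≤r⇒p≤q+r : ∀ {p q r} → ℚ.∣ p ℚ.- q ∣ ℚ.≤ r → p ℚ.≤ q ℚ.+ r
∣p-q∣≤r⇒p≤q+r {p} {q} {r} h = begin
  p                  ≡⟨ cancel p q ⟩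
  q ℚ.+ (p ℚ.- q)    ≤⟨ ℚ.+-monoʳ-≤ q (ℚ.≤-trans (p≤∣p∣ (p ℚ.- q)) h) ⟩
  q ℚ.+ r            ∎
  where
  open ℚ.≤-Reasoning
  open +-*-Solver
  cancel : ∀ a b → a ≡ b ℚ.+ (a ℚ.- b)
  cancel = solve 2 (λ a b → a := b :+ (a :- b)) refl

+-cancelʳ-≤ : ∀ {p q} r → p ℚ.+ r ℚ.≤ q ℚ.+ r → p ℚ.≤ q
+-cancelʳ-≤ {p} {q} r h = subst₂ ℚ._≤_ (cancel p r) (cancel q r) (ℚ.+-monoˡ-≤ (ℚ.- r) h)
  where
  open +-*-Solver
  cancel : ∀ a r → a ℚ.+ r ℚ.+ ℚ.- r ≡ a
  cancel = solve 2 (λ a r → a :+ r :+ :- r := a) refl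

-- The order of reals is not decidable, but with a tolerance it is: past an index `N` both sequences
-- vary by at most `e = δ / 8`, and one rational comparison at `N` selects an alternative.
compare : ∀ x y δ → 0ℚ ℚ.< δ → Eventually (λ n → seq x n ℚ.≤ seq y n ℚ.+ δ) ⊎ y < x
compare x y δ 0<δ = decide (cauchy x e 0<e) (cauchy y e 0<e)
  where
  open ℚ.≤-Reasoning
  h = ½ ℚ.* δ
  η = ½ ℚ.* h
  e = ½ ℚ.* η
  0<h : 0ℚ ℚ.< h
  0<h = half-pos 0<δ
  0<η : 0ℚ ℚ.< η
  0<η = half-pos 0<h
  0<e : 0ℚ ℚ.< e
  0<e = half-pos 0<η
  regroup : ∀ a e h → a ℚ.+ e ℚ.+ h ℚ.+ e ≡ a ℚ.+ (h ℚ.+ (e ℚ.+ e))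
  regroup = solve 3 (λ a e h → a :+ e :+ h :+ e := a :+ (h :+ (e :+ e))) refl
    where open +-*-Solver
  regroup′ : ∀ a e η → a ℚ.+ e ℚ.+ η ℚ.+ e ≡ a ℚ.+ η ℚ.+ (e ℚ.+ e)
  regroup′ = solve 3 (λ a e η → a :+ e :+ η :+ e := a :+ η :+ (e :+ e)) refl
    where open +-*-Solver
  decide : ∃[ N ] (∀ m n → N ℕ.≤ m → N ℕ.≤ n → ℚ.∣ seq x m ℚ.- seq x n ∣ ℚ.≤ e) →
           ∃[ N ] (∀ m n → N ℕ.≤ m → N ℕ.≤ n → ℚ.∣ seq y m ℚ.- seq y n ∣ ℚ.≤ e) →
           Eventually (λ n → seq x n ℚ.≤ seq y n ℚ.+ δ) ⊎ y < x
  decide (N₁ , c₁) (N₂ , c₂) = cases (seq x N ℚ.≤? seq y N ℚ.+ h)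
    where
    N = N₁ ℕ.⊔ N₂
    near-x : ∀ m n → N ℕ.≤ m → N ℕ.≤ n → seq x m ℚ.≤ seq x n ℚ.+ e
    near-x m n N≤m N≤n = ∣p-q∣≤r⇒p≤q+r (c₁ m n (ℕ.m⊔n≤o⇒m≤o N₁ N₂ N≤m) (ℕ.m⊔n≤o⇒m≤o N₁ N₂ N≤n))
    near-y : ∀ m n → N ℕ.≤ m → N ℕ.≤ n → seq y m ℚ.≤ seq y n ℚ.+ e
    near-y m n N≤m N≤n = ∣p-q∣≤r⇒p≤q+r (c₂ m n (ℕ.m⊔n≤o⇒n≤o N₁ N₂ N≤m) (ℕ.m⊔n≤o⇒n≤o N₁ N₂ N≤n))
    cases : Dec (seq x N ℚ.≤ seq y N ℚ.+ h) → Eventually (λ n → seq x n ℚ.≤ seq y n ℚ.+ δ) ⊎ y < x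
    cases (yes x≤y) = inj₁ (N , λ n N≤n → begin
      seq x n                                ≤⟨ near-x n N N≤n ℕ.≤-refl ⟩
      seq x N ℚ.+ e                          ≤⟨ ℚ.+-monoˡ-≤ e x≤y ⟩
      seq y N ℚ.+ h ℚ.+ e                    ≤⟨ ℚ.+-monoˡ-≤ e (ℚ.+-monoˡ-≤ h (near-y N n ℕ.≤-refl N≤n)) ⟩
      seq y n ℚ.+ e ℚ.+ h ℚ.+ e              ≡⟨ regroup (seq y n) e h ⟩
      seq y n ℚ.+ (h ℚ.+ (e ℚ.+ e))          ≡⟨ cong (λ z → seq y n ℚ.+ (h ℚ.+ z)) (halves η) ⟩
      seq y n ℚ.+ (h ℚ.+ η)                  ≤⟨ ℚ.+-monoʳ-≤ (seq y n) (ℚ.+-monoʳ-≤ h (p≤p+δ 0<η)) ⟩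
      seq y n ℚ.+ (h ℚ.+ (η ℚ.+ η))          ≡⟨ cong (λ z → seq y n ℚ.+ (h ℚ.+ z)) (halves h) ⟩
      seq y n ℚ.+ (h ℚ.+ h)                  ≡⟨ cong (seq y n ℚ.+_) (halves δ) ⟩
      seq y n ℚ.+ δ                          ∎)
    cases (no x≰y) = inj₂ (η , 0<η , N , λ n N≤n → +-cancelʳ-≤ (e ℚ.+ e) (begin
      seq y n ℚ.+ η ℚ.+ (e ℚ.+ e)            ≡⟨ sym (regroup′ (seq y n) e η) ⟩
      seq y n ℚ.+ e ℚ.+ η ℚ.+ e              ≤⟨ ℚ.+-monoˡ-≤ e (ℚ.+-monoˡ-≤ η (ℚ.+-monoˡ-≤ e (near-y n N N≤n ℕ.≤-refl))) ⟩
      seq y N ℚ.+ e ℚ.+ e ℚ.+ η ℚ.+ e        ≡⟨ regroup″ (seq y N) e η ⟩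
      seq y N ℚ.+ ((e ℚ.+ e) ℚ.+ η) ℚ.+ e    ≡⟨ cong (λ z → seq y N ℚ.+ (z ℚ.+ η) ℚ.+ e) (halves η) ⟩
      seq y N ℚ.+ (η ℚ.+ η) ℚ.+ e            ≡⟨ cong (λ z → seq y N ℚ.+ z ℚ.+ e) (halves h) ⟩
      seq y N ℚ.+ h ℚ.+ e                    ≤⟨ ℚ.+-monoˡ-≤ e (ℚ.<⇒≤ (ℚ.≰⇒> x≰y)) ⟩
      seq x N ℚ.+ e                          ≤⟨ ℚ.+-monoˡ-≤ e (near-x N n ℕ.≤-refl N≤n) ⟩
      seq x n ℚ.+ e ℚ.+ e                    ≡⟨ ℚ.+-assoc (seq x n) e e ⟩
      seq x n ℚ.+ (e ℚ.+ e)                  ∎))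
      where
      regroup″ : ∀ a e η → a ℚ.+ e ℚ.+ e ℚ.+ η ℚ.+ e ≡ a ℚ.+ ((e ℚ.+ e) ℚ.+ η) ℚ.+ e
      regroup″ = solve 3 (λ a e η → a :+ e :+ e :+ η :+ e := a :+ ((e :+ e) :+ η) :+ e) refl
        where open +-*-Solver

<⇒≤ : ∀ {x y} → x < y → x ≤ y
<⇒≤ {x} {y} (δ , 0<δ , h) = eventually⇒≤ {x} {y} (map₁ (λ n → ℚ.≤-trans (p≤p+δ 0<δ)) h)

<⇒≱ : ∀ {x y} → x < y → ¬ y ≤ x
<⇒≱ {x} {y} (δ , 0<δ , h) y≤x = absurd (map₂ (λ n → ℚ.≤-trans) h (y≤x (½ ℚ.* δ) (half-pos 0<δ)))
  where
  absurd : ¬ Eventually (λ n → seq x n ℚ.+ δ ℚ.≤ seq x n ℚ.+ ½ ℚ.* δ)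
  absurd (N , c) = ℚ.<-irrefl refl (ℚ.<-≤-trans (ℚ.+-monoʳ-< (seq x N) ½δ<δ) (c N ℕ.≤-refl))
    where
    ½δ<δ : ½ ℚ.* δ ℚ.< δ
    ½δ<δ = subst₂ ℚ._<_ (ℚ.+-identityʳ (½ ℚ.* δ)) (halves δ) (ℚ.+-monoʳ-< (½ ℚ.* δ) (half-pos 0<δ))

-- For each tolerance `compare` yields what is wanted or `y < x`, and the latter contradicts the
-- assumption.
≤-stable : ∀ {x y} → ¬ ¬ (x ≤ y) → x ≤ y
≤-stable {x} {y} ¬¬x≤y δ 0<δ = [ (λ h → h) , (λ y<x → ⊥-elim (¬¬x≤y (<⇒≱ {y} {x} y<x))) ]′ (compare x y δ 0<δ)

-- The integer part of `y / x` cannot be decided, so the search leaves slack: a comparison with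
-- tolerance below `x` either improves `y ≤ (4 + f) x` to `y ≤ (3 + f) x` or gives `(2 + f) x < y`.
-- The factor 3 comes from `3 + f ≤ 3 (1 + f)`.
multiple : ∀ {x y} → 0ℝ < x → x ≤ y → ∃[ k ] fromℕ (suc k) * x ≤ y × y ≤ fromℕ (3 ℕ.* suc k) * x
multiple {x} {y} (δ , 0<δ , δ≤x) x≤y = let (f , y≤) = fuel in
  search f (≤-trans {y} {fromℕ f * x} {fromℕ (3 ℕ.+ f) * x} y≤ (scale (ℕ.m≤n+m f 3)))
  where
  0≤x : Eventually (λ n → 0ℚ ℚ.≤ seq x n)
  0≤x = <⇒eventually-nonneg {x} (δ , 0<δ , δ≤x)
  scale : ∀ {i j} → i ℕ.≤ j → fromℕ i * x ≤ fromℕ j * x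
  scale {i} {j} i≤j = *-monoʳ-≤ {fromℕ i} {fromℕ j} {x} 0≤x (fromℕ-mono i≤j)
  fuel : ∃[ f ] y ≤ fromℕ f * x
  fuel = 
    let (b , 0<b , y≤b)  = eventually-bounded y
        (c , 0<c , δc≡b) = quotient 0<δ 0<b
        (f , c≤f) = archimedean c
        open ℚ.≤-Reasoning
    in f , eventually⇒≤ {y} {fromℕ f * x} (map₂ (λ n yn≤b δ≤xn → begin
         seq y n            ≤⟨ p≤∣p∣ (seq y n) ⟩
         ℚ.∣ seq y n ∣      ≤⟨ yn≤b ⟩
         b                  ≡⟨ sym δc≡b ⟩
         δ ℚ.* c            ≤⟨ *-monoʳ (ℚ.<⇒≤ 0<δ) c≤f ⟩
         δ ℚ.* ι f          ≡⟨ ℚ.*-comm δ (ι f) ⟩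
         ι f ℚ.* δ          ≤⟨ *-monoʳ (ι-mono {0} {f} ℕ.z≤n) (subst (ℚ._≤ seq x n) (ℚ.+-identityˡ δ) δ≤xn) ⟩
         ι f ℚ.* seq x n    ∎) y≤b δ≤x)
  done : ∀ f → fromℕ (suc f) * x ≤ y → y ≤ fromℕ (3 ℕ.+ f) * x →
         ∃[ k ] fromℕ (suc k) * x ≤ y × y ≤ fromℕ (3 ℕ.* suc k) * x
  done f l u = f , l , ≤-trans {y} {fromℕ (3 ℕ.+ f) * x} {fromℕ (3 ℕ.* suc f) * x} u
    (scale (subst (ℕ._≤ 3 ℕ.* suc f) (ℕ.+-comm f 3) (subst (f ℕ.+ 3 ℕ.≤_) (sym (ℕ.*-suc 3 f))
      (subst (ℕ._≤ 3 ℕ.+ 3 ℕ.* f) (ℕ.+-comm 3 f) (ℕ.+-monoʳ-≤ 3 (ℕ.m≤n*m f 3))))))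
  search : ∀ f → y ≤ fromℕ (3 ℕ.+ f) * x → ∃[ k ] fromℕ (suc k) * x ≤ y × y ≤ fromℕ (3 ℕ.* suc k) * x
  search zero    y≤ = done zero (≤-trans {fromℕ 1 * x} {x} {y} (proj₁ (pointwise⇒≃ {fromℕ 1 * x} {x} λ n → ℚ.*-identityˡ (seq x n))) x≤y) y≤
  search (suc f) y≤ = cases (compare y (fromℕ (2 ℕ.+ f) * x) δ 0<δ)
    where
    open ℚ.≤-Reasoning
    cases : Eventually (λ n → seq y n ℚ.≤ ι (2 ℕ.+ f) ℚ.* seq x n ℚ.+ δ) ⊎ fromℕ (2 ℕ.+ f) * x < y → _
    cases (inj₁ h) = search f (eventually⇒≤ {y} {fromℕ (3 ℕ.+ f) * x} (map₂ (λ n y≤ δ≤xn → begin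
      seq y n                                 ≤⟨ y≤ ⟩
      ι (2 ℕ.+ f) ℚ.* seq x n ℚ.+ δ           ≡⟨ ℚ.+-comm _ δ ⟩
      δ ℚ.+ ι (2 ℕ.+ f) ℚ.* seq x n           ≤⟨ ℚ.+-monoˡ-≤ (ι (2 ℕ.+ f) ℚ.* seq x n) (subst (ℚ._≤ seq x n) (ℚ.+-identityˡ δ) δ≤xn) ⟩
      seq x n ℚ.+ ι (2 ℕ.+ f) ℚ.* seq x n     ≡⟨ cong (ℚ._+ ι (2 ℕ.+ f) ℚ.* seq x n) (sym (ℚ.*-identityˡ (seq x n))) ⟩
      1ℚ ℚ.* seq x n ℚ.+ ι (2 ℕ.+ f) ℚ.* seq x n     ≡⟨ sym (ℚ.*-distribʳ-+ (seq x n) 1ℚ (ι (2 ℕ.+ f))) ⟩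
      (1ℚ ℚ.+ ι (2 ℕ.+ f)) ℚ.* seq x n        ≡⟨ cong (ℚ._* seq x n) (sym (ι-+ 1 (2 ℕ.+ f))) ⟩
      ι (3 ℕ.+ f) ℚ.* seq x n                 ∎) h δ≤x))
    cases (inj₂ h) = done (suc f) (<⇒≤ {fromℕ (2 ℕ.+ f) * x} {y} h) y≤

-- Expectations

module Weighted (S : ProbabilitySpace) where
  open ProbabilitySpace S

  event-and : ∀ {A B} → IsEvent A → IsEvent B → IsEvent (λ ω → A ω ∧ B ω)
  event-and {A} {B} a b = event-cong (λ ω → de-Morgan (A ω) (B ω)) (event-not (event-or (event-not a) (event-not b)))
    where
    de-Morgan : ∀ x y → not (not x ∨ not y) ≡ x ∧ y
    de-Morgan true  true  = refl
    de-Morgan true  false = refl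
    de-Morgan false _     = refl

  ℙ-≤ : ∀ {A B} (a : IsEvent A) (b : IsEvent B) → A ≗ B → ℙ A a ≤ ℙ B b
  ℙ-≤ a b A≗B = proj₁ (ℙ-cong a b A≗B)

  ℙ-split : ∀ {A B} (a : IsEvent A) (b : IsEvent B) →
            ℙ A a ≃ ℙ _ (event-and a b) + ℙ _ (event-and a (event-not b))
  ℙ-split {A} {B} a b =
      ≤-trans {ℙ A a} {ℙ _ u} {s} (ℙ-≤ a u (λ ω → cover (A ω) (B ω))) (proj₁ additive)
    , ≤-trans {s} {ℙ _ u} {ℙ A a} (proj₂ additive) (ℙ-≤ u a (λ ω → sym (cover (A ω) (B ω))))
    where
    l = event-and a b
    r = event-and a (event-not b)
    u = event-or l r
    s = ℙ _ l + ℙ _ r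
    disjoint : ∀ x y → (x ∧ y) ∧ (x ∧ not y) ≡ false
    disjoint false _     = refl
    disjoint true  true  = refl
    disjoint true  false = refl
    cover : ∀ x y → x ≡ (x ∧ y) ∨ (x ∧ not y)
    cover false _     = refl
    cover true  true  = refl
    cover true  false = refl
    additive : ℙ _ u ≃ s
    additive = ℙ-additive l r (λ ω → disjoint (A ω) (B ω))

  -- An empty event is disjoint from itself, so its probability is at least its own double.
  ℙ-empty : ∀ {A} (a : IsEvent A) → (∀ ω → A ω ≡ false) → ℙ A a ≤ 0ℝ
  ℙ-empty {A} a A≗∅ = cancel {ℙ A a} (≤-trans {ℙ A a + ℙ A a} {ℙ _ (event-or a a)} {ℙ A a}
    (proj₂ (ℙ-additive a a (λ ω → cong (λ x → x ∧ x) (A≗∅ ω))))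
    (ℙ-≤ (event-or a a) a (λ ω → ∨-idem (A ω))))
    where
    ∨-idem : ∀ x → x ∨ x ≡ x
    ∨-idem true  = refl
    ∨-idem false = refl
    cancel : ∀ {x} → x + x ≤ x → x ≤ 0ℝ
    cancel {x} h δ 0<δ = map₁ (λ n hn → subst (seq x n ℚ.≤_) (sym (ℚ.+-identityˡ δ))
      (+-cancelʳ-≤ (seq x n) (subst (seq x n ℚ.+ seq x n ℚ.≤_) (ℚ.+-comm (seq x n) δ) hn))) (h δ 0<δ)

  -- Lists of these are simple functions, as formal sums of multiples of indicators. The events may
  -- overlap, so adding functions is concatenation.
  WeightedEvent : Set
  WeightedEvent = ℕ × Σ[ B ∈ (Ω → Bool) ] IsEvent B

  total : List WeightedEvent → Ω → ℕ
  total []                ω = 0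
  total ((c , B , _) ∷ l) ω = (if B ω then c else 0) ℕ.+ total l ω

  integral : List WeightedEvent → ∀ {C} → IsEvent C → ℝ
  integral []                γ = 0ℝ
  integral ((c , B , b) ∷ l) γ = fromℕ c * ℙ _ (event-and γ b) + integral l γ

  integral-split : ∀ l {C D} (γ : IsEvent C) (d : IsEvent D) →
    integral l (event-and γ d) + integral l (event-and γ (event-not d)) ≤ integral l γ
  integral-split [] γ d = eventually⇒≤ {0ℝ + 0ℝ} {0ℝ} (eventually λ n → ℚ.≤-refl)
  integral-split ((c , B , b) ∷ l) {C} {D} γ d =
    ≤-trans {(fromℕ c * p₁ + i₁) + (fromℕ c * p₂ + i₂)} {fromℕ c * (p₁ + p₂) + (i₁ + i₂)} {fromℕ c * p + i}
      (proj₁ (pointwise⇒≃ {(fromℕ c * p₁ + i₁) + (fromℕ c * p₂ + i₂)} {fromℕ c * (p₁ + p₂) + (i₁ + i₂)}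
        (λ n → regroup (ι c) (seq p₁ n) (seq p₂ n) (seq i₁ n) (seq i₂ n))))
      (+-mono-≤ {fromℕ c * (p₁ + p₂)} {fromℕ c * p} {i₁ + i₂} {i}
        (*-monoˡ-≤ {p₁ + p₂} {p} {fromℕ c} (fromℕ-nonneg c)
          (≤-trans {p₁ + p₂} {q₁ + q₂} {p}
            (+-mono-≤ {p₁} {q₁} {p₂} {q₂}
              (ℙ-≤ (event-and (event-and γ d) b) (event-and (event-and γ b) d) (λ ω → swap (C ω) (D ω) (B ω)))
              (ℙ-≤ (event-and (event-and γ (event-not d)) b) (event-and (event-and γ b) (event-not d)) (λ ω → swap (C ω) (not (D ω)) (B ω))))
            (proj₂ (ℙ-split (event-and γ b) d))))
        (integral-split l γ d))
    where
    p  = ℙ _ (event-and γ b)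
    p₁ = ℙ _ (event-and (event-and γ d) b)
    p₂ = ℙ _ (event-and (event-and γ (event-not d)) b)
    q₁ = ℙ _ (event-and (event-and γ b) d)
    q₂ = ℙ _ (event-and (event-and γ b) (event-not d))
    i  = integral l γ
    i₁ = integral l (event-and γ d)
    i₂ = integral l (event-and γ (event-not d))
    swap : ∀ x y z → (x ∧ y) ∧ z ≡ (x ∧ z) ∧ y
    swap false _ _ = refl
    swap true y z = ∧-comm y z
    open +-*-Solver
    regroup : ∀ c p₁ p₂ i₁ i₂ → (c ℚ.* p₁ ℚ.+ i₁) ℚ.+ (c ℚ.* p₂ ℚ.+ i₂) ≡ c ℚ.* (p₁ ℚ.+ p₂) ℚ.+ (i₁ ℚ.+ i₂)
    regroup = solve 5 (λ c p₁ p₂ i₁ i₂ → (c :* p₁ :+ i₁) :+ (c :* p₂ :+ i₂) := c :* (p₁ :+ p₂) :+ (i₁ :+ i₂)) refl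

  -- Condition successively on each event of the list and on its complement.
  integral-bound : ∀ L l k {C} (γ : IsEvent C) → (∀ ω → C ω ≡ true → L ℕ.≤ k ℕ.+ total l ω) →
                   fromℕ L * ℙ C γ ≤ fromℕ k * ℙ C γ + integral l γ
  integral-bound L [] k {C} γ h = cases (L ℕ.≤? k)
    where
    p = ℙ C γ
    0≤ : ∀ x → x ≤ x + 0ℝ
    0≤ x = proj₁ (pointwise⇒≃ {x} {x + 0ℝ} (λ n → sym (ℚ.+-identityʳ (seq x n))))
    cases : Dec (L ℕ.≤ k) → fromℕ L * p ≤ fromℕ k * p + 0ℝ
    cases (yes L≤k) = ≤-trans {fromℕ L * p} {fromℕ k * p} {fromℕ k * p + 0ℝ} bound (0≤ (fromℕ k * p))
      where
      j = k ℕ.∸ L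
      step : ∀ n → ι L ℚ.* seq p n ℚ.+ ι j ℚ.* seq p n ≡ ι k ℚ.* seq p n
      step n = trans (sym (ℚ.*-distribʳ-+ (seq p n) (ι L) (ι j))) (cong (ℚ._* seq p n) (trans (sym (ι-+ L j)) (cong ι (ℕ.m+[n∸m]≡n L≤k))))
      nonneg : 0ℝ ≤ fromℕ j * p
      nonneg = ≤-trans {0ℝ} {fromℕ j * 0ℝ} {fromℕ j * p}
        (proj₁ (pointwise⇒≃ {0ℝ} {fromℕ j * 0ℝ} (λ n → sym (ℚ.*-zeroʳ (ι j)))))
        (*-monoˡ-≤ {0ℝ} {p} {fromℕ j} (fromℕ-nonneg j) (ℙ-nonneg γ))
      bound : fromℕ L * p ≤ fromℕ k * p
      bound = ≤-trans {fromℕ L * p} {fromℕ L * p + 0ℝ} {fromℕ k * p} (0≤ (fromℕ L * p))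
        (≤-trans {fromℕ L * p + 0ℝ} {fromℕ L * p + fromℕ j * p} {fromℕ k * p}
          (+-mono-≤ {fromℕ L * p} {fromℕ L * p} {0ℝ} {fromℕ j * p} (≤-refl {fromℕ L * p}) nonneg)
          (proj₁ (pointwise⇒≃ {fromℕ L * p + fromℕ j * p} {fromℕ k * p} step)))
    -- With no weights left and `k < L`, the assumed bound makes `C` empty.
    cases (no L≰k) = ≤-trans {fromℕ L * p} {0ℝ} {fromℕ k * p + 0ℝ} upper lower
      where
      empty : ∀ ω → C ω ≡ false
      empty ω with C ω in eq
      ... | false = refl
      ... | true  = ⊥-elim (L≰k (subst (L ℕ.≤_) (ℕ.+-identityʳ k) (h ω eq)))
      zero-* : ∀ m → fromℕ m * 0ℝ ≃ 0ℝ
      zero-* m = pointwise⇒≃ {fromℕ m * 0ℝ} {0ℝ} (λ n → ℚ.*-zeroʳ (ι m))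
      upper : fromℕ L * p ≤ 0ℝ
      upper = ≤-trans {fromℕ L * p} {fromℕ L * 0ℝ} {0ℝ}
        (*-monoˡ-≤ {p} {0ℝ} {fromℕ L} (fromℕ-nonneg L) (ℙ-empty γ empty)) (proj₁ (zero-* L))
      lower : 0ℝ ≤ fromℕ k * p + 0ℝ
      lower = ≤-trans {0ℝ} {fromℕ k * 0ℝ} {fromℕ k * p + 0ℝ} (proj₂ (zero-* k))
        (≤-trans {fromℕ k * 0ℝ} {fromℕ k * p} {fromℕ k * p + 0ℝ}
          (*-monoˡ-≤ {0ℝ} {p} {fromℕ k} (fromℕ-nonneg k) (ℙ-nonneg γ)) (0≤ (fromℕ k * p)))
  integral-bound L ((c , B , b) ∷ l) k {C} γ h =
    ≤-trans {fromℕ L * p} {fromℕ L * (p₁ + p₂)} {fromℕ k * p + (fromℕ c * p₁ + i)}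
      (*-monoˡ-≤ {p} {p₁ + p₂} {fromℕ L} (fromℕ-nonneg L) (proj₁ (ℙ-split γ b)))
    (≤-trans {fromℕ L * (p₁ + p₂)} {fromℕ L * p₁ + fromℕ L * p₂} {fromℕ k * p + (fromℕ c * p₁ + i)}
      (proj₁ (pointwise⇒≃ {fromℕ L * (p₁ + p₂)} {fromℕ L * p₁ + fromℕ L * p₂} (λ n → ℚ.*-distribˡ-+ (ι L) (seq p₁ n) (seq p₂ n))))
    (≤-trans {fromℕ L * p₁ + fromℕ L * p₂} {r₁ + r₂} {fromℕ k * p + (fromℕ c * p₁ + i)}
      -- On `B` the weight `c` joins the constant `k`; off `B` it contributes nothing.
      (+-mono-≤ {fromℕ L * p₁} {r₁} {fromℕ L * p₂} {r₂}
        (integral-bound L l (k ℕ.+ c) (event-and γ b) in-B)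
        (integral-bound L l k (event-and γ (event-not b)) off-B))
    (≤-trans {r₁ + r₂} {fromℕ k * (p₁ + p₂) + (fromℕ c * p₁ + (i₁ + i₂))} {fromℕ k * p + (fromℕ c * p₁ + i)}
      (proj₁ (pointwise⇒≃ {r₁ + r₂} {fromℕ k * (p₁ + p₂) + (fromℕ c * p₁ + (i₁ + i₂))}
        (λ n → trans (cong (λ z → (z ℚ.* seq p₁ n ℚ.+ seq i₁ n) ℚ.+ (ι k ℚ.* seq p₂ n ℚ.+ seq i₂ n)) (ι-+ k c))
                     (regroup (ι k) (ι c) (seq p₁ n) (seq p₂ n) (seq i₁ n) (seq i₂ n)))))
      (+-mono-≤ {fromℕ k * (p₁ + p₂)} {fromℕ k * p} {fromℕ c * p₁ + (i₁ + i₂)} {fromℕ c * p₁ + i}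
        (*-monoˡ-≤ {p₁ + p₂} {p} {fromℕ k} (fromℕ-nonneg k) (proj₂ (ℙ-split γ b)))
        (+-mono-≤ {fromℕ c * p₁} {fromℕ c * p₁} {i₁ + i₂} {i} (≤-refl {fromℕ c * p₁}) (integral-split l γ b))))))
    where
    p  = ℙ C γ
    p₁ = ℙ _ (event-and γ b)
    p₂ = ℙ _ (event-and γ (event-not b))
    i  = integral l γ
    i₁ = integral l (event-and γ b)
    i₂ = integral l (event-and γ (event-not b))
    r₁ = fromℕ (k ℕ.+ c) * p₁ + i₁
    r₂ = fromℕ k * p₂ + i₂
    open +-*-Solver
    regroup : ∀ k c p₁ p₂ i₁ i₂ → ((k ℚ.+ c) ℚ.* p₁ ℚ.+ i₁) ℚ.+ (k ℚ.* p₂ ℚ.+ i₂) ≡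
                                  k ℚ.* (p₁ ℚ.+ p₂) ℚ.+ (c ℚ.* p₁ ℚ.+ (i₁ ℚ.+ i₂))
    regroup = solve 6 (λ k c p₁ p₂ i₁ i₂ → ((k :+ c) :* p₁ :+ i₁) :+ (k :* p₂ :+ i₂) :=
                                  k :* (p₁ :+ p₂) :+ (c :* p₁ :+ (i₁ :+ i₂))) refl
    in-B : ∀ ω → C ω ∧ B ω ≡ true → L ℕ.≤ k ℕ.+ c ℕ.+ total l ω
    in-B ω eq with C ω in eqC | B ω in eqB | h ω
    ... | true | true | hω = subst (L ℕ.≤_) (sym (ℕ.+-assoc k c (total l ω))) (hω refl)
    off-B : ∀ ω → C ω ∧ not (B ω) ≡ true → L ℕ.≤ k ℕ.+ total l ω
    off-B ω eq with C ω in eqC | B ω in eqB | h ω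
    ... | true | false | hω = hω refl

  open SimpleVariable

  -- `w` times the variable, decomposed into its level sets below `m`; for `m` above its bound
  -- nothing is lost.
  layers : ℕ → SimpleVariable S → ℕ → List WeightedEvent
  layers w s zero    = []
  layers w s (suc m) = (w ℕ.* m , (λ ω → value s ω ℕ.≡ᵇ m) , measurable s m) ∷ layers w s m

  total-++ : ∀ l l′ ω → total (l ++ l′) ω ≡ total l ω ℕ.+ total l′ ω
  total-++ []                l′ ω = refl
  total-++ ((c , B , b) ∷ l) l′ ω = trans (cong (_ ℕ.+_) (total-++ l l′ ω)) (sym (ℕ.+-assoc (if B ω then c else 0) _ _))

  integral-++ : ∀ l l′ {C} (γ : IsEvent C) → integral (l ++ l′) γ ≤ integral l γ + integral l′ γ
  integral-++ []                l′ γ = proj₁ (pointwise⇒≃ {integral l′ γ} {0ℝ + integral l′ γ}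
    (λ n → sym (ℚ.+-identityˡ (seq (integral l′ γ) n))))
  integral-++ ((c , B , b) ∷ l) l′ γ =
    ≤-trans {p + integral (l ++ l′) γ} {p + (i + i′)} {p + i + i′}
      (+-mono-≤ {p} {p} {integral (l ++ l′) γ} {i + i′} (≤-refl {p}) (integral-++ l l′ γ))
      (proj₁ (pointwise⇒≃ {p + (i + i′)} {p + i + i′} (λ n → sym (ℚ.+-assoc (seq p n) (seq i n) (seq i′ n)))))
    where
    p = fromℕ c * ℙ _ (event-and γ b)
    i = integral l γ
    i′ = integral l′ γ

  layers-total : ∀ w s m ω → value s ω ℕ.< m → w ℕ.* value s ω ℕ.≤ total (layers w s m) ω
  layers-total w s (suc m) ω v≤m with value s ω ℕ.≡ᵇ m in eq | ℕ.≡ᵇ⇒≡ (value s ω) m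
  ... | true  | toEq rewrite toEq _ = ℕ.m≤m+n (w ℕ.* m) _
  ... | false | _ = layers-total w s m ω (ℕ.≤∧≢⇒< (ℕ.s≤s⁻¹ v≤m) (λ v≡m → subst Bool.T eq (ℕ.≡⇒≡ᵇ (value s ω) m v≡m)))

  layers-integral : ∀ w s m → integral (layers w s m) event-full ≤
                    fromℕ w * Σℝ m (λ u → fromℕ u * ℙ (λ ω → value s ω ℕ.≡ᵇ u) (measurable s u))
  layers-integral w s zero    = proj₁ (pointwise⇒≃ {0ℝ} {fromℕ w * 0ℝ} (λ n → sym (ℚ.*-zeroʳ (ι w))))
  layers-integral w s (suc m) =
    ≤-trans {fromℕ (w ℕ.* m) * p′ + i} {fromℕ (w ℕ.* m) * p + fromℕ w * σ} {fromℕ w * (σ + fromℕ m * p)}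
      (+-mono-≤ {fromℕ (w ℕ.* m) * p′} {fromℕ (w ℕ.* m) * p} {i} {fromℕ w * σ}
        (*-monoˡ-≤ {p′} {p} {fromℕ (w ℕ.* m)} (fromℕ-nonneg (w ℕ.* m)) (ℙ-≤ (event-and event-full (measurable s m)) (measurable s m) (λ _ → refl)))
        (layers-integral w s m))
      (proj₁ (pointwise⇒≃ {fromℕ (w ℕ.* m) * p + fromℕ w * σ} {fromℕ w * (σ + fromℕ m * p)}
        (λ n → trans (cong (λ z → z ℚ.* seq p n ℚ.+ ι w ℚ.* seq σ n) (ι-* w m)) (regroup (ι w) (ι m) (seq p n) (seq σ n)))))
    where
    p  = ℙ (λ ω → value s ω ℕ.≡ᵇ m) (measurable s m)
    p′ = ℙ _ (event-and event-full (measurable s m))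
    i  = integral (layers w s m) event-full
    σ  = Σℝ m (λ u → fromℕ u * ℙ (λ ω → value s ω ℕ.≡ᵇ u) (measurable s u))
    open +-*-Solver
    regroup : ∀ w m p s → w ℚ.* m ℚ.* p ℚ.+ w ℚ.* s ≡ w ℚ.* (s ℚ.+ m ℚ.* p)
    regroup = solve 4 (λ w m p s → w :* m :* p :+ w :* s := w :* (s :+ m :* p)) refl

  layers-mean : ∀ w s → integral (layers w s (suc (bound s))) event-full ≤ fromℕ w * mean s
  layers-mean w s =
    ≤-trans {integral (layers w s (suc (bound s))) event-full} {fromℕ w * σ} {fromℕ w * mean s}
      (layers-integral w s (suc (bound s)))
      (proj₁ (pointwise⇒≃ {fromℕ w * σ} {fromℕ w * mean s} (λ n → refl)))
    where
    σ = Σℝ (suc (bound s)) (λ u → fromℕ u * ℙ (λ ω → value s ω ℕ.≡ᵇ u) (measurable s u))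

  module _ {V : Set} (s : V → SimpleVariable S) (F : V → ℕ) (ρ : ℝ)
           (mean≤ : ∀ v → mean (s v) ≤ ρ * fromℕ (F v)) where

    all-layers : List (ℕ × V) → List WeightedEvent
    all-layers []            = []
    all-layers ((w , v) ∷ l) = layers w (s v) (suc (bound (s v))) ++ all-layers l

    all-layers-total : ∀ l ω → weightedSum l (λ v → value (s v) ω) ℕ.≤ total (all-layers l) ω
    all-layers-total []            ω = ℕ.z≤n
    all-layers-total ((w , v) ∷ l) ω = subst (weightedSum ((w , v) ∷ l) (λ v′ → value (s v′) ω) ℕ.≤_) (sym (total-++ (layers w (s v) (suc (bound (s v)))) (all-layers l) ω))
      (ℕ.+-mono-≤ (layers-total w (s v) (suc (bound (s v))) ω (ℕ.s≤s (bounded (s v) ω))) (all-layers-total l ω))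

    all-layers-integral : ∀ l → integral (all-layers l) event-full ≤ ρ * fromℕ (weightedSum l F)
    all-layers-integral [] = proj₁ (pointwise⇒≃ {0ℝ} {ρ * 0ℝ} (λ n → sym (ℚ.*-zeroʳ (seq ρ n))))
    all-layers-integral ((w , v) ∷ l) =
      ≤-trans {integral (l₁ ++ l₂) event-full} {i₁ + i₂} {r} (integral-++ l₁ l₂ event-full)
      (≤-trans {i₁ + i₂} {fromℕ w * (ρ * fromℕ (F v)) + ρ * fromℕ f} {r}
        (+-mono-≤ {i₁} {fromℕ w * (ρ * fromℕ (F v))} {i₂} {ρ * fromℕ f} head≤ (all-layers-integral l))
        (proj₁ (pointwise⇒≃ {fromℕ w * (ρ * fromℕ (F v)) + ρ * fromℕ f} {r} combine)))
      where
      l₁ = layers w (s v) (suc (bound (s v)))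
      l₂ = all-layers l
      i₁ = integral l₁ event-full
      i₂ = integral l₂ event-full
      f  = weightedSum l F
      r  = ρ * fromℕ (w ℕ.* F v ℕ.+ f)
      open +-*-Solver
      regroup : ∀ w r x y → w ℚ.* (r ℚ.* x) ℚ.+ r ℚ.* y ≡ r ℚ.* (w ℚ.* x ℚ.+ y)
      regroup = solve 4 (λ w r x y → w :* (r :* x) :+ r :* y := r :* (w :* x :+ y)) refl
      ι-linear : ι (w ℕ.* F v ℕ.+ f) ≡ ι w ℚ.* ι (F v) ℚ.+ ι f
      ι-linear = trans (ι-+ (w ℕ.* F v) f) (cong (ℚ._+ ι f) (ι-* w (F v)))
      combine : ∀ n → ι w ℚ.* (seq ρ n ℚ.* ι (F v)) ℚ.+ seq ρ n ℚ.* ι f ≡ seq ρ n ℚ.* ι (w ℕ.* F v ℕ.+ f)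
      combine n = trans (regroup (ι w) (seq ρ n) (ι (F v)) (ι f)) (cong (seq ρ n ℚ.*_) (sym ι-linear))
      head≤ : i₁ ≤ fromℕ w * (ρ * fromℕ (F v))
      head≤ = ≤-trans {i₁} {fromℕ w * mean (s v)} {fromℕ w * (ρ * fromℕ (F v))}
        (layers-mean w (s v))
        (*-monoˡ-≤ {mean (s v)} {ρ * fromℕ (F v)} {fromℕ w} (fromℕ-nonneg w) (mean≤ v))

    -- The averaging principle behind randomized lower bounds: a bound valid for every `ω` passes to
    -- the expectation, which is linear and hence at most the weighted sum of the bounds on the
    -- means.
    weightedSum-bound : ∀ l L → (∀ ω → L ℕ.≤ weightedSum l (λ v → value (s v) ω)) →
                        fromℕ L ≤ ρ * fromℕ (weightedSum l F)
    weightedSum-bound l L L≤ =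
      ≤-trans {fromℕ L} {fromℕ L * p} {r} normalise
      (≤-trans {fromℕ L * p} {0ℝ * p + i} {r}
        (integral-bound L (all-layers l) 0 event-full (λ ω _ → ℕ.≤-trans (L≤ ω) (all-layers-total l ω)))
      (≤-trans {0ℝ * p + i} {i} {r}
        (proj₁ (pointwise⇒≃ {0ℝ * p + i} {i} (λ n → trans (cong (ℚ._+ seq i n) (ℚ.*-zeroˡ (seq p n))) (ℚ.+-identityˡ (seq i n)))))
        (all-layers-integral l)))
      where
      p = ℙ _ event-full
      i = integral (all-layers l) event-full
      r = ρ * fromℕ (weightedSum l F)
      normalise : fromℕ L ≤ fromℕ L * p
      normalise = ≤-trans {fromℕ L} {fromℕ L * 1ℝ} {fromℕ L * p}
        (proj₁ (pointwise⇒≃ {fromℕ L} {fromℕ L * 1ℝ} (λ n → sym (ℚ.*-identityʳ (ι L)))))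
        (*-monoˡ-≤ {1ℝ} {p} {fromℕ L} (fromℕ-nonneg L) (proj₂ ℙ-full))

-- The lower bound

-- An optimal flow exists only up to double negation, which suffices because
-- the order of ℝ is stable.
optimal-exists : ∀ I {σ F₀} → Feasible I σ → TotalFlow I σ F₀ → ¬ ¬ (∃[ F ] IsOptimalFlow I F × F ℕ.≤ F₀)
optimal-exists I {σ} {F₀} feasible flow = go F₀ (σ , feasible , flow) ℕ.≤-refl
  where
  go : ∀ b {F} → ∃[ σ ] Feasible I σ × TotalFlow I σ F → F ℕ.≤ b → ¬ ¬ (∃[ F ] IsOptimalFlow I F × F ℕ.≤ b)
  go zero    {F} achieved F≤b none = none (F , (achieved , λ _ _ _ _ → ℕ.≤-trans F≤b z≤n) , F≤b)
  go (suc b) {F} achieved F≤b none = none (F , (achieved , λ σ F′ feasible′ flow′ →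
    ℕ.≮⇒≥ λ F′<F → go b (σ , feasible′ , flow′) (ℕ.≤-pred (ℕ.≤-trans F′<F F≤b))
      (λ (F″ , optimal , F″≤b) → none (F″ , optimal , ℕ.m≤n⇒m≤1+n F″≤b))) , F≤b)

-- Dividing by `y ≥ 1` only shrinks the error term, so the same `δ` serves.
cancel-scale : ∀ ρ a b y → 1 ℕ.≤ y → fromℕ (a ℕ.* y) ≤ ρ * fromℕ (b ℕ.* y) → fromℕ a ≤ ρ * fromℕ b
cancel-scale ρ a b y 1≤y h δ 0<δ = map₁ step (h δ 0<δ)
  where
  open ℚ.≤-Reasoning
  0<ιy : 0ℚ ℚ.< ι y
  0<ιy = ℚ.<-≤-trans (ℚ.positive⁻¹ 1ℚ) (ι-mono 1≤y)
  step : ∀ n → ι (a ℕ.* y) ℚ.≤ seq ρ n ℚ.* ι (b ℕ.* y) ℚ.+ δ → ι a ℚ.≤ seq ρ n ℚ.* ι b ℚ.+ δ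
  step n hn = ℚ.*-cancelʳ-≤-pos (ι y) ⦃ ℚ.positive 0<ιy ⦄ (begin
    ι a ℚ.* ι y                                    ≡⟨ ι-* a y ⟨
    ι (a ℕ.* y)                                    ≤⟨ hn ⟩
    r ℚ.* ι (b ℕ.* y) ℚ.+ δ                        ≡⟨ cong₂ (λ u v → r ℚ.* u ℚ.+ v) (ι-* b y) (sym (ℚ.*-identityʳ δ)) ⟩
    r ℚ.* (ι b ℚ.* ι y) ℚ.+ δ ℚ.* 1ℚ               ≤⟨ ℚ.+-monoʳ-≤ (r ℚ.* (ι b ℚ.* ι y)) (*-monoʳ (ℚ.<⇒≤ 0<δ) (ι-mono 1≤y)) ⟩
    r ℚ.* (ι b ℚ.* ι y) ℚ.+ δ ℚ.* ι y              ≡⟨ factor r (ι b) (ι y) δ ⟩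
    (r ℚ.* ι b ℚ.+ δ) ℚ.* ι y                      ∎)
    where
    r = seq ρ n
    factor : ∀ r b y d → r ℚ.* (b ℚ.* y) ℚ.+ d ℚ.* y ≡ (r ℚ.* b ℚ.+ d) ℚ.* y
    factor = solve 4 (λ r b y d → r :* (b :* y) :+ d :* y := (r :* b :+ d) :* y) refl
      where open +-*-Solver

scaled-≤ : ∀ a {m p x μ} → m ℕ.≤ a ℕ.* p → x ≤ μ → (∀ n → seq x n ≡ ι a) → fromℕ m ≤ μ * fromℕ p
scaled-≤ a {m} {p} {x} {μ} m≤ap x≤μ x≡a =
  ≤-trans {fromℕ m} {fromℕ (a ℕ.* p)} {μ * fromℕ p} (fromℕ-mono m≤ap)
  (≤-trans {fromℕ (a ℕ.* p)} {x * fromℕ p} {μ * fromℕ p}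
    (proj₁ (pointwise⇒≃ {fromℕ (a ℕ.* p)} {x * fromℕ p} (λ n → trans (ι-* a p) (cong (ℚ._* ι p) (sym (x≡a n))))))
    (*-monoʳ-≤ {x} {μ} {fromℕ p} (fromℕ-nonneg p) x≤μ))

-- A job of size p has threshold m, where suc m = min (p , s) and p = suc m + r.
threshold-≤ : ∀ {ε s} → ε ≤ 1ℝ → fromℕ s * ε ≤ 1ℝ → Eventually (λ n → 0ℚ ℚ.≤ seq ε n) → ∀ m r → suc m ℕ.≤ s →
              fromℕ m ≤ (1ℝ - ε) * fromℕ (suc m ℕ.+ r)
threshold-≤ {ε} {s} ε≤1 sε≤1 0≤ε m r m<s δ 0<δ = map₁ step (bound δ 0<δ)
  where
  open ℚ.≤-Reasoning
  bound : fromℕ (suc m) * ε + ε * fromℕ r ≤ 1ℝ + 1ℝ * fromℕ r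
  bound = +-mono-≤ {fromℕ (suc m) * ε} {1ℝ} {ε * fromℕ r} {1ℝ * fromℕ r}
    (≤-trans {fromℕ (suc m) * ε} {fromℕ s * ε} {1ℝ} (*-monoʳ-≤ {fromℕ (suc m)} {fromℕ s} {ε} 0≤ε (fromℕ-mono m<s)) sε≤1)
    (*-monoʳ-≤ {ε} {1ℝ} {fromℕ r} (fromℕ-nonneg r) ε≤1)
  step : ∀ n → ι (suc m) ℚ.* seq ε n ℚ.+ seq ε n ℚ.* ι r ℚ.≤ 1ℚ ℚ.+ 1ℚ ℚ.* ι r ℚ.+ δ →
         ι m ℚ.≤ (1ℚ ℚ.- seq ε n) ℚ.* ι (suc m ℕ.+ r) ℚ.+ δ
  step n h = +-cancelʳ-≤ X (begin
    ι m ℚ.+ X                                          ≤⟨ ℚ.+-monoʳ-≤ (ι m) h ⟩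
    ι m ℚ.+ (1ℚ ℚ.+ 1ℚ ℚ.* ι r ℚ.+ δ)                  ≡⟨ cong (λ z → ι m ℚ.+ (1ℚ ℚ.+ z ℚ.+ δ)) (ℚ.*-identityˡ (ι r)) ⟩
    ι m ℚ.+ (1ℚ ℚ.+ ι r ℚ.+ δ)                         ≡⟨ regroup 1ℚ (ι m) (ι r) δ ⟩
    (1ℚ ℚ.+ ι m ℚ.+ ι r) ℚ.+ δ                         ≡⟨ cong (ℚ._+ δ) (trans (cong (ℚ._+ ι r) (sym (ι-+ 1 m))) (sym (ℚ.*-identityˡ (ι (suc m) ℚ.+ ι r)))) ⟩
    1ℚ ℚ.* (ι (suc m) ℚ.+ ι r) ℚ.+ δ                   ≡⟨ regroup′ 1ℚ e (ι (suc m)) (ι r) δ ⟩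
    (1ℚ ℚ.- e) ℚ.* (ι (suc m) ℚ.+ ι r) ℚ.+ δ ℚ.+ X     ≡⟨ cong (λ z → (1ℚ ℚ.- e) ℚ.* z ℚ.+ δ ℚ.+ X) (ι-+ (suc m) r) ⟨
    (1ℚ ℚ.- e) ℚ.* ι (suc m ℕ.+ r) ℚ.+ δ ℚ.+ X         ∎)
    where
    e = seq ε n
    X = ι (suc m) ℚ.* e ℚ.+ e ℚ.* ι r
    regroup : ∀ u m r d → m ℚ.+ (u ℚ.+ r ℚ.+ d) ≡ (u ℚ.+ m ℚ.+ r) ℚ.+ d
    regroup = solve 4 (λ u m r d → m :+ (u :+ r :+ d) := (u :+ m :+ r) :+ d) refl
      where open +-*-Solver
    regroup′ : ∀ u e m r d → u ℚ.* (m ℚ.+ r) ℚ.+ d ≡ (u ℚ.- e) ℚ.* (m ℚ.+ r) ℚ.+ d ℚ.+ (m ℚ.* e ℚ.+ e ℚ.* r)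
    regroup′ = solve 5 (λ u e m r d → u :* (m :+ r) :+ d := (u :- e) :* (m :+ r) :+ d :+ (m :* e :+ e :* r)) refl
      where open +-*-Solver

-- Measurability of finite runs

module _ {Ω : Set} where

  -- Substitutes the random decision `d ω` into `ψ` by a finite union over its values, idling or a
  -- job below `N`; in this form it is built from events.
  branches : ℕ → (Ω → Decision) → (Decision → Ω → Bool) → Ω → Bool
  branches zero    d ψ ω = ⌊ ≡-dec ℕ._≟_ (d ω) nothing ⌋ ∧ ψ nothing ω
  branches (suc i) d ψ ω = branches i d ψ ω ∨ (⌊ ≡-dec ℕ._≟_ (d ω) (just i) ⌋ ∧ ψ (just i) ω)

  branches-nothing : ∀ N {d} ψ {ω} → d ω ≡ nothing → branches N d ψ ω ≡ ψ nothing ω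
  branches-nothing zero    {d} ψ {ω} eq rewrite eq = refl
  branches-nothing (suc i) {d} ψ {ω} eq = trans (cong₂ (λ x y → x ∨ (⌊ ≡-dec ℕ._≟_ y (just i) ⌋ ∧ ψ (just i) ω)) (branches-nothing i ψ eq) eq) (∨-identityʳ _)

  just-≡ : ∀ i → ⌊ ≡-dec ℕ._≟_ (just i) (just i) ⌋ ≡ true
  just-≡ i = trans (isYes≗does (≡-dec ℕ._≟_ (just i) (just i))) (dec-true (≡-dec ℕ._≟_ (just i) (just i)) refl)

  just-≢ : ∀ {i j} → j ≢ i → ⌊ ≡-dec ℕ._≟_ (just j) (just i) ⌋ ≡ false
  just-≢ {i} {j} j≢i = trans (isYes≗does (≡-dec ℕ._≟_ (just j) (just i)))
    (dec-false (≡-dec ℕ._≟_ (just j) (just i)) (λ eq → j≢i (just-injective eq)))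

  branches-early : ∀ N {d} ψ {ω j} → d ω ≡ just j → N ℕ.≤ j → branches N d ψ ω ≡ false
  branches-early zero    {d} ψ {ω} eq _ rewrite eq = refl
  branches-early (suc i) {d} ψ {ω} {j} eq i<j =
    trans (cong₂ (λ x y → x ∨ (⌊ ≡-dec ℕ._≟_ y (just i) ⌋ ∧ ψ (just i) ω)) (branches-early i ψ eq (ℕ.<⇒≤ i<j)) eq)
      (cong (_∧ ψ (just i) ω) (just-≢ (λ j≡i → ℕ.<⇒≢ i<j (sym j≡i))))

  branches-just : ∀ N {d} ψ {ω j} → d ω ≡ just j → j ℕ.< N → branches N d ψ ω ≡ ψ (just j) ω
  branches-just (suc i) {d} ψ {ω} {j} eq j<N with j ℕ.≟ i
  ... | yes refl =
    trans (cong₂ (λ x y → x ∨ (⌊ ≡-dec ℕ._≟_ y (just i) ⌋ ∧ ψ (just i) ω)) (branches-early i ψ eq ℕ.≤-refl) eq)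
      (cong (_∧ ψ (just i) ω) (just-≡ i))
  ... | no  j≢i  =
    trans (cong₂ (λ x y → x ∨ (⌊ ≡-dec ℕ._≟_ y (just i) ⌋ ∧ ψ (just i) ω)) (branches-just i ψ eq (ℕ.≤∧≢⇒< (ℕ.≤-pred j<N) j≢i)) eq)
      (trans (cong (λ b → ψ (just j) ω ∨ (b ∧ ψ (just i) ω)) (just-≢ j≢i)) (∨-identityʳ _))

module _ {ε μ₁ μ₂ : ℝ} (A : OnlineAlgorithm ε μ₁ μ₂) where
  open OnlineAlgorithm A
  open Weighted space

  event-const : ∀ b → IsEvent (λ _ → b)
  event-const true  = event-full
  event-const false = event-not event-full

  -- `measurable` speaks of fixed histories only. Peeling off the last decision shortens the random
  -- list at the cost of a union over its values, which feasibility confines to the jobs of the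
  -- instance.
  event-decisions : ∀ {I} → InModel ε μ₁ μ₂ I → ∀ t (φ : Ω → List Decision → Bool) →
    (∀ ds → IsEvent (λ ω → φ ω ds)) → IsEvent (λ ω → φ ω (decisions I (policy ω) t))
  event-decisions {I} inModel zero    φ event = event []
  event-decisions {I} inModel (suc t) φ event = event-cong agrees (event-decisions inModel t φ′ event′)
    where
    N = #jobs I
    next : List Decision → Ω → Decision
    next ds ω = policy ω (historyOf I ds)
    φ′ : Ω → List Decision → Bool
    φ′ ω ds = branches N (next ds) (λ d ω → φ ω (d ∷ ds)) ω
    event-branches : ∀ i ds → IsEvent (branches i (next ds) (λ d ω → φ ω (d ∷ ds)))
    event-branches zero    ds = event-and (measurable (historyOf I ds) nothing) (event (nothing ∷ ds))
    event-branches (suc i) ds = event-or (event-branches i ds) (event-and (measurable (historyOf I ds) (just i)) (event (just i ∷ ds)))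
    event′ : ∀ ds → IsEvent (λ ω → φ′ ω ds)
    event′ ds = event-branches N ds
    agrees : ∀ ω → φ′ ω (decisions I (policy ω) t) ≡ φ ω (decisions I (policy ω) (suc t))
    agrees ω = cases (run I (policy ω) t) refl
      where
      ds = decisions I (policy ω) t
      ψ : Decision → Ω → Bool
      ψ d ω = φ ω (d ∷ ds)
      cases : ∀ d → run I (policy ω) t ≡ d → branches N (next ds) ψ ω ≡ ψ (run I (policy ω) t) ω
      cases nothing  eq = trans (branches-nothing N ψ eq) (cong (λ d → ψ d ω) (sym eq))
      cases (just i) eq with feasible I inModel ω t i eq
      ... | j , refl , _ = trans (branches-just N ψ eq (toℕ<n j)) (cong (λ d → ψ d ω) (sym eq))

  decisionVariable : ∀ {I} → InModel ε μ₁ μ₂ I → ℕ → (g : List Decision → ℕ) (b : ℕ) → (∀ ds → g ds ℕ.≤ b) → SimpleVariable (OnlineAlgorithm.space A)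
  decisionVariable {I} inModel t g b g≤b = record
    { value      = λ ω → g (decisions I (policy ω) t)
    ; bound      = b
    ; bounded    = λ ω → g≤b (decisions I (policy ω) t)
    ; measurable = λ u → event-decisions inModel t (λ _ ds → g ds ℕ.≡ᵇ u) (λ ds → event-const (g ds ℕ.≡ᵇ u))
    }

before-run : ∀ I π t → before (run I π) t ≡ decisions I π t
before-run I π zero    = refl
before-run I π (suc t) = cong (run I π t ∷_) (before-run I π t)

-- From competitiveness to an averaged inequality

module Reduction {ε μ₁ μ₂ : ℝ} (k n M T s a : ℕ) (1≤a : 1 ℕ.≤ a) (1≤s : 1 ℕ.≤ s) (1≤M : 1 ℕ.≤ M) where
  open Adversary k n M T s a
  open Play 1≤a 1≤s

  module _ (inModel : ∀ v → InModel ε μ₁ μ₂ (inst v)) (A : OnlineAlgorithm ε μ₁ μ₂) (ρ : ℝ) (competitive : Competitive A ρ) where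
    open Weighted (OnlineAlgorithm.space A)

    -- A lower bound on the flow time that is bounded and depends on the decisions before `T` only,
    -- as `Expectation≤` requires of its test variables.
    variable-of : Vec (Fin (suc k)) n → SimpleVariable (OnlineAlgorithm.space A)
    variable-of v = decisionVariable A (inModel v) T (λ ds → M ℕ.* suc (alive v ds)) (M ℕ.* suc n)
      (λ ds → ℕ.*-monoʳ-≤ M (s≤s (alive≤n v ds)))

    below : ∀ v ω F → TotalFlow (inst v) (run (inst v) (OnlineAlgorithm.policy A ω)) F → SimpleVariable.value (variable-of v) ω ℕ.≤ F
    below v ω F flow = subst (λ ds → M ℕ.* suc (alive v ds) ℕ.≤ F) (before-run (inst v) (OnlineAlgorithm.policy A ω) T)
      (flow-lower v (OnlineAlgorithm.feasible A (inst v) (inModel v) ω) F flow)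

    mean≤optimal : ∀ v {F} → IsOptimalFlow (inst v) F → SimpleVariable.mean (variable-of v) ≤ ρ * fromℕ F
    mean≤optimal v {F} optimal = competitive (inst v) (inModel v) F optimal (variable-of v) (below v)

    greedy-flow : ∀ v → ¬ ¬ (∃[ F ] IsOptimalFlow (inst v) F × F ℕ.≤ flowBound n M T v)
    greedy-flow v none = optimal-exists (inst v) {G.σ} G.feasible G.totalFlow
      (λ (F , optimal , F≤) → none (F , optimal , ℕ.≤-trans F≤ G.flow≤flowBound))
      where
      module G = Greedy k n M T s a 1≤a 1≤s v

    1≤flow : ∀ v {F} → IsOptimalFlow (inst v) F → 1 ℕ.≤ F
    1≤flow v {F} ((σ , feasible , flow) , _) = ℕ.≤-trans (ℕ.*-mono-≤ 1≤M (s≤s z≤n)) (flow-lower v feasible F flow)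

    -- Competitiveness bounds a nonnegative mean by `ρ` times an optimal flow time, which is at
    -- least 1.
    0≤ρ : 0ℝ ≤ ρ
    0≤ρ = ≤-stable {0ℝ} {ρ} (λ 0≰ρ → greedy-flow v₀ (λ (F , optimal , _) → 0≰ρ (nonneg optimal)))
      where
      v₀ : Vec (Fin (suc k)) n
      v₀ = replicate n zero
      nonneg : ∀ {F} → IsOptimalFlow (inst v₀) F → 0ℝ ≤ ρ
      nonneg {F} optimal = ≤-trans {0ℝ} {ρ * fromℕ 1} {ρ}
        (cancel-scale ρ 0 1 (F ℕ.+ 0) (ℕ.≤-trans (1≤flow v₀ optimal) (ℕ.m≤m+n F 0))
          (subst (λ f → 0ℝ ≤ ρ * fromℕ f) (cong (ℕ._+ 0) (refl {x = F ℕ.+ 0}))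
            (weightedSum-bound {V = Vec (Fin (suc k)) n} (λ _ → variable-of v₀) (λ _ → F) ρ (λ _ → mean≤optimal v₀ optimal) ((1 , v₀) ∷ []) 0 (λ _ → z≤n))))
        (proj₁ (pointwise⇒≃ {ρ * fromℕ 1} {ρ} (λ n → ℚ.*-identityʳ (seq ρ n))))

    ρ-mono : ∀ {i j} → i ℕ.≤ j → ρ * fromℕ i ≤ ρ * fromℕ j
    ρ-mono {i} {j} i≤j =
      ≤-trans {ρ * fromℕ i} {ρ * fromℕ i + 0ℝ * fromℕ d} {ρ * fromℕ j}
        (proj₁ (pointwise⇒≃ {ρ * fromℕ i} {ρ * fromℕ i + 0ℝ * fromℕ d} (λ n → lower (seq ρ n))))
      (≤-trans {ρ * fromℕ i + 0ℝ * fromℕ d} {ρ * fromℕ i + ρ * fromℕ d} {ρ * fromℕ j}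
        (+-mono-≤ {ρ * fromℕ i} {ρ * fromℕ i} {0ℝ * fromℕ d} {ρ * fromℕ d} (≤-refl {ρ * fromℕ i})
          (*-monoʳ-≤ {0ℝ} {ρ} {fromℕ d} (fromℕ-nonneg d) 0≤ρ))
        (proj₁ (pointwise⇒≃ {ρ * fromℕ i + ρ * fromℕ d} {ρ * fromℕ j} (λ n → upper (seq ρ n)))))
      where
      d = j ℕ.∸ i
      lower : ∀ r → r ℚ.* ι i ≡ r ℚ.* ι i ℚ.+ ι 0 ℚ.* ι d
      lower r = sym (trans (cong (r ℚ.* ι i ℚ.+_) (ℚ.*-zeroˡ (ι d))) (ℚ.+-identityʳ (r ℚ.* ι i)))
      upper : ∀ r → r ℚ.* ι i ℚ.+ r ℚ.* ι d ≡ r ℚ.* ι j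
      upper r = trans (sym (ℚ.*-distribˡ-+ r (ι i) (ι d))) (cong (r ℚ.*_) (trans (sym (ι-+ i d)) (cong ι (ℕ.m+[n∸m]≡n i≤j))))

    -- Enlarging the optimum to `flowBound` preserves the inequality because `0 ≤ ρ`.
    mean≤ : ∀ v → SimpleVariable.mean (variable-of v) ≤ ρ * fromℕ (flowBound n M T v)
    mean≤ v = ≤-stable {x} {ρ * fromℕ (flowBound n M T v)} (λ x≰ → greedy-flow v (λ (F , optimal , F≤) → x≰ (via optimal F≤)))
      where
      x = SimpleVariable.mean (variable-of v)
      via : ∀ {F} → IsOptimalFlow (inst v) F → F ℕ.≤ flowBound n M T v → x ≤ ρ * fromℕ (flowBound n M T v)
      via {F} optimal F≤ = ≤-trans {x} {ρ * fromℕ F} {ρ * fromℕ (flowBound n M T v)} (mean≤optimal v optimal) (ρ-mono F≤)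

    -- `L` is a bound for every policy, hence for every `ω`, so `weightedSum-bound` applies to the
    -- list that represents `E`.
    transfer : ∀ L Q → (∀ π → L ℕ.≤ E k n (λ v → M ℕ.* suc (alive v (decisions (inst v) π T)))) →
               E k n (flowBound n M T) ℕ.≤ Q → fromℕ L ≤ ρ * fromℕ Q
    transfer L Q L≤ ≤Q =
      ≤-trans {fromℕ L} {ρ * fromℕ (weightedSum l (flowBound n M T))} {ρ * fromℕ Q}
        (weightedSum-bound variable-of (flowBound n M T) ρ mean≤ l L
          (λ ω → subst (L ℕ.≤_) (sym (l≡E (λ v → M ℕ.* suc (alive v (decisions (inst v) (OnlineAlgorithm.policy A ω) T))))) (L≤ (OnlineAlgorithm.policy A ω))))
        (ρ-mono (subst (ℕ._≤ Q) (sym (l≡E (flowBound n M T))) ≤Q))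
      where
      l = proj₁ (E-list k n)
      l≡E = proj₂ (E-list k n)

-- Membership in the model and the final constant

inModel-adversary : ∀ {ε μ₁ μ₂} k s a b (1≤a : 1 ℕ.≤ a) (1≤s : 1 ℕ.≤ s) → 1 ℕ.≤ b → suc k ℕ.≤ b ℕ.* (a ℕ.* s) →
  fromℕ a * 1ℝ ≤ μ₁ → fromℕ b * 1ℝ ≤ μ₂ → fromℕ s * ε ≤ 1ℝ → 0ℝ < ε → ε ≤ 1ℝ →
  ∀ n M T v → InModel ε μ₁ μ₂ (Adversary.Play.inst k n M T s a 1≤a 1≤s v)
inModel-adversary {ε} {μ₁} {μ₂} k s a b 1≤a 1≤s 1≤b K≤ a≤μ₁ b≤μ₂ sε≤1 0<ε ε≤1 n M T v = record
  { estimate-upper  = λ j → upper (size v (toℕ j))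
  ; estimate-lower  = λ j → lower (size v (toℕ j)) (size≤ v (toℕ j))
  ; threshold-upper = λ j → threshold≤ (size v (toℕ j)) (size≥1 v (toℕ j))
  }
  where
  open Adversary k n M T s a
  estimate≤ : ∀ p → estimateOf p ℕ.≤ a ℕ.* p
  estimate≤ p with s ℕ.≤? p
  ... | yes s≤p = subst (ℕ._≤ a ℕ.* p) (sym (cong (if_then p else a ℕ.* s) (dec-false (p ℕ.<? s) (ℕ.≤⇒≯ s≤p)))) (ℕ.*-monoʳ-≤ a s≤p)
  ... | no  s≰p = subst (ℕ._≤ a ℕ.* p) (sym (cong (if_then p else a ℕ.* s) (dec-true (p ℕ.<? s) (ℕ.≰⇒> s≰p))))
                    (ℕ.≤-trans (ℕ.≤-reflexive (sym (ℕ.*-identityˡ p))) (ℕ.*-monoˡ-≤ p 1≤a))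
  ≤estimate : ∀ p → p ℕ.≤ suc k → p ℕ.≤ b ℕ.* estimateOf p
  ≤estimate p p≤K with s ℕ.≤? p
  ... | yes s≤p = subst (λ e → p ℕ.≤ b ℕ.* e) (sym (cong (if_then p else a ℕ.* s) (dec-false (p ℕ.<? s) (ℕ.≤⇒≯ s≤p)))) (ℕ.≤-trans p≤K K≤)
  ... | no  s≰p = subst (λ e → p ℕ.≤ b ℕ.* e) (sym (cong (if_then p else a ℕ.* s) (dec-true (p ℕ.<? s) (ℕ.≰⇒> s≰p))))
                    (ℕ.≤-trans (ℕ.≤-reflexive (sym (ℕ.*-identityˡ p))) (ℕ.*-monoˡ-≤ p 1≤b))
  upper : ∀ p → fromℕ (estimateOf p) ≤ μ₁ * fromℕ p
  upper p = scaled-≤ a {estimateOf p} {p} {fromℕ a * 1ℝ} {μ₁} (estimate≤ p) a≤μ₁ (λ n → ℚ.*-identityʳ (ι a))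
  lower : ∀ p → p ℕ.≤ suc k → fromℕ p ≤ μ₂ * fromℕ (estimateOf p)
  lower p p≤K = scaled-≤ b {p} {estimateOf p} {fromℕ b * 1ℝ} {μ₂} (≤estimate p p≤K) b≤μ₂ (λ n → ℚ.*-identityʳ (ι b))
  threshold≤ : ∀ p → 1 ℕ.≤ p → fromℕ (thresholdOf p) ≤ (1ℝ - ε) * fromℕ p
  threshold≤ p 1≤p = subst (λ q → fromℕ (thresholdOf p) ≤ (1ℝ - ε) * fromℕ q) (trans (cong (ℕ._+ r) suc-threshold) (ℕ.m+[n∸m]≡n (ℕ.m⊓n≤m p s)))
    (threshold-≤ {ε} {s} ε≤1 sε≤1 (<⇒eventually-nonneg {ε} 0<ε) (thresholdOf p) r (subst (ℕ._≤ s) (sym suc-threshold) (ℕ.m⊓n≤n p s)))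
    where
    r = p ℕ.∸ (p ℕ.⊓ s)
    suc-threshold : suc (thresholdOf p) ≡ p ℕ.⊓ s
    suc-threshold = ℕ.suc-pred (p ℕ.⊓ s) ⦃ ℕ.>-nonZero (ℕ.⊓-glb 1≤p 1≤s) ⦄

1/-nonneg : ∀ y (0<y : 0ℝ < y) → Eventually (λ n → 0ℚ ℚ.≤ seq (1/ y by 0<y) n)
1/-nonneg y (d , 0<d , N , d≤y) = eventually (λ n → ℚ.<⇒≤ (ℚ.positive⁻¹ (Inverse.r n) ⦃ Inverse.r-pos n ⦄))
  where module Inverse = Reciprocal {y} {d} {N} 0<d d≤y

*-1/ : ∀ y (0<y : 0ℝ < y) → Eventually (λ n → seq y n ℚ.* seq (1/ y by 0<y) n ≡ 1ℚ)
*-1/ y (d , 0<d , N , d≤y) = N , λ n N≤n →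
  trans (cong (ℚ._* Inverse.r n) (sym (Inverse.y⁺≡y n N≤n))) (trans (ℚ.*-comm (Inverse.y⁺ n) (Inverse.r n)) (Inverse.inverse n))
  where module Inverse = Reciprocal {y} {d} {N} 0<d d≤y

1/-≤ : ∀ y (0<y : 0ℝ < y) m → 1ℝ ≤ fromℕ m * y → 1/ y by 0<y ≤ fromℕ m
1/-≤ y 0<y m 1≤my =
  ≤-trans {i} {1ℝ * i} {fromℕ m} (proj₁ (pointwise⇒≃ {i} {1ℝ * i} (λ n → sym (ℚ.*-identityˡ (seq i n)))))
  (≤-trans {1ℝ * i} {fromℕ m * y * i} {fromℕ m} (*-monoʳ-≤ {1ℝ} {fromℕ m * y} {i} (1/-nonneg y 0<y) 1≤my)
    (eventually⇒≤ {fromℕ m * y * i} {fromℕ m} (map₁ (λ n yi≡1 → ℚ.≤-reflexive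
      (trans (ℚ.*-assoc (ι m) (seq y n) (seq i n)) (trans (cong (ι m ℚ.*_) yi≡1) (ℚ.*-identityʳ (ι m))))) (*-1/ y 0<y))))
  where
  i = 1/ y by 0<y

theorem1p3 : ∃[ c ] 0ℝ < c × (∀ (μ₁ μ₂ ε : ℝ) → 1ℝ ≤ μ₁ → 1ℝ ≤ μ₂ → (0<ε : 0ℝ < ε) → ε ≤ 1ℝ →
    (A : OnlineAlgorithm ε μ₁ μ₂) → CompetitiveRatio≥ A (c * (μ₁ * μ₂) * 1/ ε by 0<ε))
theorem1p3 = fromℚ c₀ , (c₀ , ℚ.positive⁻¹ c₀ , 0 , λ _ _ → ℚ.≤-reflexive (ℚ.+-identityˡ c₀)) , λ μ₁ μ₂ ε 1≤μ₁ 1≤μ₂ 0<ε ε≤1 A ρ competitive →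
    lower-bound μ₁ μ₂ ε 0<ε ε≤1 A ρ competitive (multiple {1ℝ} {μ₁} 0<1 1≤μ₁) (multiple {1ℝ} {μ₂} 0<1 1≤μ₂) (multiple {ε} {1ℝ} 0<ε ε≤1)
  where
  -- `648 = 24 * 27`: 24 relates the two averaged flow times, and `27 = 3³` is lost in rounding
  -- `μ₁`, `μ₂` and `1 / ε` to integers.
  c₀ : ℚ
  c₀ = ℤ.+ 1 ℚ./ 648
  0<1 : 0ℝ < 1ℝ
  0<1 = 1ℚ , ℚ.positive⁻¹ 1ℚ , 0 , λ _ _ → ℚ.≤-reflexive (ℚ.+-identityˡ 1ℚ)
  lower-bound : ∀ μ₁ μ₂ ε (0<ε : 0ℝ < ε) → ε ≤ 1ℝ → (A : OnlineAlgorithm ε μ₁ μ₂) (ρ : ℝ) → Competitive A ρ →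
    ∃[ a ] fromℕ (suc a) * 1ℝ ≤ μ₁ × μ₁ ≤ fromℕ (3 ℕ.* suc a) * 1ℝ →
    ∃[ b ] fromℕ (suc b) * 1ℝ ≤ μ₂ × μ₂ ≤ fromℕ (3 ℕ.* suc b) * 1ℝ →
    ∃[ s ] fromℕ (suc s) * ε ≤ 1ℝ × 1ℝ ≤ fromℕ (3 ℕ.* suc s) * ε →
    fromℚ c₀ * (μ₁ * μ₂) * 1/ ε by 0<ε ≤ ρ
  lower-bound μ₁ μ₂ ε 0<ε ε≤1 A ρ competitive (a′ , a≤μ₁ , μ₁≤) (b′ , b≤μ₂ , μ₂≤) (s′ , sε≤1 , 1≤3sε) =
    ≤-trans {fromℚ c₀ * (μ₁ * μ₂) * i} {fromℚ c₀ * (μ₁ * μ₂ * i)} {ρ}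
      (proj₁ (pointwise⇒≃ {fromℚ c₀ * (μ₁ * μ₂) * i} {fromℚ c₀ * (μ₁ * μ₂ * i)} (λ n → ℚ.*-assoc c₀ (seq (μ₁ * μ₂) n) (seq i n))))
    (≤-trans {fromℚ c₀ * (μ₁ * μ₂ * i)} {fromℚ c₀ * (ρ * fromℕ 648)} {ρ}
      (*-monoˡ-≤ {μ₁ * μ₂ * i} {ρ * fromℕ 648} {fromℚ c₀} (eventually λ _ → ℚ.<⇒≤ (ℚ.positive⁻¹ c₀)) μ₁μ₂i≤)
      (proj₁ (pointwise⇒≃ {fromℚ c₀ * (ρ * fromℕ 648)} {ρ} (λ n → cancel (seq ρ n)))))
    where
    i = 1/ ε by 0<ε
    a = suc a′
    b = suc b′
    s = suc s′
    cancel : ∀ r → c₀ ℚ.* (r ℚ.* ι 648) ≡ r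
    cancel r = trans (cong (c₀ ℚ.*_) (ℚ.*-comm r (ι 648))) (trans (sym (ℚ.*-assoc c₀ (ι 648) r)) (ℚ.*-identityˡ r))
    k = ℕ.pred (b ℕ.* (a ℕ.* s))
    -- `refl` suffices because `a`, `b` and `s` are successors, so their product computes to a
    -- successor and `pred` is undone.
    K≡ : suc k ≡ b ℕ.* (a ℕ.* s)
    K≡ = refl
    open Parameters k using (n; M; T; 1≤M; unit; 1≤unit; E-flow-lower; E-flowBound)
    open Reduction {ε} {μ₁} {μ₂} k n M T s a (s≤s z≤n) (s≤s z≤n) 1≤M
    K≤ : fromℕ (suc k) ≤ ρ * fromℕ 24
    K≤ = cancel-scale ρ (suc k) 24 unit 1≤unit
      (transfer (inModel-adversary {ε} {μ₁} {μ₂} k s a b (s≤s z≤n) (s≤s z≤n) (s≤s z≤n) (ℕ.≤-reflexive K≡) a≤μ₁ b≤μ₂ sε≤1 0<ε ε≤1 n M T) A ρ competitive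
        (suc k ℕ.* unit) (24 ℕ.* unit) (E-flow-lower s a (s≤s z≤n) (s≤s z≤n)) E-flowBound)
    x y z : ℕ
    x = 3 ℕ.* a
    y = 3 ℕ.* b
    z = 3 ℕ.* s
    nonneg-μ₂ : Eventually (λ n → 0ℚ ℚ.≤ seq μ₂ n)
    nonneg-μ₂ = <⇒eventually-nonneg {μ₂} (half-below b≤μ₂)
      where
      half-below : fromℕ b * 1ℝ ≤ μ₂ → 0ℝ < μ₂
      half-below h = ½ , ℚ.positive⁻¹ ½ , map₁ (λ n hn → +-cancelʳ-≤ ½ (ℚ.≤-trans (ℚ.≤-trans (ι-mono {1} {b} (s≤s z≤n)) (ℚ.≤-reflexive (sym (ℚ.*-identityʳ (ι b))))) hn)) (h ½ (ℚ.positive⁻¹ ½))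
    μ₁≤x : μ₁ ≤ fromℕ x
    μ₁≤x = ≤-trans {μ₁} {fromℕ x * 1ℝ} {fromℕ x} μ₁≤ (proj₁ (pointwise⇒≃ {fromℕ x * 1ℝ} {fromℕ x} (λ n → ℚ.*-identityʳ (ι x))))
    μ₂≤y : μ₂ ≤ fromℕ y
    μ₂≤y = ≤-trans {μ₂} {fromℕ y * 1ℝ} {fromℕ y} μ₂≤ (proj₁ (pointwise⇒≃ {fromℕ y * 1ℝ} {fromℕ y} (λ n → ℚ.*-identityʳ (ι y))))
    μ₁μ₂i≤xyz : μ₁ * μ₂ * i ≤ fromℕ x * fromℕ y * fromℕ z
    μ₁μ₂i≤xyz = ≤-trans {μ₁ * μ₂ * i} {fromℕ x * fromℕ y * i} {fromℕ x * fromℕ y * fromℕ z}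
      (*-monoʳ-≤ {μ₁ * μ₂} {fromℕ x * fromℕ y} {i} (1/-nonneg ε 0<ε)
        (≤-trans {μ₁ * μ₂} {fromℕ x * μ₂} {fromℕ x * fromℕ y}
          (*-monoʳ-≤ {μ₁} {fromℕ x} {μ₂} nonneg-μ₂ μ₁≤x)
          (*-monoˡ-≤ {μ₂} {fromℕ y} {fromℕ x} (fromℕ-nonneg x) μ₂≤y)))
      (*-monoˡ-≤ {i} {fromℕ z} {fromℕ x * fromℕ y} (eventually λ _ → subst (0ℚ ℚ.≤_) (ι-* x y) (ι-mono {0} {x ℕ.* y} z≤n)) (1/-≤ ε 0<ε z 1≤3sε))
    μ₁μ₂i≤ : μ₁ * μ₂ * i ≤ ρ * fromℕ 648
    μ₁μ₂i≤ = ≤-trans {μ₁ * μ₂ * i} {fromℕ x * fromℕ y * fromℕ z} {ρ * fromℕ 648} μ₁μ₂i≤xyz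
      (≤-trans {fromℕ x * fromℕ y * fromℕ z} {fromℕ (suc k) * fromℕ 27} {ρ * fromℕ 648}
        (proj₁ (pointwise⇒≃ {fromℕ x * fromℕ y * fromℕ z} {fromℕ (suc k) * fromℕ 27} (λ _ → rearrange)))
      (≤-trans {fromℕ (suc k) * fromℕ 27} {ρ * fromℕ 24 * fromℕ 27} {ρ * fromℕ 648}
        (*-monoʳ-≤ {fromℕ (suc k)} {ρ * fromℕ 24} {fromℕ 27} (fromℕ-nonneg 27) K≤)
        (proj₁ (pointwise⇒≃ {ρ * fromℕ 24 * fromℕ 27} {ρ * fromℕ 648} (λ n → ℚ.*-assoc (seq ρ n) (ι 24) (ι 27))))))
      where
      product : ∀ a b s → 3 ℕ.* a ℕ.* (3 ℕ.* b) ℕ.* (3 ℕ.* s) ≡ b ℕ.* (a ℕ.* s) ℕ.* 27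
      product = solve-∀
      rearrange : ι x ℚ.* ι y ℚ.* ι z ≡ ι (suc k) ℚ.* ι 27
      rearrange = trans (cong (ℚ._* ι z) (sym (ι-* x y))) (trans (sym (ι-* (x ℕ.* y) z)) (trans (cong ι (product a b s)) (ι-* (suc k) 27)))
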